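{- There is a deterministic algorithm which, given a field $\mathbb{F}$, a nonconstant polynomial $f\in\mathbb{F}[x_1,\ldots,x_n]$ in sparse representation and an integer $e\ge 2$, computes a polynomial $g\in\mathbb{F}[x_1,\ldots,x_n]$ such that $g^e=f$, or determines that no such $g$ exists. Writing $s=\|f\|_0$, $d=\operatorname{indeg}(f)$ and $D=\operatorname{tdeg}(f)$, its running time is \[ \operatorname{poly}\bigl(s^{O(Dd)},n,d,D\bigr)+s\cdot R(e), \] where $R(e)$ denotes the cost of constructing a single $e$-th root of a scalar in the base field $\mathbb{F}$ and, when $\operatorname{char}(\mathbb{F})\mid e$, the cost of computing a single Frobenius root of a scalar (including both existence testing and construction).
   Context: For a polynomial $P$, $\|P\|_0$ is the number of monomials occurring in $P$ with nonzero coefficient. For nonzero $P$, $\operatorname{tdeg}(P)$ is its total degree, and $\operatorname{indeg}(P)$ is its individual degree (the maximum exponent of any single variable in any monomial of $P$). The sparse representation of $P$ is the list of its nonzero terms (coefficient, exponent vector). The implied constants and the polynomial are absolute. Running time is counted in operations on sparse polynomials: arithmetic operations in $\mathbb{F}$ and operations on exponent vectors have unit cost, while testing for existence of and constructing roots of scalars is charged separately through $R(e)$. If $p=\operatorname{char}(\mathbb{F})>0$ divides $e$ and $e=p^rq$ with $p\nmid q$, a Frobenius root of a scalar $A\in\mathbb{F}$ is the (unique, if it exists) element $B\in\mathbb{F}$ with $B^{p^r}=A$. -}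

module Defs where

open import Level using (Level; Lift; lift; lower; _⊔_) renaming (suc to lsuc)
open import Algebra.Bundles using (Semiring; CommutativeRing)
import Algebra.Definitions.RawSemiring as RawSemiringDefs
open import Data.List.Base using (List; []; _∷_; map; foldr; concatMap; length)
open import Data.List.Membership.Propositional using (_∈_)
open import Data.List.Relation.Unary.All using (All; []; _∷_; lookup)
open import Data.List.Relation.Unary.Unique.Propositional using (Unique)
open import Data.Maybe.Base using (Maybe; just; nothing)
open import Data.Nat.Base using (ℕ; zero; suc; _+_; _*_; _∸_; _^_; _≤_; _<_)
  renaming (_⊔_ to _⊔ⁿ_)
open import Data.Nat.Divisibility using (_∣_)
open import Data.Nat.Properties using (_≤?_) renaming (_≟_ to _≟ⁿ_)
open import Data.Product.Base using (Σ; ∃; _×_; _,_; proj₁; proj₂)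
open import Data.Vec.Base as Vec using (Vec; toList; zipWith; replicate)
open import Data.Vec.Properties using (≡-dec)
open import Function.Base using (_∘_)
open import Relation.Binary.Definitions using (Decidable)
open import Relation.Binary.PropositionalEquality.Core using (_≡_)
open import Relation.Nullary using (¬_; Dec; yes; no)

------------------------------------------------------------------------
-- Fields

-- Equality is decidable because zero tests are among the unit-cost
-- operations.  The value of 0# ⁻¹ is left unspecified.
record Field (a ℓ : Level) : Set (lsuc (a ⊔ ℓ)) where
  field
    commutativeRing : CommutativeRing a ℓ
  open CommutativeRing commutativeRing public
    renaming (_+_ to _+ᶠ_; _*_ to _*ᶠ_; -_ to -ᶠ_)
  field
    _≟_   : Decidable _≈_
    1≉0   : ¬ (1# ≈ 0#)
    _⁻¹   : Carrier → Carrier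
    *-inv : ∀ x → ¬ (x ≈ 0#) → x *ᶠ (x ⁻¹) ≈ 1#
  open RawSemiringDefs (Semiring.rawSemiring semiring) public
    using () renaming (_^_ to _^ᶠ_; _×_ to _×ᶠ_)

record HasPositiveChar {a ℓ} (F : Field a ℓ) (p : ℕ) : Set ℓ where
  open Field F
  field
    positive   : 0 < p
    vanishes   : p ×ᶠ 1# ≈ 0#
    isMinimal  : ∀ m → 0 < m → m ×ᶠ 1# ≈ 0# → p ≤ m

------------------------------------------------------------------------
-- Polynomials

module _ {a ℓ} (F : Field a ℓ) where
  open Field F

  Term : ℕ → Set a
  Term n = Carrier × Vec ℕ n

  -- Formal sums of terms; monomials may repeat and coefficients may be
  -- zero.  Polynomials are identified through _≋_ below.
  Poly : ℕ → Set a
  Poly n = List (Term n)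

  -- The terms of a sparse representation may come in any order.
  record SparsePoly (n : ℕ) : Set (a ⊔ ℓ) where
    field
      terms    : Poly n
      nonzero  : All (λ t → ¬ (proj₁ t ≈ 0#)) terms
      distinct : Unique (map proj₂ terms)

module PolyArithmetic {a ℓ} (F : Field a ℓ) {n : ℕ} where
  open Field F

  coeff : Poly F n → Vec ℕ n → Carrier
  coeff []            u = 0#
  coeff ((c , v) ∷ P) u with ≡-dec _≟ⁿ_ v u
  ... | yes _ = c +ᶠ coeff P u
  ... | no  _ = coeff P u

  infix 4 _≋_
  _≋_ : Poly F n → Poly F n → Set ℓ
  P ≋ Q = ∀ u → coeff P u ≈ coeff Q u

  constant : Carrier → Poly F n
  constant c = (c , replicate n 0) ∷ []

  infixl 7 _·_
  _·_ : Poly F n → Poly F n → Poly F n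
  P · Q = concatMap (λ (c , u) → map (λ (d , v) → c *ᶠ d , zipWith _+_ u v) Q) P

  infixr 8 _^ᵖ_
  _^ᵖ_ : Poly F n → ℕ → Poly F n
  P ^ᵖ zero  = constant 1#
  P ^ᵖ suc k = P · P ^ᵖ k

module _ {a ℓ} {F : Field a ℓ} {n : ℕ} where
  open SparsePoly
  open PolyArithmetic F

  NonConstant : SparsePoly F n → Set (a ⊔ ℓ)
  NonConstant f = ¬ (∃ λ c → terms f ≋ constant c)

  ‖_‖₀ : SparsePoly F n → ℕ
  ‖ f ‖₀ = length (terms f)

  tdeg : SparsePoly F n → ℕ
  tdeg f = foldr _⊔ⁿ_ 0 (map (Vec.sum ∘ proj₂) (terms f))

  indeg : SparsePoly F n → ℕ
  indeg f = foldr _⊔ⁿ_ 0 (map (Vec.foldr _ _⊔ⁿ_ 0 ∘ proj₂) (terms f))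

------------------------------------------------------------------------
-- Root extraction in the base field, for a fixed exponent e

-- In the second case y ^ (p ^ r) ≈ x says that y is the Frobenius root of x.
data FrobeniusOracle {a ℓ} (F : Field a ℓ) (e : ℕ) : Set (a ⊔ ℓ) where
  char∤e : (∀ p → HasPositiveChar F p → ¬ (p ∣ e)) → FrobeniusOracle F e
  char∣e : (p r q : ℕ) → HasPositiveChar F p → p ∣ e →
           e ≡ p ^ r * q → ¬ (p ∣ q) →
           (let open Field F) →
           (frobRoot? : ∀ x → Dec (∃ λ y → y ^ᶠ (p ^ r) ≈ x)) →
           (cost : ℕ) → FrobeniusOracle F e

record RootOracle {a ℓ} (F : Field a ℓ) (e : ℕ) : Set (a ⊔ ℓ) where
  open Field F
  field
    root?     : ∀ x → Dec (∃ λ y → y ^ᶠ e ≈ x)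
    rootCost  : ℕ
    frobenius : FrobeniusOracle F e

  frobCost : ℕ
  frobCost with frobenius
  ... | char∤e _                = 0
  ... | char∣e _ _ _ _ _ _ _ _ c = c

  -- R(e)
  cost : ℕ
  cost = rootCost + frobCost

------------------------------------------------------------------------
-- Algorithms

-- Algorithms are closed programs of a first-order functional language with
-- primitive iteration (foldr over lists, iter over numbers).  Programs do not
-- mention the field; field elements are manipulated only through the
-- operations below.  All programs terminate, which loses no generality for
-- algorithms with an explicit time bound: they can be clocked.

infixr 6 _⊗_
data Ty : Set where
  fld nat    : Ty
  _⊗_        : Ty → Ty → Ty
  list maybe : Ty → Ty

data Tm (Γ : List Ty) : Ty → Set where
  var       : ∀ {τ} → τ ∈ Γ → Tm Γ τ
  let′      : ∀ {σ τ} → Tm Γ σ → Tm (σ ∷ Γ) τ → Tm Γ τ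

  pair      : ∀ {σ τ} → Tm Γ σ → Tm Γ τ → Tm Γ (σ ⊗ τ)
  fst       : ∀ {σ τ} → Tm Γ (σ ⊗ τ) → Tm Γ σ
  snd       : ∀ {σ τ} → Tm Γ (σ ⊗ τ) → Tm Γ τ
  none      : ∀ {τ} → Tm Γ (maybe τ)
  some      : ∀ {τ} → Tm Γ τ → Tm Γ (maybe τ)
  caseMaybe : ∀ {σ τ} → Tm Γ (maybe σ) → Tm Γ τ → Tm (σ ∷ Γ) τ → Tm Γ τ
  nil       : ∀ {τ} → Tm Γ (list τ)
  cons      : ∀ {τ} → Tm Γ τ → Tm Γ (list τ) → Tm Γ (list τ)
  caseList  : ∀ {σ τ} → Tm Γ (list σ) → Tm Γ τ → Tm (σ ∷ list σ ∷ Γ) τ → Tm Γ τ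
  foldList  : ∀ {σ τ} → Tm Γ (list σ) → Tm Γ τ → Tm (σ ∷ τ ∷ Γ) τ → Tm Γ τ

  lit       : ℕ → Tm Γ nat
  add monus : Tm Γ nat → Tm Γ nat → Tm Γ nat
  if≤       : ∀ {τ} → Tm Γ nat → Tm Γ nat → Tm Γ τ → Tm Γ τ → Tm Γ τ
  iter      : ∀ {τ} → Tm Γ nat → Tm Γ τ → Tm (τ ∷ Γ) τ → Tm Γ τ

  0ᶠ 1ᶠ     : Tm Γ fld
  addᶠ mulᶠ : Tm Γ fld → Tm Γ fld → Tm Γ fld
  negᶠ invᶠ : Tm Γ fld → Tm Γ fld
  if≈       : ∀ {τ} → Tm Γ fld → Tm Γ fld → Tm Γ τ → Tm Γ τ → Tm Γ τ

  root frob : Tm Γ fld → Tm Γ (maybe fld)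

Timed : ∀ {b} → Set b → Set b
Timed A = A × ℕ

return : ∀ {b} {A : Set b} → A → Timed A
return x = x , 0

infixl 1 _>>=_
_>>=_ : ∀ {b c} {A : Set b} {B : Set c} → Timed A → (A → Timed B) → Timed B
(x , s) >>= k = proj₁ (k x) , s + proj₂ (k x)

charge : ∀ {b} {A : Set b} → ℕ → Timed A → Timed A
charge c (x , t) = x , c + t

foldM : ∀ {b c} {A : Set b} {B : Set c} →
        (A → B → Timed B) → B → List A → Timed B
foldM f z []       = return z
foldM f z (x ∷ xs) = foldM f z xs >>= f x

iterM : ∀ {b} {B : Set b} → (B → Timed B) → B → ℕ → Timed B
iterM f z zero    = return z
iterM f z (suc k) = iterM f z k >>= f

decToMaybe : ∀ {b q} {A : Set b} {Q : A → Set q} → Dec (∃ Q) → Maybe A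
decToMaybe (yes (x , _)) = just x
decToMaybe (no  _)       = nothing

module Semantics {a ℓ} {F : Field a ℓ} {e : ℕ} (O : RootOracle F e) where
  open Field F
  open RootOracle O

  ⟦_⟧ : Ty → Set a
  ⟦ fld ⟧     = Carrier
  ⟦ nat ⟧     = Lift a ℕ
  ⟦ σ ⊗ τ ⟧   = ⟦ σ ⟧ × ⟦ τ ⟧
  ⟦ list τ ⟧  = List ⟦ τ ⟧
  ⟦ maybe τ ⟧ = Maybe ⟦ τ ⟧

  frobRoot : Carrier → Maybe Carrier
  frobRoot x with frobenius
  ... | char∤e _                        = nothing
  ... | char∣e _ _ _ _ _ _ _ frobRoot? _ = decToMaybe (frobRoot? x)

  -- Every evaluated node costs 1, plus rootCost or frobCost for a root
  -- extraction.
  mutual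
    eval : ∀ {Γ τ} → Tm Γ τ → All ⟦_⟧ Γ → Timed ⟦ τ ⟧
    eval t ρ = charge 1 (step t ρ)

    step : ∀ {Γ τ} → Tm Γ τ → All ⟦_⟧ Γ → Timed ⟦ τ ⟧
    step (var i)    ρ = return (lookup ρ i)
    step (let′ s t) ρ = eval s ρ >>= λ x → eval t (x ∷ ρ)

    step (pair s t) ρ = eval s ρ >>= λ x → eval t ρ >>= λ y → return (x , y)
    step (fst t)    ρ = eval t ρ >>= λ x → return (proj₁ x)
    step (snd t)    ρ = eval t ρ >>= λ x → return (proj₂ x)
    step none       ρ = return nothing
    step (some t)   ρ = eval t ρ >>= λ x → return (just x)
    step (caseMaybe s t u) ρ = eval s ρ >>= λ where
      nothing  → eval t ρ
      (just x) → eval u (x ∷ ρ)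
    step nil        ρ = return []
    step (cons s t) ρ = eval s ρ >>= λ x → eval t ρ >>= λ xs → return (x ∷ xs)
    step (caseList s t u) ρ = eval s ρ >>= λ where
      []       → eval t ρ
      (x ∷ xs) → eval u (x ∷ xs ∷ ρ)
    step (foldList s t u) ρ = eval s ρ >>= λ xs → eval t ρ >>= λ z →
      foldM (λ x y → eval u (x ∷ y ∷ ρ)) z xs

    step (lit k)     ρ = return (lift k)
    step (add s t)   ρ = eval s ρ >>= λ x → eval t ρ >>= λ y →
      return (lift (lower x + lower y))
    step (monus s t) ρ = eval s ρ >>= λ x → eval t ρ >>= λ y →
      return (lift (lower x ∸ lower y))
    step (if≤ s t u v) ρ = eval s ρ >>= λ x → eval t ρ >>= λ y →
      branch (lower x ≤? lower y) u v ρ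
    step (iter s t u) ρ = eval s ρ >>= λ k → eval t ρ >>= λ z →
      iterM (λ y → eval u (y ∷ ρ)) z (lower k)

    step 0ᶠ         ρ = return 0#
    step 1ᶠ         ρ = return 1#
    step (addᶠ s t) ρ = eval s ρ >>= λ x → eval t ρ >>= λ y → return (x +ᶠ y)
    step (mulᶠ s t) ρ = eval s ρ >>= λ x → eval t ρ >>= λ y → return (x *ᶠ y)
    step (negᶠ t)   ρ = eval t ρ >>= λ x → return (-ᶠ x)
    step (invᶠ t)   ρ = eval t ρ >>= λ x → return (x ⁻¹)
    step (if≈ s t u v) ρ = eval s ρ >>= λ x → eval t ρ >>= λ y →
      branch (x ≟ y) u v ρ

    step (root t)   ρ = eval t ρ >>= λ x →
      charge rootCost (return (decToMaybe (root? x)))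
    step (frob t)   ρ = eval t ρ >>= λ x →
      charge frobCost (return (frobRoot x))

    branch : ∀ {q} {Q : Set q} {Γ τ} → Dec Q →
             Tm Γ τ → Tm Γ τ → All ⟦_⟧ Γ → Timed ⟦ τ ⟧
    branch (yes _) u v ρ = eval u ρ
    branch (no  _) u v ρ = eval v ρ

open Semantics using (⟦_⟧; eval)

polyTy : Ty
polyTy = list (fld ⊗ list nat)

-- The inputs are n, e and f; `none' means that f is not an e-th power.
Algorithm : Set
Algorithm = Tm (nat ∷ nat ∷ polyTy ∷ []) (maybe polyTy)

module _ {a ℓ} {F : Field a ℓ} {n e : ℕ} (O : RootOracle F e) where
  open SparsePoly
  open PolyArithmetic F

  encode : Poly F n → ⟦ O ⟧ polyTy
  encode = map (λ (c , u) → c , map lift (toList u))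

  run : Algorithm → SparsePoly F n → Timed (⟦ O ⟧ (maybe polyTy))
  run A f = eval O A (lift n ∷ lift e ∷ encode (terms f) ∷ [])

  output : Algorithm → SparsePoly F n → ⟦ O ⟧ (maybe polyTy)
  output A f = proj₁ (run A f)

  time : Algorithm → SparsePoly F n → ℕ
  time A f = proj₂ (run A f)

  IsRootOf : ⟦ O ⟧ (maybe polyTy) → SparsePoly F n → Set (a ⊔ ℓ)
  IsRootOf (just x) f = Σ (SparsePoly F n) λ g →
                          x ≡ encode (terms g) × terms g ^ᵖ e ≋ terms f
  IsRootOf nothing  f = ¬ (Σ (Poly F n) λ g → g ^ᵖ e ≋ terms f)

-- Let s be the number of terms of f and D its total degree.  If g ^ e = f, then g has total degree
-- at most D / e and involves only variables of f, of which there are at most s D.  For s ≥ 2 there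
-- are at most (4 s) ^ D = s ^ O(D) such monomials; for s = 1 the leading monomial of g, which is
-- forced, already gives a root.  A Kronecker substitution reduces everything to one variable.
--
-- Write e = P q, where P is the largest power of the characteristic dividing e (P = 1 if there is
-- none).  By the Frobenius identity, taking P-th roots of the coefficients of f gives h with
-- h = G ^ q, where G (x) = g (x ^ P).  The leading coefficient y of G is an e-th root of the one of
-- f, and as q is invertible in the field, the coefficient of h - L ^ q at (q - 1) k₀ + k equals
-- q y ^ (q - 1) times the error of L at k whenever L agrees with G above k (k₀ is the leading
-- exponent).  So G is found by correcting all coefficients simultaneously, as many times as there
-- are candidates.  P and q are unknown to the program: it tries all pairs of numbers up to e and
-- keeps a result g only after checking g ^ e = f.  One e-th root and s Frobenius roots suffice.

module Submission where

open import Defs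
open import Level using (Level; lift; lower; _⊔_)
open import Algebra.Bundles using (CommutativeRing; Semiring)
open import Algebra.Structures using (IsCommutativeMonoid)
open import Data.Bool.Base using (if_then_else_; true; false; _∧_; _∨_)
open import Data.Empty using (⊥-elim)
open import Data.Fin.Base as Fin using (Fin; toℕ; inject₁; fromℕ)
open import Data.Fin.Properties using (toℕ-inject₁; toℕ-fromℕ; toℕ<n)
open import Data.List.Base using (List; []; _∷_; map; _++_; foldr; concatMap; length; drop)
open import Data.List.Membership.Propositional using (_∈_; _∉_)
open import Data.List.Membership.Propositional.Properties using (∈-map⁺; ∈-map⁻; ∈-++⁺ˡ; ∈-++⁺ʳ)
open import Data.List.Properties using (length-map; length-++; map-∘; map-cong; foldr-map; ∷-injective)
open import Data.List.Relation.Binary.Pointwise using (Pointwise; []; _∷_; Pointwise-length)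
open import Data.List.Relation.Unary.All as All using (All; []; _∷_; lookup)
import Data.List.Relation.Unary.All.Properties as All
open import Data.List.Relation.Unary.AllPairs using (AllPairs; []; _∷_)
import Data.List.Relation.Unary.AllPairs.Properties as AllPairs
open import Data.List.Relation.Unary.Any using (here; there; _─_)
open import Data.List.Relation.Unary.Unique.Propositional using (Unique)
open import Data.Maybe.Base as Maybe using (Maybe; just; nothing; maybe′)
open import Data.Nat.Base as ℕ using (ℕ; zero; suc; s≤s; z≤n; _+_; _*_; _^_; _∸_; _≤_; _<_; NonZero)
open import Data.Nat.Combinatorics using (nCk+nC[k+1]≡[n+1]C[k+1]; k>n⇒nCk≡0; nC1≡n; nCn≡1) renaming (_C_ to _choose_)
open import Data.Nat.DivMod using (_%_; _/_; m≡m%n+[m/n]*n; m%n<n)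
open import Data.Nat.Divisibility using (_∣_; divides)
open import Data.Nat.ListAction using (sum)
import Data.Nat.Properties as ℕ
open import Algebra.Properties.CommutativeSemigroup ℕ.*-commutativeSemigroup using (x∙yz≈y∙xz)
open import Data.Nat.Solver using (module +-*-Solver)
open import Data.Product.Base using (Σ; ∃; ∃₂; _×_; _,_; proj₁; proj₂)
open import Data.Sum.Base using (_⊎_; inj₁; inj₂)
open import Data.Unit.Base using (⊤; tt)
open import Data.Vec.Base as Vec using (Vec; toList; []; _∷_; fromList; zipWith; replicate)
open import Data.Vec.Properties using (≡-dec; length-toList; toList∘fromList; lookup-zipWith; lookup-map; lookup-replicate)
open import Function.Base using (_∘_; id; case_of_)
open import Function.Bundles using (mk⇔)
open import Relation.Binary.Definitions using (DecidableEquality; tri<; tri≈; tri>)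
open import Relation.Binary.PropositionalEquality as ≡ using (_≡_; _≢_; module ≡-Reasoning)
open import Relation.Nullary using (¬_; Dec; yes; no; does; contradiction)
open import Relation.Nullary.Decidable using (_×-dec_; _⊎-dec_; dec-true; dec-false; does-⇔)

-- The time bound shapes the proof in three ways. Apart from the oracle cost it does not mention e,
-- so every loop of length e has to wait until the test e ≤ D has passed. Additions cost one step
-- however large a Kronecker key is, but no key may count the iterations of a loop. And the bound
-- has to hold for wrong guesses of P and q as well, when L approximates nothing and its powers L ^
-- j might grow dense. They do not: e times an exponent vector of L ^ j is bounded by j times the
-- bounds taken from f, so for j ≤ e the vector is a candidate for the exponent 1, and those obey
-- the same estimate.
--
-- The estimate (4 s) ^ D does not come from counting monomials in s D variables directly. A
-- candidate of degree b gets the weight (2 s) ^ (D - b). Every variable of f multiplies the total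
-- weight by at most 2 s / (2 s - 1), and an absent variable leaves it alone. For s D variables this
-- gives at most 2 ^ D times the initial weight (2 s) ^ D.

module FieldExtras {a ℓ} (F : Field a ℓ) where
  open Field F public
  open import Algebra.Properties.Ring ring public
    using (-‿distribʳ-*; -‿distribˡ-*; -‿+-comm; -0#≈0#; -‿involutive)
  open import Algebra.Properties.CommutativeSemiring.Exp commutativeSemiring public
    using (^-congˡ; ^-distrib-*)
  open import Relation.Binary.Reasoning.Setoid setoid public
  open import Algebra.Properties.Semiring.Mult semiring public
    using (×-congʳ; ×-homo-+; ×-assoc-*; ×1-homo-*)
  open import Algebra.Solver.Ring.NaturalCoefficients.Default commutativeSemiring public
    using (solve; _:+_; _:*_; _:=_)

  noZeroDivisors : ∀ {x y} → ¬ x ≈ 0# → x *ᶠ y ≈ 0# → y ≈ 0#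
  noZeroDivisors {x} {y} x≉0 xy≈0 = begin
    y                    ≈⟨ *-identityˡ y ⟨
    1# *ᶠ y              ≈⟨ *-congʳ (*-inv x x≉0) ⟨
    x *ᶠ x ⁻¹ *ᶠ y       ≈⟨ solve 3 (λ x i y → x :* i :* y := i :* (x :* y)) refl x (x ⁻¹) y ⟩
    x ⁻¹ *ᶠ (x *ᶠ y)     ≈⟨ *-congˡ xy≈0 ⟩
    x ⁻¹ *ᶠ 0#           ≈⟨ zeroʳ _ ⟩
    0#                   ∎

  *-≉0 : ∀ {x y} → ¬ x ≈ 0# → ¬ y ≈ 0# → ¬ x *ᶠ y ≈ 0#
  *-≉0 x≉0 y≉0 xy≈0 = y≉0 (noZeroDivisors x≉0 xy≈0)

  ^-≉0 : ∀ {x} n → ¬ x ≈ 0# → ¬ x ^ᶠ n ≈ 0#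
  ^-≉0 zero    x≉0 = 1≉0
  ^-≉0 (suc n) x≉0 = *-≉0 x≉0 (^-≉0 n x≉0)

  x+-y≈0⇒x≈y : ∀ {x y} → x +ᶠ -ᶠ y ≈ 0# → x ≈ y
  x+-y≈0⇒x≈y {x} {y} eq = begin
    x                    ≈⟨ +-identityʳ x ⟨
    x +ᶠ 0#              ≈⟨ +-congˡ (-‿inverseˡ y) ⟨
    x +ᶠ (-ᶠ y +ᶠ y)     ≈⟨ +-assoc _ _ _ ⟨
    x +ᶠ -ᶠ y +ᶠ y       ≈⟨ +-congʳ eq ⟩
    0# +ᶠ y              ≈⟨ +-identityˡ y ⟩
    y                    ∎

  x≈y⇒x+-y≈0 : ∀ {x y} → x ≈ y → x +ᶠ -ᶠ y ≈ 0#
  x≈y⇒x+-y≈0 {x} {y} eq = trans (+-congʳ eq) (-‿inverseʳ y)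

-- Formal sums of terms over an arbitrary set of monomials

module FormalSums {a ℓ} (F : Field a ℓ) {m} {M : Set m} (_≟ᴹ_ : DecidableEquality M) where
  open FieldExtras F

  Sum : Set (a ⊔ m)
  Sum = List (Carrier × M)

  infix 8 ⟨_∣_⟩
  -- The linear functional on sums that extends `φ`. Maps of monomials act on it by composition with
  -- `φ` and products by nesting, so identities between sums become identities in the field.
  ⟨_∣_⟩ : Sum → (M → Carrier) → Carrier
  ⟨ []          ∣ φ ⟩ = 0#
  ⟨ (c , u) ∷ P ∣ φ ⟩ = c *ᶠ φ u +ᶠ ⟨ P ∣ φ ⟩

  δ : M → M → Carrier
  δ u v = if does (v ≟ᴹ u) then 1# else 0#

  δ-refl : ∀ u → δ u u ≈ 1#
  δ-refl u with u ≟ᴹ u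
  ... | yes _  = refl
  ... | no u≢u = contradiction ≡.refl u≢u

  δ-≢ : ∀ {u v} → v ≢ u → δ u v ≈ 0#
  δ-≢ {u} {v} v≢u with v ≟ᴹ u
  ... | yes v≡u = contradiction v≡u v≢u
  ... | no _    = refl

  coef : Sum → M → Carrier
  coef []            u = 0#
  coef ((c , v) ∷ P) u = if does (v ≟ᴹ u) then c +ᶠ coef P u else coef P u

  coef-pairing : ∀ P u → coef P u ≈ ⟨ P ∣ δ u ⟩
  coef-pairing []            u = refl
  coef-pairing ((c , v) ∷ P) u with v ≟ᴹ u
  ... | yes _ = +-cong (sym (*-identityʳ c)) (coef-pairing P u)
  ... | no  _ = trans (coef-pairing P u)
                      (trans (sym (+-identityˡ _)) (+-congʳ (sym (zeroʳ c))))

  coef-≡ : ∀ {c v} {P} {u} → v ≡ u → coef ((c , v) ∷ P) u ≈ c +ᶠ coef P u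
  coef-≡ {v = v} {u = u} v≡u with v ≟ᴹ u
  ... | yes _  = refl
  ... | no v≢u = contradiction v≡u v≢u

  coef-≢ : ∀ {c v} {P} {u} → v ≢ u → coef ((c , v) ∷ P) u ≈ coef P u
  coef-≢ {v = v} {u = u} v≢u with v ≟ᴹ u
  ... | yes v≡u = contradiction v≡u v≢u
  ... | no _    = refl

  coef-∉ : ∀ P {u} → All (λ t → proj₂ t ≢ u) P → coef P u ≈ 0#
  coef-∉ []            []         = refl
  coef-∉ ((c , v) ∷ P) (v≢u ∷ hs) = trans (coef-≢ {c} {P = P} v≢u) (coef-∉ P hs)

  pairing-congˡ : ∀ P {φ ψ} → All (λ t → φ (proj₂ t) ≈ ψ (proj₂ t)) P → ⟨ P ∣ φ ⟩ ≈ ⟨ P ∣ ψ ⟩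
  pairing-congˡ []      []       = refl
  pairing-congˡ (t ∷ P) (h ∷ hs) = +-cong (*-congˡ h) (pairing-congˡ P hs)

  pairing-congˡ′ : ∀ P {φ ψ} → (∀ u → φ u ≈ ψ u) → ⟨ P ∣ φ ⟩ ≈ ⟨ P ∣ ψ ⟩
  pairing-congˡ′ []            h = refl
  pairing-congˡ′ ((c , u) ∷ P) h = +-cong (*-congˡ (h u)) (pairing-congˡ′ P h)

  pairing-++ : ∀ P Q φ → ⟨ P ++ Q ∣ φ ⟩ ≈ ⟨ P ∣ φ ⟩ +ᶠ ⟨ Q ∣ φ ⟩
  pairing-++ []      Q φ = sym (+-identityˡ _)
  pairing-++ (t ∷ P) Q φ = trans (+-congˡ (pairing-++ P Q φ)) (sym (+-assoc _ _ _))

  pairing-*ˡ : ∀ P x φ → ⟨ P ∣ (λ u → x *ᶠ φ u) ⟩ ≈ x *ᶠ ⟨ P ∣ φ ⟩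
  pairing-*ˡ []            x φ = sym (zeroʳ x)
  pairing-*ˡ ((c , u) ∷ P) x φ = trans (+-congˡ (pairing-*ˡ P x φ))
    (solve 4 (λ c x y z → c :* (x :* y) :+ x :* z := x :* (c :* y :+ z)) refl c x (φ u) ⟨ P ∣ φ ⟩)

  pairing-+ : ∀ P φ ψ → ⟨ P ∣ (λ u → φ u +ᶠ ψ u) ⟩ ≈ ⟨ P ∣ φ ⟩ +ᶠ ⟨ P ∣ ψ ⟩
  pairing-+ []            φ ψ = sym (+-identityˡ _)
  pairing-+ ((c , u) ∷ P) φ ψ = trans (+-congˡ (pairing-+ P φ ψ))
    (solve 5 (λ c x y z w → c :* (x :+ y) :+ (z :+ w) := (c :* x :+ z) :+ (c :* y :+ w)) refl
      c (φ u) (ψ u) ⟨ P ∣ φ ⟩ ⟨ P ∣ ψ ⟩)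

  pairing-0 : ∀ P → ⟨ P ∣ (λ _ → 0#) ⟩ ≈ 0#
  pairing-0 []            = refl
  pairing-0 ((c , u) ∷ P) = trans (+-cong (zeroʳ c) (pairing-0 P)) (+-identityˡ _)

  neg : Sum → Sum
  neg = map (λ (c , u) → -ᶠ c , u)

  pairing-neg : ∀ P φ → ⟨ neg P ∣ φ ⟩ ≈ -ᶠ ⟨ P ∣ φ ⟩
  pairing-neg []            φ = sym -0#≈0#
  pairing-neg ((c , u) ∷ P) φ =
    trans (+-cong (sym (-‿distribˡ-* c (φ u))) (pairing-neg P φ)) (-‿+-comm _ _)

  remove : M → Sum → Sum
  remove u []            = []
  remove u ((c , v) ∷ P) = if does (v ≟ᴹ u) then remove u P else (c , v) ∷ remove u P

  remove-length : ∀ u P → length (remove u P) ℕ.≤ length P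
  remove-length u []            = z≤n
  remove-length u ((c , v) ∷ P) with v ≟ᴹ u
  ... | yes _ = ℕ.m≤n⇒m≤1+n (remove-length u P)
  ... | no  _ = s≤s (remove-length u P)

  remove-All : ∀ {p} {Q : Carrier × M → Set p} u P → All Q P → All Q (remove u P)
  remove-All u []            []       = []
  remove-All u ((c , v) ∷ P) (q ∷ qs) with v ≟ᴹ u
  ... | yes _ = remove-All u P qs
  ... | no  _ = q ∷ remove-All u P qs

  remove-∉ : ∀ u P → All (λ t → u ≢ proj₂ t) (remove u P)
  remove-∉ u []            = []
  remove-∉ u ((c , v) ∷ P) with v ≟ᴹ u
  ... | yes _  = remove-∉ u P
  ... | no v≢u = (v≢u ∘ ≡.sym) ∷ remove-∉ u P

  pairing-remove : ∀ u P φ → ⟨ P ∣ φ ⟩ ≈ coef P u *ᶠ φ u +ᶠ ⟨ remove u P ∣ φ ⟩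
  pairing-remove u []            φ = sym (trans (+-identityʳ _) (zeroˡ _))
  pairing-remove u ((c , v) ∷ P) φ with v ≟ᴹ u
  ... | yes ≡.refl = trans (+-congˡ (pairing-remove u P φ))
    (solve 4 (λ c x y z → c :* x :+ (y :* x :+ z) := (c :+ y) :* x :+ z) refl
      c (φ u) (coef P u) ⟨ remove u P ∣ φ ⟩)
  ... | no _ = trans (+-congˡ (pairing-remove u P φ))
    (solve 3 (λ x y z → x :+ (y :+ z) := y :+ (x :+ z)) refl
      (c *ᶠ φ v) (coef P u *ᶠ φ u) ⟨ remove u P ∣ φ ⟩)

  coef-remove : ∀ u P w → coef (remove u P) w ≈ (if does (w ≟ᴹ u) then 0# else coef P w)
  coef-remove u P w with w ≟ᴹ u
  ... | yes ≡.refl = coef-∉ (remove u P) (go P)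
    where
    go : ∀ P → All (λ t → proj₂ t ≢ u) (remove u P)
    go []            = []
    go ((c , v) ∷ P) with v ≟ᴹ u
    ... | yes _  = go P
    ... | no v≢u = v≢u ∷ go P
  ... | no w≢u = go P
    where
    go : ∀ P → coef (remove u P) w ≈ coef P w
    go []            = refl
    go ((c , v) ∷ P) with v ≟ᴹ u
    ... | yes ≡.refl = trans (go P) (sym (coef-≢ {c} {P = P} (w≢u ∘ ≡.sym)))
    ... | no _ with v ≟ᴹ w
    ...   | yes _ = +-congˡ (go P)
    ...   | no  _ = go P

  module _ {q} {Q : M → Set q} (Q? : ∀ u → Dec (Q u)) where

    select : Sum → Sum
    select []            = []
    select ((c , u) ∷ P) = if does (Q? u) then (c , u) ∷ select P else select P

    select-All : ∀ P → All (Q ∘ proj₂) (select P)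
    select-All []            = []
    select-All ((c , u) ∷ P) with Q? u
    ... | yes q = q ∷ select-All P
    ... | no  _ = select-All P

    coef-select : ∀ P {u} → Q u → coef (select P) u ≈ coef P u
    coef-select []            q = refl
    coef-select ((c , v) ∷ P) {u} q with Q? v
    ... | no ¬q = trans (coef-select P q) (sym (coef-≢ {c} {P = P} λ { ≡.refl → ¬q q }))
    ... | yes _ with v ≟ᴹ u
    ...   | yes _ = +-congˡ (coef-select P q)
    ...   | no  _ = coef-select P q

  -- Grouping the terms with equal monomials shortens the sum.
  vanishing : ∀ k P → length P ℕ.≤ k → (∀ u → coef P u ≈ 0#) → ∀ φ → ⟨ P ∣ φ ⟩ ≈ 0#
  vanishing k       []            _       h φ = refl
  vanishing (suc k) P@((c , v) ∷ Q) (s≤s l) h φ = begin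
    ⟨ P ∣ φ ⟩                                 ≈⟨ pairing-remove v P φ ⟩
    coef P v *ᶠ φ v +ᶠ ⟨ remove v P ∣ φ ⟩     ≈⟨ +-cong (trans (*-congʳ (h v)) (zeroˡ _))
                                                     (vanishing k (remove v P) (shorter l) zero′ φ) ⟩
    0# +ᶠ 0#                                  ≈⟨ +-identityˡ 0# ⟩
    0#                                        ∎
    where
    shorter : length Q ℕ.≤ k → length (remove v P) ℕ.≤ k
    shorter l with v ≟ᴹ v
    ... | yes _  = ℕ.≤-trans (remove-length v Q) l
    ... | no v≢v = contradiction ≡.refl v≢v
    zero′ : ∀ u → coef (remove v P) u ≈ 0#
    zero′ u with coef-remove v P u
    ... | eq with u ≟ᴹ v
    ...   | yes _ = eq
    ...   | no  _ = trans eq (h u)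

  infix 4 _≋_
  -- Test functions instead of coefficients: the ring laws then need no bookkeeping of which
  -- monomials coincide. `≋-coef` and `coef-≋` show that both notions of equality agree.
  record _≋_ (P Q : Sum) : Set (a ⊔ ℓ ⊔ m) where
    constructor mk
    field at : ∀ φ → ⟨ P ∣ φ ⟩ ≈ ⟨ Q ∣ φ ⟩
  open _≋_ public

  ≋-coef : ∀ {P Q} → P ≋ Q → ∀ u → coef P u ≈ coef Q u
  ≋-coef {P} {Q} P≋Q u =
    trans (coef-pairing P u) (trans (at P≋Q (δ u)) (sym (coef-pairing Q u)))

  coef-++ : ∀ P Q u → coef (P ++ Q) u ≈ coef P u +ᶠ coef Q u
  coef-++ P Q u = trans (coef-pairing (P ++ Q) u)
    (trans (pairing-++ P Q (δ u)) (sym (+-cong (coef-pairing P u) (coef-pairing Q u))))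

  coef-neg : ∀ P u → coef (neg P) u ≈ -ᶠ coef P u
  coef-neg P u = trans (coef-pairing (neg P) u)
    (trans (pairing-neg P (δ u)) (-‿cong (sym (coef-pairing P u))))

  -- The difference `P ++ neg Q` has only zero coefficients, so by `vanishing` every test function
  -- kills it.
  coef-≋ : ∀ {P Q} → (∀ u → coef P u ≈ coef Q u) → P ≋ Q
  coef-≋ {P} {Q} h = mk λ φ → x+-y≈0⇒x≈y (begin
    ⟨ P ∣ φ ⟩ +ᶠ -ᶠ ⟨ Q ∣ φ ⟩   ≈⟨ +-congˡ (pairing-neg Q φ) ⟨
    ⟨ P ∣ φ ⟩ +ᶠ ⟨ neg Q ∣ φ ⟩  ≈⟨ pairing-++ P (neg Q) φ ⟨
    ⟨ P ++ neg Q ∣ φ ⟩          ≈⟨ vanishing _ (P ++ neg Q) ℕ.≤-refl zero′ φ ⟩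
    0#                          ∎)
    where
    zero′ : ∀ u → coef (P ++ neg Q) u ≈ 0#
    zero′ u = trans (coef-++ P (neg Q) u)
      (trans (+-congˡ (coef-neg Q u)) (x≈y⇒x+-y≈0 (h u)))

  ≋-refl : ∀ {P} → P ≋ P
  ≋-refl = mk λ _ → refl
  ≋-sym : ∀ {P Q} → P ≋ Q → Q ≋ P
  ≋-sym h = mk λ φ → sym (at h φ)
  ≋-trans : ∀ {P Q R} → P ≋ Q → Q ≋ R → P ≋ R
  ≋-trans h k = mk λ φ → trans (at h φ) (at k φ)

  -- Merging on insertion keeps a sum no longer than the number of monomials that can occur in it.
  -- All size bounds for the programs rest on this.
  insert : Carrier × M → Sum → Sum
  insert (c , u) P = (c +ᶠ coef P u , u) ∷ remove u P

  insert-≋ : ∀ t P φ → ⟨ insert t P ∣ φ ⟩ ≈ ⟨ t ∷ P ∣ φ ⟩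
  insert-≋ (c , u) P φ = begin
    (c +ᶠ coef P u) *ᶠ φ u +ᶠ ⟨ remove u P ∣ φ ⟩
      ≈⟨ solve 4 (λ c x y z → (c :+ y) :* x :+ z := c :* x :+ (y :* x :+ z)) refl
           c (φ u) (coef P u) ⟨ remove u P ∣ φ ⟩ ⟩
    c *ᶠ φ u +ᶠ (coef P u *ᶠ φ u +ᶠ ⟨ remove u P ∣ φ ⟩)
      ≈⟨ +-congˡ (pairing-remove u P φ) ⟨
    c *ᶠ φ u +ᶠ ⟨ P ∣ φ ⟩ ∎

  Distinct : Sum → Set (a ⊔ m)
  Distinct = AllPairs (λ s t → proj₂ s ≢ proj₂ t)

  remove-Distinct : ∀ u P → Distinct P → Distinct (remove u P)
  remove-Distinct u []            []       = []
  remove-Distinct u ((c , v) ∷ P) (d ∷ ds) with v ≟ᴹ u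
  ... | yes _ = remove-Distinct u P ds
  ... | no  _ = remove-All u P d ∷ remove-Distinct u P ds

  insert-Distinct : ∀ t P → Distinct P → Distinct (insert t P)
  insert-Distinct (c , u) P d = remove-∉ u P ∷ remove-Distinct u P d

  insert-All : ∀ {p} {Q : M → Set p} t P → Q (proj₂ t) → All (Q ∘ proj₂) P →
               All (Q ∘ proj₂) (insert t P)
  insert-All (c , u) P q qs = q ∷ remove-All u P qs

module Products {a ℓ} (F : Field a ℓ) {m} {M : Set m}
  (_≟ᴹ_ : DecidableEquality M) (_∙_ : M → M → M) where
  open FieldExtras F
  open FormalSums F _≟ᴹ_ public

  infixl 7 _⊛_
  _⊛_ : Sum → Sum → Sum
  P ⊛ Q = concatMap (λ (c , u) → map (λ (d , v) → c *ᶠ d , u ∙ v) Q) P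

  -- The laws of multiplication all come from this nesting. Commutativity, for instance, is an
  -- exchange of two finite sums together with commutativity of the monomials.
  pairing-⊛ : ∀ P Q φ → ⟨ P ⊛ Q ∣ φ ⟩ ≈ ⟨ P ∣ (λ u → ⟨ Q ∣ (λ v → φ (u ∙ v)) ⟩) ⟩
  pairing-⊛ []            Q φ = refl
  pairing-⊛ ((c , u) ∷ P) Q φ = begin
    ⟨ map (λ (d , v) → c *ᶠ d , u ∙ v) Q ++ P ⊛ Q ∣ φ ⟩
      ≈⟨ pairing-++ (map (λ (d , v) → c *ᶠ d , u ∙ v) Q) (P ⊛ Q) φ ⟩
    ⟨ map (λ (d , v) → c *ᶠ d , u ∙ v) Q ∣ φ ⟩ +ᶠ ⟨ P ⊛ Q ∣ φ ⟩
      ≈⟨ +-cong (monomial Q) (pairing-⊛ P Q φ) ⟩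
    c *ᶠ ⟨ Q ∣ (λ v → φ (u ∙ v)) ⟩ +ᶠ ⟨ P ∣ (λ u → ⟨ Q ∣ (λ v → φ (u ∙ v)) ⟩) ⟩ ∎
    where
    monomial : ∀ Q → ⟨ map (λ (d , v) → c *ᶠ d , u ∙ v) Q ∣ φ ⟩ ≈ c *ᶠ ⟨ Q ∣ (λ v → φ (u ∙ v)) ⟩
    monomial []            = sym (zeroʳ c)
    monomial ((d , v) ∷ Q) = trans (+-congˡ (monomial Q))
      (solve 4 (λ c d x y → c :* d :* x :+ c :* y := c :* (d :* x :+ y)) refl
        c d (φ (u ∙ v)) ⟨ Q ∣ (λ v → φ (u ∙ v)) ⟩)

  ⊛-cong : ∀ {P P′ Q Q′} → P ≋ P′ → Q ≋ Q′ → P ⊛ Q ≋ P′ ⊛ Q′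
  ⊛-cong {P} {P′} {Q} {Q′} p q = mk λ φ → begin
    ⟨ P ⊛ Q ∣ φ ⟩                              ≈⟨ pairing-⊛ P Q φ ⟩
    ⟨ P ∣ (λ u → ⟨ Q ∣ (λ v → φ (u ∙ v)) ⟩) ⟩    ≈⟨ pairing-congˡ′ P (λ u → at q (λ v → φ (u ∙ v))) ⟩
    ⟨ P ∣ (λ u → ⟨ Q′ ∣ (λ v → φ (u ∙ v)) ⟩) ⟩   ≈⟨ at p _ ⟩
    ⟨ P′ ∣ (λ u → ⟨ Q′ ∣ (λ v → φ (u ∙ v)) ⟩) ⟩  ≈⟨ pairing-⊛ P′ Q′ φ ⟨
    ⟨ P′ ⊛ Q′ ∣ φ ⟩                            ∎

module SumMaps {a ℓ} (F : Field a ℓ) {m m′} {M : Set m} {M′ : Set m′}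
  (_≟ᴹ_ : DecidableEquality M) (_≟ᴺ_ : DecidableEquality M′) where
  open FieldExtras F
  private
    module A = FormalSums F _≟ᴹ_
    module B = FormalSums F _≟ᴺ_

  reindex : (M → M′) → A.Sum → B.Sum
  reindex h = map (λ (c , u) → c , h u)

  pairing-reindex : ∀ h P φ → B.⟨ reindex h P ∣ φ ⟩ ≡ A.⟨ P ∣ φ ∘ h ⟩
  pairing-reindex h []            φ = ≡.refl
  pairing-reindex h ((c , u) ∷ P) φ = ≡.cong (c *ᶠ φ (h u) +ᶠ_) (pairing-reindex h P φ)

  reindex-cong : ∀ h {P Q} → P A.≋ Q → reindex h P B.≋ reindex h Q
  reindex-cong h {P} {Q} P≋Q = B.mk λ φ → trans (reflexive (pairing-reindex h P φ))
    (trans (A.at P≋Q (φ ∘ h)) (reflexive (≡.sym (pairing-reindex h Q φ))))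

  -- Injectivity is asked only at `u` and only against the monomials of `P`, because a Kronecker key
  -- is injective only on bounded degrees.
  coef-reindex : ∀ h P u → All (λ t → h (proj₂ t) ≡ h u → proj₂ t ≡ u) P →
                 B.coef (reindex h P) (h u) ≈ A.coef P u
  coef-reindex h []            u []         = refl
  coef-reindex h ((c , v) ∷ P) u (inj ∷ is) with h v ≟ᴺ h u | v ≟ᴹ u
  ... | yes _   | yes _      = +-congˡ (coef-reindex h P u is)
  ... | yes eq  | no v≢u     = contradiction (inj eq) v≢u
  ... | no neq  | yes ≡.refl = contradiction ≡.refl neq
  ... | no _    | no _       = coef-reindex h P u is

module ProductMaps {a ℓ} (F : Field a ℓ) {m m′} {M : Set m} {M′ : Set m′}
  (_≟ᴹ_ : DecidableEquality M) (_≟ᴺ_ : DecidableEquality M′)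
  (_∙_ : M → M → M) (_∘′_ : M′ → M′ → M′)
  (h : M → M′) (homo : ∀ u v → h (u ∙ v) ≡ h u ∘′ h v) where
  open FieldExtras F
  open SumMaps F _≟ᴹ_ _≟ᴺ_
  private
    module A = Products F _≟ᴹ_ _∙_
    module B = Products F _≟ᴺ_ _∘′_

  reindex-⊛ : ∀ P Q → reindex h (P A.⊛ Q) B.≋ reindex h P B.⊛ reindex h Q
  reindex-⊛ P Q = B.mk λ φ → begin
    B.⟨ reindex h (P A.⊛ Q) ∣ φ ⟩
      ≡⟨ pairing-reindex h (P A.⊛ Q) φ ⟩
    A.⟨ P A.⊛ Q ∣ φ ∘ h ⟩
      ≈⟨ A.pairing-⊛ P Q (φ ∘ h) ⟩
    A.⟨ P ∣ (λ u → A.⟨ Q ∣ (λ v → φ (h (u ∙ v))) ⟩) ⟩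
      ≈⟨ A.pairing-congˡ′ P (λ u → A.pairing-congˡ′ Q (λ v → reflexive (≡.cong φ (homo u v)))) ⟩
    A.⟨ P ∣ (λ u → A.⟨ Q ∣ (λ v → φ (h u ∘′ h v)) ⟩) ⟩
      ≈⟨ A.pairing-congˡ′ P (λ u → reflexive (≡.sym (pairing-reindex h Q (λ v → φ (h u ∘′ v))))) ⟩
    A.⟨ P ∣ (λ u → B.⟨ reindex h Q ∣ (λ v → φ (h u ∘′ v)) ⟩) ⟩
      ≡⟨ pairing-reindex h P (λ u → B.⟨ reindex h Q ∣ (λ v → φ (u ∘′ v)) ⟩) ⟨
    B.⟨ reindex h P ∣ (λ u → B.⟨ reindex h Q ∣ (λ v → φ (u ∘′ v)) ⟩) ⟩
      ≈⟨ B.pairing-⊛ (reindex h P) (reindex h Q) φ ⟨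
    B.⟨ reindex h P B.⊛ reindex h Q ∣ φ ⟩ ∎

module MonoidRing {a ℓ} (F : Field a ℓ) {m} {M : Set m}
  (_≟ᴹ_ : DecidableEquality M) {_∙_ : M → M → M} {ε : M}
  (isCM : IsCommutativeMonoid _≡_ _∙_ ε) where
  open FieldExtras F
  open Products F _≟ᴹ_ _∙_ public
  private module I = IsCommutativeMonoid isCM

  one : Sum
  one = (1# , ε) ∷ []

  private
    swap : ∀ P Q (φ : M → M → Carrier) →
           ⟨ P ∣ (λ u → ⟨ Q ∣ φ u ⟩) ⟩ ≈ ⟨ Q ∣ (λ v → ⟨ P ∣ (λ u → φ u v) ⟩) ⟩
    swap []            Q φ = sym (pairing-0 Q)
    swap ((c , u) ∷ P) Q φ = begin
      c *ᶠ ⟨ Q ∣ φ u ⟩ +ᶠ ⟨ P ∣ (λ u → ⟨ Q ∣ φ u ⟩) ⟩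
        ≈⟨ +-cong (sym (pairing-*ˡ Q c (φ u))) (swap P Q φ) ⟩
      ⟨ Q ∣ (λ v → c *ᶠ φ u v) ⟩ +ᶠ ⟨ Q ∣ (λ v → ⟨ P ∣ (λ u → φ u v) ⟩) ⟩
        ≈⟨ pairing-+ Q _ _ ⟨
      ⟨ Q ∣ (λ v → c *ᶠ φ u v +ᶠ ⟨ P ∣ (λ u → φ u v) ⟩) ⟩ ∎

    ⊛-comm : ∀ P Q → P ⊛ Q ≋ Q ⊛ P
    ⊛-comm P Q = mk λ φ → begin
      ⟨ P ⊛ Q ∣ φ ⟩                                ≈⟨ pairing-⊛ P Q φ ⟩
      ⟨ P ∣ (λ u → ⟨ Q ∣ (λ v → φ (u ∙ v)) ⟩) ⟩      ≈⟨ swap P Q _ ⟩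
      ⟨ Q ∣ (λ v → ⟨ P ∣ (λ u → φ (u ∙ v)) ⟩) ⟩
        ≈⟨ pairing-congˡ′ Q (λ v → pairing-congˡ′ P (λ u → reflexive (≡.cong φ (I.comm u v)))) ⟩
      ⟨ Q ∣ (λ v → ⟨ P ∣ (λ u → φ (v ∙ u)) ⟩) ⟩      ≈⟨ pairing-⊛ Q P φ ⟨
      ⟨ Q ⊛ P ∣ φ ⟩                                ∎

    ⊛-assoc : ∀ P Q R → (P ⊛ Q) ⊛ R ≋ P ⊛ (Q ⊛ R)
    ⊛-assoc P Q R = mk λ φ → begin
      ⟨ (P ⊛ Q) ⊛ R ∣ φ ⟩                          ≈⟨ pairing-⊛ (P ⊛ Q) R φ ⟩
      ⟨ P ⊛ Q ∣ (λ w → ⟨ R ∣ (λ x → φ (w ∙ x)) ⟩) ⟩  ≈⟨ pairing-⊛ P Q _ ⟩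
      ⟨ P ∣ (λ u → ⟨ Q ∣ (λ v → ⟨ R ∣ (λ x → φ ((u ∙ v) ∙ x)) ⟩) ⟩) ⟩
        ≈⟨ pairing-congˡ′ P (λ u → pairing-congˡ′ Q (λ v → pairing-congˡ′ R (λ x →
             reflexive (≡.cong φ (I.assoc u v x))))) ⟩
      ⟨ P ∣ (λ u → ⟨ Q ∣ (λ v → ⟨ R ∣ (λ x → φ (u ∙ (v ∙ x))) ⟩) ⟩) ⟩
        ≈⟨ pairing-congˡ′ P (λ u → pairing-⊛ Q R (λ y → φ (u ∙ y))) ⟨
      ⟨ P ∣ (λ u → ⟨ Q ⊛ R ∣ (λ y → φ (u ∙ y)) ⟩) ⟩  ≈⟨ pairing-⊛ P (Q ⊛ R) φ ⟨
      ⟨ P ⊛ (Q ⊛ R) ∣ φ ⟩                          ∎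

    ⊛-identityˡ : ∀ P → one ⊛ P ≋ P
    ⊛-identityˡ P = mk λ φ → begin
      ⟨ one ⊛ P ∣ φ ⟩                        ≈⟨ pairing-⊛ one P φ ⟩
      1# *ᶠ ⟨ P ∣ (λ v → φ (ε ∙ v)) ⟩ +ᶠ 0#   ≈⟨ +-identityʳ _ ⟩
      1# *ᶠ ⟨ P ∣ (λ v → φ (ε ∙ v)) ⟩         ≈⟨ *-identityˡ _ ⟩
      ⟨ P ∣ (λ v → φ (ε ∙ v)) ⟩
        ≈⟨ pairing-congˡ′ P (λ v → reflexive (≡.cong φ (I.identityˡ v))) ⟩
      ⟨ P ∣ φ ⟩                              ∎

    ⊛-distribʳ : ∀ R P Q → (P ++ Q) ⊛ R ≋ P ⊛ R ++ Q ⊛ R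
    ⊛-distribʳ R P Q = mk λ φ → begin
      ⟨ (P ++ Q) ⊛ R ∣ φ ⟩                     ≈⟨ pairing-⊛ (P ++ Q) R φ ⟩
      ⟨ P ++ Q ∣ _ ⟩                           ≈⟨ pairing-++ P Q _ ⟩
      ⟨ P ∣ _ ⟩ +ᶠ ⟨ Q ∣ _ ⟩                    ≈⟨ +-cong (pairing-⊛ P R φ) (pairing-⊛ Q R φ) ⟨
      ⟨ P ⊛ R ∣ φ ⟩ +ᶠ ⟨ Q ⊛ R ∣ φ ⟩            ≈⟨ pairing-++ (P ⊛ R) (Q ⊛ R) φ ⟨
      ⟨ P ⊛ R ++ Q ⊛ R ∣ φ ⟩                   ∎

    ++-cong : ∀ {P P′ Q Q′} → P ≋ P′ → Q ≋ Q′ → P ++ Q ≋ P′ ++ Q′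
    ++-cong {P} {P′} {Q} {Q′} p q = mk λ φ → trans (pairing-++ P Q φ)
      (trans (+-cong (at p φ) (at q φ)) (sym (pairing-++ P′ Q′ φ)))

    ++-comm : ∀ P Q → P ++ Q ≋ Q ++ P
    ++-comm P Q = mk λ φ → trans (pairing-++ P Q φ)
      (trans (+-comm _ _) (sym (pairing-++ Q P φ)))

    ++-assoc : ∀ P Q R → (P ++ Q) ++ R ≋ P ++ (Q ++ R)
    ++-assoc []      Q R = ≋-refl
    ++-assoc (t ∷ P) Q R = mk λ φ → +-congˡ (at (++-assoc P Q R) φ)

    inverseˡ : ∀ P → neg P ++ P ≋ []
    inverseˡ P = mk λ φ → trans (pairing-++ (neg P) P φ)
      (trans (+-congʳ (pairing-neg P φ)) (-‿inverseˡ _))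

  sumRing : CommutativeRing (a ⊔ m) (a ⊔ ℓ ⊔ m)
  sumRing = record
    { Carrier = Sum ; _≈_ = _≋_ ; _+_ = _++_ ; _*_ = _⊛_ ; -_ = neg ; 0# = [] ; 1# = one
    ; isCommutativeRing = record
      { isRing = record
        { +-isAbelianGroup = record
          { isGroup = record
            { isMonoid = record
              { isSemigroup = record
                { isMagma = record
                  { isEquivalence = record { refl = ≋-refl ; sym = ≋-sym ; trans = ≋-trans }
                  ; ∙-cong = ++-cong }
                ; assoc = ++-assoc }
              ; identity = (λ P → ≋-refl) , λ P → ++-comm P [] }
            ; inverse = inverseˡ , λ P → ≋-trans (++-comm P (neg P)) (inverseˡ P)
            ; ⁻¹-cong = λ {P} {Q} h → mk λ φ →
                trans (pairing-neg P φ) (trans (-‿cong (at h φ)) (sym (pairing-neg Q φ))) }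
          ; comm = ++-comm }
        ; *-cong = ⊛-cong
        ; *-assoc = ⊛-assoc
        ; *-identity = ⊛-identityˡ , λ P → ≋-trans (⊛-comm P one) (⊛-identityˡ P)
        ; distrib = (λ R P Q → ≋-trans (⊛-comm R (P ++ Q)) (≋-trans (⊛-distribʳ R P Q)
                       (++-cong (⊛-comm P R) (⊛-comm Q R))))
                  , ⊛-distribʳ }
      ; *-comm = ⊛-comm } }

-- Leading terms of univariate sums

-- With the characteristic as `suc n`, the right side vanishes in the field; this is why the inner
-- binomial coefficients vanish there.
absorption : ∀ n k → suc k * (suc n choose suc k) ≡ suc n * (n choose k)
absorption zero    zero    = ≡.refl
absorption zero    (suc k) = ≡.trans (≡.cong (suc (suc k) *_) (k>n⇒nCk≡0 {1} {suc (suc k)} (s≤s (s≤s z≤n))))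
  (≡.trans (ℕ.*-zeroʳ k) (≡.sym (≡.trans (ℕ.+-identityʳ _) (k>n⇒nCk≡0 {0} {suc k} (s≤s z≤n)))))
absorption n@(suc _) zero = ≡.trans (ℕ.+-identityʳ _) (≡.trans (nC1≡n (suc n)) (≡.sym (ℕ.*-identityʳ (suc n))))
absorption (suc n) (suc k) = begin
  suc (suc k) * (suc (suc n) choose suc (suc k))
    ≡⟨ ≡.cong (suc (suc k) *_) (nCk+nC[k+1]≡[n+1]C[k+1] (suc n) (suc k)) ⟨
  suc (suc k) * (x + (suc n choose suc (suc k)))
    ≡⟨ ℕ.*-distribˡ-+ (suc (suc k)) x _ ⟩
  (x + suc k * x) + suc (suc k) * (suc n choose suc (suc k))
    ≡⟨ ≡.cong₂ (λ y z → (x + y) + z) (absorption n k) (absorption n (suc k)) ⟩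
  (x + suc n * (n choose k)) + suc n * (n choose suc k)
    ≡⟨ ℕ.+-assoc x _ _ ⟩
  x + (suc n * (n choose k) + suc n * (n choose suc k))
    ≡⟨ ≡.cong (x +_) (ℕ.*-distribˡ-+ (suc n) (n choose k) _) ⟨
  x + suc n * ((n choose k) + (n choose suc k))
    ≡⟨ ≡.cong (λ y → x + suc n * y) (nCk+nC[k+1]≡[n+1]C[k+1] n k) ⟩
  suc (suc n) * x ∎
  where
  open ≡-Reasoning
  x = suc n choose suc k

module RingIdentities {a ℓ} (S : CommutativeRing a ℓ) where
  open CommutativeRing S renaming (_+_ to _+ʳ_; _*_ to _*ʳ_; -_ to -ʳ_)
  open import Algebra.Properties.Ring ring using (-‿distribʳ-*; -‿distribˡ-*)
  open import Algebra.Properties.CommutativeSemiring.Exp commutativeSemiring using (^-congˡ; ^-assocʳ) renaming (_^_ to _^ʳ_)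
  open import Algebra.Properties.Semiring.Mult semiring using (×-homo-1) renaming (_×_ to _×ʳ_)
  open import Algebra.Properties.Monoid.Sum +-monoid using (sum-init-last; sum-cong-≋; sum-replicate-zero) renaming (sum to ∑)
  import Algebra.Properties.CommutativeSemiring.Binomial commutativeSemiring as Binomial
  open import Relation.Binary.Reasoning.Setoid setoid

  -- Peels one factor off a difference of powers, which gives the induction on the exponent when two
  -- powers are compared.
  *-difference : ∀ a b x y → a *ʳ x +ʳ -ʳ (b *ʳ y) ≈ a *ʳ (x +ʳ -ʳ y) +ʳ (a +ʳ -ʳ b) *ʳ y
  *-difference a b x y = begin
    a *ʳ x +ʳ -ʳ (b *ʳ y)                            ≈⟨ +-congˡ (+-identityˡ _) ⟨
    a *ʳ x +ʳ (0# +ʳ -ʳ (b *ʳ y))                     ≈⟨ +-congˡ (+-congʳ (-‿inverseˡ (a *ʳ y))) ⟨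
    a *ʳ x +ʳ ((-ʳ (a *ʳ y) +ʳ a *ʳ y) +ʳ -ʳ (b *ʳ y))    ≈⟨ +-congˡ (+-assoc _ _ _) ⟩
    a *ʳ x +ʳ (-ʳ (a *ʳ y) +ʳ (a *ʳ y +ʳ -ʳ (b *ʳ y)))    ≈⟨ +-assoc _ _ _ ⟨
    (a *ʳ x +ʳ -ʳ (a *ʳ y)) +ʳ (a *ʳ y +ʳ -ʳ (b *ʳ y))
      ≈⟨ +-cong (+-congˡ (-‿distribʳ-* a y)) (+-congˡ (-‿distribˡ-* b y)) ⟩
    (a *ʳ x +ʳ a *ʳ -ʳ y) +ʳ (a *ʳ y +ʳ -ʳ b *ʳ y)        ≈⟨ +-cong (distribˡ a x (-ʳ y)) (distribʳ y a (-ʳ b)) ⟨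
    a *ʳ (x +ʳ -ʳ y) +ʳ (a +ʳ -ʳ b) *ʳ y                ∎

  module _ {p} (0<p : 0 < p) (C×≈0 : ∀ k → 0 < k → k < p → ∀ x → (p choose k) ×ʳ x ≈ 0#) where

    -- Only the two outer terms of the binomial expansion survive. The hypothesis speaks of
    -- multiples of ring elements, so the same proof serves the field and the ring of sums.
    frobenius-+ : ∀ x y → (x +ʳ y) ^ʳ p ≈ x ^ʳ p +ʳ y ^ʳ p
    frobenius-+ x y = go p 0<p C×≈0
      where
      go : ∀ p → 0 < p → (∀ k → 0 < k → k < p → ∀ x → (p choose k) ×ʳ x ≈ 0#) →
           (x +ʳ y) ^ʳ p ≈ x ^ʳ p +ʳ y ^ʳ p
      go (suc p) _ C×≈0 = begin
        (x +ʳ y) ^ʳ suc p              ≈⟨ Binomial.theorem (suc p) x y ⟩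
        t Fin.zero +ʳ ∑ (t ∘ Fin.suc)   ≈⟨ +-congˡ (sum-init-last (t ∘ Fin.suc)) ⟩
        t Fin.zero +ʳ (∑ {p} (λ i → t (Fin.suc (inject₁ i))) +ʳ t (Fin.suc (fromℕ p)))
          ≈⟨ +-cong first (+-cong (trans (sum-cong-≋ middle) (sum-replicate-zero p)) last′) ⟩
        y ^ʳ suc p +ʳ (0# +ʳ x ^ʳ suc p) ≈⟨ +-congˡ (+-identityˡ _) ⟩
        y ^ʳ suc p +ʳ x ^ʳ suc p        ≈⟨ +-comm _ _ ⟩
        x ^ʳ suc p +ʳ y ^ʳ suc p        ∎
        where
        t = Binomial.binomialTerm x y (suc p)
        first : t Fin.zero ≈ y ^ʳ suc p
        first = trans (×-homo-1 _) (*-identityˡ _)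
        middle : ∀ (i : Fin p) → t (Fin.suc (inject₁ i)) ≈ 0#
        middle i rewrite toℕ-inject₁ i = C×≈0 (suc (toℕ i)) (s≤s z≤n) (s≤s (toℕ<n i)) _
        last′ : t (Fin.suc (fromℕ p)) ≈ x ^ʳ suc p
        last′ rewrite toℕ-fromℕ p | nCn≡1 (suc p) | ℕ.n∸n≡0 p = trans (×-homo-1 _) (*-identityʳ _)

    frobenius-+^ : ∀ r x y → (x +ʳ y) ^ʳ (p ^ r) ≈ x ^ʳ (p ^ r) +ʳ y ^ʳ (p ^ r)
    frobenius-+^ zero    x y = trans (*-identityʳ _) (sym (+-cong (*-identityʳ x) (*-identityʳ y)))
    frobenius-+^ (suc r) x y = begin
      (x +ʳ y) ^ʳ (p * p ^ r)                ≈⟨ ^-assocʳ (x +ʳ y) p (p ^ r) ⟨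
      ((x +ʳ y) ^ʳ p) ^ʳ (p ^ r)                ≈⟨ ^-congˡ (p ^ r) (frobenius-+ x y) ⟩
      (x ^ʳ p +ʳ y ^ʳ p) ^ʳ (p ^ r)              ≈⟨ frobenius-+^ r (x ^ʳ p) (y ^ʳ p) ⟩
      (x ^ʳ p) ^ʳ (p ^ r) +ʳ (y ^ʳ p) ^ʳ (p ^ r)
        ≈⟨ +-cong (^-assocʳ x p (p ^ r)) (^-assocʳ y p (p ^ r)) ⟩
      x ^ʳ (p * p ^ r) +ʳ y ^ʳ (p * p ^ r) ∎

module Univariate {a ℓ} (F : Field a ℓ) where
  open FieldExtras F
  open MonoidRing F ℕ._≟_ ℕ.+-0-isCommutativeMonoid public
  private module R = CommutativeRing sumRing
  open import Algebra.Definitions.RawSemiring (Semiring.rawSemiring R.semiring) public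
    using () renaming (_^_ to _^ˢ_; _×_ to _×ˢ_)
  open import Algebra.Properties.CommutativeSemiring.Exp R.commutativeSemiring public using () renaming (^-congˡ to ^ˢ-cong; ^-assocʳ to ^ˢ-assocʳ)

  record Below (A : Sum) (b : ℕ) : Set ℓ where
    constructor mkBelow
    field above : ∀ k → b < k → coef A k ≈ 0#
  open Below public

  Below-resp : ∀ {A B b} → A ≋ B → Below A b → Below B b
  Below-resp A≋B h = mkBelow λ k b<k → trans (sym (≋-coef A≋B k)) (above h k b<k)

  private
    -- `Below A b` still allows listed terms above `b` that cancel. Once they are dropped, the
    -- degree bound holds for every listed term and can be used inside a pairing.
    cut : ℕ → Sum → Sum
    cut b = select (ℕ._≤? b)

    cut-keys : ∀ b A → All (λ t → proj₂ t ≤ b) (cut b A)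
    cut-keys b = select-All (ℕ._≤? b)

    cut-coef-≤ : ∀ b A k → k ≤ b → coef (cut b A) k ≈ coef A k
    cut-coef-≤ b A k k≤b = coef-select (ℕ._≤? b) A k≤b

    cut-≋ : ∀ {A b} → Below A b → A ≋ cut b A
    cut-≋ {A} {b} below = coef-≋ λ k → case k ℕ.≤? b of λ where
      (yes k≤b) → sym (cut-coef-≤ b A k k≤b)
      (no  k≰b) → trans (above below k (ℕ.≰⇒> k≰b))
        (sym (coef-∉ (cut b A) (All.map (λ v≤b v≡k → k≰b (≡.subst (_≤ b) v≡k v≤b)) (cut-keys b A))))

    -- Under the two bounds, `u + v` reaches `a + b` only if `u` is `a` and `v` is `b`.
    -- Multiplicativity of leading coefficients follows.
    δ-+ : ∀ {a b u v} → u ≤ a → v ≤ b → δ (a + b) (u + v) ≈ δ a u *ᶠ δ b v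
    δ-+ {a} {b} {u} {v} u≤a v≤b with u ℕ.≟ a
    ... | no u≢a = trans (δ-≢ (λ eq → ℕ.<⇒≢ (ℕ.+-mono-<-≤ (ℕ.≤∧≢⇒< u≤a u≢a) v≤b) eq))
                     (sym (trans (*-congʳ (δ-≢ u≢a)) (zeroˡ _)))
    ... | yes ≡.refl with v ℕ.≟ b
    ...   | yes ≡.refl = trans (δ-refl (u + v)) (sym (trans (*-cong (δ-refl u) (δ-refl v)) (*-identityˡ _)))
    ...   | no v≢b = trans (δ-≢ (v≢b ∘ ℕ.+-cancelˡ-≡ u v b)) (sym (trans (*-congˡ (δ-≢ v≢b)) (zeroʳ _)))

  module _ {A B : Sum} {a b : ℕ} (Aa : Below A a) (Bb : Below B b) where
    private
      A′ = cut a A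
      B′ = cut b B

      pairing-cut : ∀ φ → ⟨ A ⊛ B ∣ φ ⟩ ≈ ⟨ A′ ∣ (λ u → ⟨ B′ ∣ (λ v → φ (u + v)) ⟩) ⟩
      pairing-cut φ = trans (at (⊛-cong {A} {A′} {B} {B′} (cut-≋ Aa) (cut-≋ Bb)) φ) (pairing-⊛ A′ B′ φ)

      pairing-cut-cong : ∀ {φ ψ : ℕ → ℕ → Carrier} → (∀ {u v} → u ≤ a → v ≤ b → φ u v ≈ ψ u v) →
        ⟨ A′ ∣ (λ u → ⟨ B′ ∣ φ u ⟩) ⟩ ≈ ⟨ A′ ∣ (λ u → ⟨ B′ ∣ ψ u ⟩) ⟩
      pairing-cut-cong h = pairing-congˡ A′ (All.map (λ u≤a →
        pairing-congˡ B′ (All.map (h u≤a) (cut-keys b B))) (cut-keys a A))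

    ⊛-top : coef (A ⊛ B) (a + b) ≈ coef A a *ᶠ coef B b
    ⊛-top = begin
      coef (A ⊛ B) (a + b)                              ≈⟨ coef-pairing (A ⊛ B) _ ⟩
      ⟨ A ⊛ B ∣ δ (a + b) ⟩                             ≈⟨ pairing-cut _ ⟩
      ⟨ A′ ∣ (λ u → ⟨ B′ ∣ (λ v → δ (a + b) (u + v)) ⟩) ⟩ ≈⟨ pairing-cut-cong δ-+ ⟩
      ⟨ A′ ∣ (λ u → ⟨ B′ ∣ (λ v → δ a u *ᶠ δ b v) ⟩) ⟩
        ≈⟨ pairing-congˡ′ A′ (λ u → trans (pairing-*ˡ B′ (δ a u) (δ b)) (*-comm _ _)) ⟩
      ⟨ A′ ∣ (λ u → ⟨ B′ ∣ δ b ⟩ *ᶠ δ a u) ⟩               ≈⟨ pairing-*ˡ A′ _ (δ a) ⟩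
      ⟨ B′ ∣ δ b ⟩ *ᶠ ⟨ A′ ∣ δ a ⟩                         ≈⟨ *-comm _ _ ⟩
      ⟨ A′ ∣ δ a ⟩ *ᶠ ⟨ B′ ∣ δ b ⟩                         ≈⟨ *-cong (coef-pairing A′ a) (coef-pairing B′ b) ⟨
      coef A′ a *ᶠ coef B′ b
        ≈⟨ *-cong (cut-coef-≤ a A a ℕ.≤-refl) (cut-coef-≤ b B b ℕ.≤-refl) ⟩
      coef A a *ᶠ coef B b                                ∎

    ⊛-Below : Below (A ⊛ B) (a + b)
    ⊛-Below = mkBelow λ k a+b<k → begin
      coef (A ⊛ B) k                                ≈⟨ coef-pairing (A ⊛ B) _ ⟩
      ⟨ A ⊛ B ∣ δ k ⟩                               ≈⟨ pairing-cut _ ⟩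
      ⟨ A′ ∣ (λ u → ⟨ B′ ∣ (λ v → δ k (u + v)) ⟩) ⟩
        ≈⟨ pairing-cut-cong (λ u≤a v≤b → δ-≢ (ℕ.<⇒≢ (ℕ.≤-<-trans (ℕ.+-mono-≤ u≤a v≤b) a+b<k))) ⟩
      ⟨ A′ ∣ (λ u → ⟨ B′ ∣ (λ v → 0#) ⟩) ⟩           ≈⟨ pairing-congˡ′ A′ (λ _ → pairing-0 B′) ⟩
      ⟨ A′ ∣ (λ u → 0#) ⟩                           ≈⟨ pairing-0 A′ ⟩
      0#                                            ∎

  one-Below : Below one 0
  one-Below = mkBelow λ k 0<k → coef-≢ {P = []} (ℕ.<⇒≢ 0<k)

  ^ˢ-Below : ∀ {A a} n → Below A a → Below (A ^ˢ n) (n * a)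
  ^ˢ-Below zero    Aa = one-Below
  ^ˢ-Below (suc n) Aa = ⊛-Below Aa (^ˢ-Below n Aa)

  ^ˢ-top : ∀ {A a} n → Below A a → coef (A ^ˢ n) (n * a) ≈ coef A a ^ᶠ n
  ^ˢ-top zero    Aa = +-identityʳ 1#
  ^ˢ-top (suc n) Aa = trans (⊛-top Aa (^ˢ-Below n Aa)) (*-congˡ (^ˢ-top n Aa))


  open RingIdentities sumRing using (*-difference)

  module _ {A B k₀ κ y} (A≤k₀ : Below A k₀) (B≤k₀ : Below B k₀) (A-k₀ : coef A k₀ ≈ y) (B-k₀ : coef B k₀ ≈ y)
           (κ≤k₀ : κ ≤ k₀) (agree : ∀ k → κ < k → coef A k ≈ coef B k) where
    private
      Δ : Carrier
      Δ = coef A κ +ᶠ -ᶠ coef B κ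

      Δ₁ : Sum
      Δ₁ = A ++ neg B

      Δ₁-Below : Below Δ₁ κ
      Δ₁-Below = mkBelow λ k κ<k → trans (coef-++ A (neg B) k)
        (trans (+-congˡ (coef-neg B k)) (x≈y⇒x+-y≈0 (agree k κ<k)))

      Δ₁-top : coef Δ₁ κ ≈ Δ
      Δ₁-top = trans (coef-++ A (neg B) κ) (+-congˡ (coef-neg B κ))

      Δ^ : ℕ → Sum
      Δ^ n = A ^ˢ n ++ neg (B ^ˢ n)

      statement : ℕ → Set _
      statement q = Below (Δ^ (suc q)) (q * k₀ + κ) ×
                    coef (Δ^ (suc q)) (q * k₀ + κ) ≈ (suc q ×ᶠ 1#) *ᶠ y ^ᶠ q *ᶠ Δ

      -- The exponent is `suc q`, so `q` here is one less than the power taken. In A (A ^ n - B ^ n)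
      -- + (A - B) B ^ n, with n = q + 1, the first summand contributes n copies of y ^ n Δ at the
      -- top and the second contributes one more.
      top : ∀ q → statement q
      top zero = Below-resp (≋-sym step) Δ₁-Below ,
        trans (≋-coef step κ) (trans Δ₁-top
          (sym (trans (*-congʳ (trans (*-identityʳ _) (+-identityʳ 1#))) (*-identityˡ Δ))))
        where
        step : Δ^ 1 ≋ Δ₁
        step = R.+-cong (R.*-identityʳ A) (R.-‿cong (R.*-identityʳ B))
      top (suc q) = Below-resp (≋-sym step) both ,
        (begin
          coef (Δ^ (suc (suc q))) m                            ≈⟨ ≋-coef step m ⟩
          coef (A ⊛ Δ^ (suc q) ++ Δ₁ ⊛ B ^ˢ suc q) m            ≈⟨ coef-++ (A ⊛ Δ^ (suc q)) _ m ⟩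
          coef (A ⊛ Δ^ (suc q)) m +ᶠ coef (Δ₁ ⊛ B ^ˢ suc q) m   ≡⟨ ≡.cong₂ (λ i j → coef (A ⊛ Δ^ (suc q)) i +ᶠ coef (Δ₁ ⊛ B ^ˢ suc q) j) m≡₁ m≡₂ ⟩
          coef (A ⊛ Δ^ (suc q)) (k₀ + (q * k₀ + κ)) +ᶠ coef (Δ₁ ⊛ B ^ˢ suc q) (κ + suc q * k₀)
            ≈⟨ +-cong (⊛-top A≤k₀ IHb) (⊛-top Δ₁-Below (^ˢ-Below (suc q) B≤k₀)) ⟩
          coef A k₀ *ᶠ coef (Δ^ (suc q)) (q * k₀ + κ) +ᶠ coef Δ₁ κ *ᶠ coef (B ^ˢ suc q) (suc q * k₀)
            ≈⟨ +-cong (*-cong A-k₀ IHt) (*-cong Δ₁-top (trans (^ˢ-top (suc q) B≤k₀) (^-congˡ (suc q) B-k₀))) ⟩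
          y *ᶠ ((suc q ×ᶠ 1#) *ᶠ y ^ᶠ q *ᶠ Δ) +ᶠ Δ *ᶠ (y *ᶠ y ^ᶠ q)
            ≈⟨ +-congˡ (*-congʳ (*-identityˡ Δ)) ⟨
          y *ᶠ ((suc q ×ᶠ 1#) *ᶠ y ^ᶠ q *ᶠ Δ) +ᶠ (1# *ᶠ Δ) *ᶠ (y *ᶠ y ^ᶠ q)
            ≈⟨ solve 5 (λ y n w d o → y :* (n :* w :* d) :+ (o :* d) :* (y :* w) := (o :+ n) :* (y :* w) :* d) refl
                 y (suc q ×ᶠ 1#) (y ^ᶠ q) Δ 1# ⟩
          (suc (suc q) ×ᶠ 1#) *ᶠ y ^ᶠ suc q *ᶠ Δ ∎)
        where
        m = suc q * k₀ + κ
        IHb = proj₁ (top q)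
        IHt = proj₂ (top q)
        m≡₁ : m ≡ k₀ + (q * k₀ + κ)
        m≡₁ = ℕ.+-assoc k₀ (q * k₀) κ
        m≡₂ : m ≡ κ + suc q * k₀
        m≡₂ = ℕ.+-comm (suc q * k₀) κ
        step : Δ^ (suc (suc q)) ≋ A ⊛ Δ^ (suc q) ++ Δ₁ ⊛ B ^ˢ suc q
        step = *-difference A B (A ^ˢ suc q) (B ^ˢ suc q)
        both : Below (A ⊛ Δ^ (suc q) ++ Δ₁ ⊛ B ^ˢ suc q) m
        both = mkBelow λ k m<k → trans (coef-++ (A ⊛ Δ^ (suc q)) _ k) (trans (+-cong
          (above (⊛-Below A≤k₀ IHb) k (≡.subst (_< k) m≡₁ m<k))
          (above (⊛-Below Δ₁-Below (^ˢ-Below (suc q) B≤k₀)) k (≡.subst (_< k) m≡₂ m<k)))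
          (+-identityˡ _))

    ^ˢ-difference-top : ∀ q → coef (A ^ˢ suc q) (q * k₀ + κ) +ᶠ -ᶠ coef (B ^ˢ suc q) (q * k₀ + κ)
                        ≈ (suc q ×ᶠ 1#) *ᶠ y ^ᶠ q *ᶠ (coef A κ +ᶠ -ᶠ coef B κ)
    ^ˢ-difference-top q = trans (sym (trans (coef-++ (A ^ˢ suc q) _ _) (+-congˡ (coef-neg (B ^ˢ suc q) _))))
                                (proj₂ (top q))

-- The Frobenius map

module Characteristic {a ℓ} (F : Field a ℓ) where
  open FieldExtras F
  open Univariate F
  private module R = CommutativeRing sumRing
  private module FI = RingIdentities commutativeRing
  private module SI = RingIdentities sumRing

  ×1-* : ∀ n x → n ×ᶠ x ≈ (n ×ᶠ 1#) *ᶠ x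
  ×1-* n x = trans (×-congʳ n (sym (*-identityˡ x))) (sym (×-assoc-* n 1# x))

  module _ {p} (char : HasPositiveChar F p) where
    open HasPositiveChar char

    private
      remainder : ∀ q → .{{_ : NonZero p}} → (q ×ᶠ 1#) ≈ ((q % p) ×ᶠ 1#)
      remainder q = begin
        q ×ᶠ 1#                                       ≡⟨ ≡.cong (_×ᶠ 1#) (m≡m%n+[m/n]*n q p) ⟩
        (q % p + q / p * p) ×ᶠ 1#                 ≈⟨ ×-homo-+ 1# (q % p) (q / p * p) ⟩
        ((q % p) ×ᶠ 1#) +ᶠ ((q / p * p) ×ᶠ 1#)       ≈⟨ +-congˡ (×1-homo-* (q / p) p) ⟩
        ((q % p) ×ᶠ 1#) +ᶠ ((q / p) ×ᶠ 1#) *ᶠ (p ×ᶠ 1#) ≈⟨ +-congˡ (trans (*-congˡ vanishes) (zeroʳ _)) ⟩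
        ((q % p) ×ᶠ 1#) +ᶠ 0#                         ≈⟨ +-identityʳ _ ⟩
        (q % p) ×ᶠ 1#                                 ∎

    -- Modulo the vanishing multiple `p`, `q` and its remainder have the same image; a nonzero
    -- remainder would contradict the minimality of `p`.
    ×1≈0⇒char∣ : ∀ q → q ×ᶠ 1# ≈ 0# → p ∣ q
    ×1≈0⇒char∣ q q≈0 = divides (q / p) (≡.trans (m≡m%n+[m/n]*n q p) (≡.cong (ℕ._+ q / p * p) (zero-rem (q % p) ≡.refl)))
      where
      instance
        nz : NonZero p
        nz = ℕ.>-nonZero positive
      zero-rem : ∀ r → q % p ≡ r → q % p ≡ 0
      zero-rem zero    eq = eq
      zero-rem (suc r) eq = contradiction (m%n<n q p) (ℕ.≤⇒≯ (isMinimal (q % p)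
        (≡.subst (0 <_) (≡.sym eq) (s≤s z≤n)) (trans (sym (remainder q)) q≈0)))

    -- By `absorption`, `k` times the binomial coefficient is a multiple of `p` and vanishes. The
    -- factor `k` does not vanish, being positive and below the minimal `p`.
    C×≈0 : ∀ k → 0 < k → k < p → ∀ x → (p choose k) ×ᶠ x ≈ 0#
    C×≈0 k 0<k k<p x = trans (×1-* (p choose k) x) (trans (*-congʳ (C1≈0 p k 0<k k<p vanishes isMinimal)) (zeroˡ x))
      where
      C1≈0 : ∀ p k → 0 < k → k < p → p ×ᶠ 1# ≈ 0# → (∀ m → 0 < m → m ×ᶠ 1# ≈ 0# → p ≤ m) →
             (p choose k) ×ᶠ 1# ≈ 0#
      C1≈0 (suc p) (suc k) _ k<p van min = noZeroDivisors
        (λ k≈0 → ℕ.<⇒≱ k<p (min (suc k) (s≤s z≤n) k≈0))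
        (begin
          (suc k ×ᶠ 1#) *ᶠ ((suc p choose suc k) ×ᶠ 1#)  ≈⟨ ×1-homo-* (suc k) (suc p choose suc k) ⟨
          (suc k * (suc p choose suc k)) ×ᶠ 1#        ≡⟨ ≡.cong (_×ᶠ 1#) (absorption p k) ⟩
          (suc p * (p choose k)) ×ᶠ 1#                ≈⟨ ×1-homo-* (suc p) (p choose k) ⟩
          (suc p ×ᶠ 1#) *ᶠ ((p choose k) ×ᶠ 1#)          ≈⟨ *-congʳ van ⟩
          0# *ᶠ ((p choose k) ×ᶠ 1#)                    ≈⟨ zeroˡ _ ⟩
          0#                                      ∎)

    C×≋[] : ∀ k → 0 < k → k < p → ∀ P → (p choose k) ×ˢ P ≋ []
    C×≋[] k 0<k k<p P = mk λ φ → trans (pairing-× (p choose k) φ) (C×≈0 k 0<k k<p ⟨ P ∣ φ ⟩)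
      where
      pairing-× : ∀ n φ → ⟨ n ×ˢ P ∣ φ ⟩ ≈ n ×ᶠ ⟨ P ∣ φ ⟩
      pairing-× zero    φ = refl
      pairing-× (suc n) φ = trans (pairing-++ P (n ×ˢ P) φ) (+-congˡ (pairing-× n φ))

  private
    -- `n` climbs towards the known vanishing multiple `m + n`, while no positive multiple up to `n`
    -- vanishes.
    search : ∀ n m → (m + n) ×ᶠ 1# ≈ 0# → (∀ j → 0 < j → j ×ᶠ 1# ≈ 0# → suc n ≤ j) → 0 < m →
             ∃ (HasPositiveChar F)
    search n zero    _    _   ()
    search n (suc m) m+n≈0 min _ with (suc n ×ᶠ 1#) ≟ 0#
    ... | yes n≈0 = suc n , record { positive = s≤s z≤n ; vanishes = n≈0 ; isMinimal = min }
    ... | no n≉0 with m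
    ...   | zero = contradiction m+n≈0 n≉0
    ...   | suc m′ = search (suc n) (suc m′)
        (trans (reflexive (≡.cong (_×ᶠ 1#) (ℕ.+-suc (suc m′) n))) m+n≈0)
        (λ j 0<j j≈0 → ℕ.≤∧≢⇒< (min j 0<j j≈0) λ { ≡.refl → n≉0 j≈0 }) (s≤s z≤n)

  -- `char∤e` only excludes characteristics that divide `e`. A vanishing image of `e` would produce
  -- one, so under `char∤e` the image is nonzero.
  positiveChar : ∀ e → 0 < e → e ×ᶠ 1# ≈ 0# → ∃ λ p → HasPositiveChar F p × p ∣ e
  positiveChar e 0<e e≈0 with search 0 e (trans (reflexive (≡.cong (_×ᶠ 1#) (ℕ.+-identityʳ e))) e≈0) (λ _ 0<j _ → 0<j) 0<e
  ... | p , char = p , char , ×1≈0⇒char∣ char e e≈0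

  term-^ : ∀ c k n → ((c , k) ∷ []) ^ˢ n ≋ (c ^ᶠ n , n * k) ∷ []
  term-^ c k zero    = ≋-refl
  term-^ c k (suc n) = R.*-congˡ {(c , k) ∷ []} (term-^ c k n)

  -- Covers P = 1 and P = p ^ r at once, so that completeness needs no case distinction on the
  -- characteristic.
  record FrobeniusPower (P : ℕ) : Set (a ⊔ ℓ) where
    field
      positive : 0 < P
      ^-+      : ∀ x y → (x +ᶠ y) ^ᶠ P ≈ x ^ᶠ P +ᶠ y ^ᶠ P
      ^ˢ-++    : ∀ A B → (A ++ B) ^ˢ P ≋ A ^ˢ P ++ B ^ˢ P

  frobeniusPower-1 : FrobeniusPower 1
  frobeniusPower-1 = record
    { positive = s≤s z≤n
    ; ^-+ = λ x y → trans (*-identityʳ _) (sym (+-cong (*-identityʳ x) (*-identityʳ y)))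
    ; ^ˢ-++ = λ A B → R.trans (R.*-identityʳ (A ++ B)) (R.sym (R.+-cong (R.*-identityʳ A) (R.*-identityʳ B))) }

  frobeniusPower-char : ∀ {p} r → HasPositiveChar F p → FrobeniusPower (p ^ r)
  frobeniusPower-char {p} r char = record
    { positive = ℕ.>-nonZero⁻¹ _ {{ℕ.m^n≢0 p r {{ℕ.>-nonZero (HasPositiveChar.positive char)}}}}
    ; ^-+ = FI.frobenius-+^ (HasPositiveChar.positive char) (C×≈0 char) r
    ; ^ˢ-++ = SI.frobenius-+^ (HasPositiveChar.positive char) (C×≋[] char) r }

  module FrobeniusMap {P} (frob : FrobeniusPower P) where
    open FrobeniusPower frob

    0^P : 0# ^ᶠ P ≈ 0#
    0^P = go positive
      where
      go : ∀ {n} → 0 < n → 0# ^ᶠ n ≈ 0#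
      go (s≤s _) = zeroˡ _

    -- Additivity turns the hypothesis into (x - y) ^ P = 0, and a field has no nilpotent elements.
    ^P-injective : ∀ {x y} → x ^ᶠ P ≈ y ^ᶠ P → x ≈ y
    ^P-injective {x} {y} eq with (x +ᶠ -ᶠ y) ≟ 0#
    ... | yes x-y≈0 = x+-y≈0⇒x≈y x-y≈0
    ... | no x-y≉0  = ⊥-elim (^-≉0 P x-y≉0 (begin
      (x +ᶠ -ᶠ y) ^ᶠ P                            ≈⟨ +-identityʳ _ ⟨
      (x +ᶠ -ᶠ y) ^ᶠ P +ᶠ 0#                      ≈⟨ +-congˡ (-‿inverseʳ _) ⟨
      (x +ᶠ -ᶠ y) ^ᶠ P +ᶠ (y ^ᶠ P +ᶠ -ᶠ y ^ᶠ P)    ≈⟨ +-assoc _ _ _ ⟨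
      (x +ᶠ -ᶠ y) ^ᶠ P +ᶠ y ^ᶠ P +ᶠ -ᶠ y ^ᶠ P      ≈⟨ +-congʳ (^-+ (x +ᶠ -ᶠ y) y) ⟨
      (x +ᶠ -ᶠ y +ᶠ y) ^ᶠ P +ᶠ -ᶠ y ^ᶠ P
        ≈⟨ +-congʳ (^-congˡ P (trans (+-assoc _ _ _) (trans (+-congˡ (-‿inverseˡ y)) (+-identityʳ x)))) ⟩
      x ^ᶠ P +ᶠ -ᶠ y ^ᶠ P                         ≈⟨ x≈y⇒x+-y≈0 eq ⟩
      0#                                         ∎))

    frobSum : Sum → Sum
    frobSum = map (λ (c , k) → c ^ᶠ P , P * k)

    private
      []^P : [] ^ˢ P ≋ []
      []^P = go positive
        where
        go : ∀ {n} → 0 < n → [] ^ˢ n ≋ []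
        go (s≤s _) = ≋-refl

    ^ˢP≋frobSum : ∀ A → A ^ˢ P ≋ frobSum A
    ^ˢP≋frobSum []            = []^P
    ^ˢP≋frobSum ((c , k) ∷ A) = R.trans (^ˢ-++ ((c , k) ∷ []) A)
      (R.+-cong (term-^ c k P) (^ˢP≋frobSum A))

    coef-^P : ∀ A k → coef (map (λ (c , j) → c ^ᶠ P , j) A) k ≈ coef A k ^ᶠ P
    coef-^P []            k = sym 0^P
    coef-^P ((c , j) ∷ A) k with j ℕ.≟ k
    ... | yes j≡k = trans (coef-≡ {P = map (λ (c , j) → c ^ᶠ P , j) A} j≡k)
      (trans (+-congˡ (coef-^P A k)) (trans (sym (^-+ c (coef A k))) (^-congˡ P (sym (coef-≡ {P = A} j≡k)))))
    ... | no  j≢k = trans (coef-≢ {P = map (λ (c , j) → c ^ᶠ P , j) A} j≢k)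
      (trans (coef-^P A k) (^-congˡ P (sym (coef-≢ {P = A} j≢k))))

-- Kronecker substitution

record Additive {n} (h : Vec ℕ n → ℕ) : Set where
  field
    +-homo : ∀ u v → h (zipWith _+_ u v) ≡ h u + h v
    0-homo : h (replicate n 0) ≡ 0

sum-additive : ∀ {n} → Additive (Vec.sum {n})
sum-additive {n} = record { +-homo = plus ; 0-homo = zeros n }
  where
  plus : ∀ {n} (u v : Vec ℕ n) → Vec.sum (zipWith _+_ u v) ≡ Vec.sum u + Vec.sum v
  plus []      []      = ≡.refl
  plus (x ∷ u) (y ∷ v) = ≡.trans (≡.cong (x + y +_) (plus u v))
    (solve 4 (λ x y z w → x :+ y :+ (z :+ w) := x :+ z :+ (y :+ w)) ≡.refl x y (Vec.sum u) (Vec.sum v))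
    where open +-*-Solver
  zeros : ∀ n → Vec.sum (replicate n 0) ≡ 0
  zeros zero    = ≡.refl
  zeros (suc n) = zeros n

lookup-additive : ∀ {n} (i : Fin n) → Additive (λ u → Vec.lookup u i)
lookup-additive i = record
  { +-homo = λ u v → lookup-zipWith _+_ i u v ; 0-homo = lookup-replicate i 0 }

-- The exponents as digits in base `W`, lowest first: the Kronecker substitution of x ^ (W ^ i) for
-- the i-th variable.
key : ℕ → List ℕ → ℕ
key W = foldr (λ a k → a + W * k) 0

keyᵛ : ∀ {n} → ℕ → Vec ℕ n → ℕ
keyᵛ W = key W ∘ toList

key-additive : ∀ {n} W → Additive (keyᵛ {n} W)
key-additive {n} W = record { +-homo = plus ; 0-homo = zeros n }
  where
  plus : ∀ {n} (u v : Vec ℕ n) → keyᵛ W (zipWith _+_ u v) ≡ keyᵛ W u + keyᵛ W v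
  plus []      []      = ≡.refl
  plus (x ∷ u) (y ∷ v) = ≡.trans (≡.cong (λ k → x + y + W * k) (plus u v))
    (solve 5 (λ x y z w q → x :+ y :+ q :* (z :+ w) := x :+ q :* z :+ (y :+ q :* w)) ≡.refl x y (keyᵛ W u) (keyᵛ W v) W)
    where open +-*-Solver
  zeros : ∀ n → keyᵛ W (replicate n 0) ≡ 0
  zeros zero    = ≡.refl
  zeros (suc n) = ≡.trans (≡.cong (W *_) (zeros n)) (ℕ.*-zeroʳ W)

*-additive : ∀ {n} {h : Vec ℕ n → ℕ} → Additive h → ∀ P → Additive (λ u → P * h u)
*-additive {h = h} H P = record
  { +-homo = λ u v → ≡.trans (≡.cong (P *_) (+-homo u v)) (ℕ.*-distribˡ-+ P (h u) (h v))
  ; 0-homo = ≡.trans (≡.cong (P *_) 0-homo) (ℕ.*-zeroʳ P) }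
  where open Additive H

+-additive : ∀ {n} {g h : Vec ℕ n → ℕ} → Additive g → Additive h → Additive (λ u → g u + h u)
+-additive {g = g} {h} G H = record
  { +-homo = λ u v → ≡.trans (≡.cong₂ _+_ (G.+-homo u v) (H.+-homo u v))
      (solve 4 (λ x y z w → x :+ y :+ (z :+ w) := x :+ z :+ (y :+ w)) ≡.refl (g u) (g v) (h u) (h v))
  ; 0-homo = ≡.cong₂ _+_ G.0-homo H.0-homo }
  where
  module G = Additive G
  module H = Additive H
  open +-*-Solver

digits-< : ∀ {W m a x} → a < W → x < m → a + W * x < W * m
digits-< {W} {m} {a} {x} a<W x<m = begin-strict
  a + W * x  <⟨ ℕ.+-monoˡ-< (W * x) a<W ⟩
  W + W * x  ≡⟨ ℕ.*-suc W x ⟨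
  W * suc x    ≤⟨ ℕ.*-monoʳ-≤ W x<m ⟩
  W * m        ∎
  where open ℕ.≤-Reasoning

digits-injective : ∀ {W a b} x y → a < W → b < W → a + W * x ≡ b + W * y → a ≡ b × x ≡ y
digits-injective {W} {a} {b} x y a<W b<W eq with ℕ.<-cmp x y
... | tri< x<y _ _ = contradiction eq (ℕ.<⇒≢ (ℕ.<-≤-trans (digits-< a<W x<y) (ℕ.m≤n+m _ b)))
... | tri≈ _ ≡.refl _ = ℕ.+-cancelʳ-≡ (W * x) a b eq , ≡.refl
... | tri> _ _ y<x = contradiction (≡.sym eq) (ℕ.<⇒≢ (ℕ.<-≤-trans (digits-< b<W y<x) (ℕ.m≤n+m _ a)))

-- A bound on the total degree keeps every digit below `W` and passes on to the remaining digits.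
key-injective : ∀ {n W} {u v : Vec ℕ n} → Vec.sum u < W → Vec.sum v < W → keyᵛ W u ≡ keyᵛ W v → u ≡ v
key-injective {u = []}    {[]}    _   _   _  = ≡.refl
key-injective {W = W} {u = x ∷ u} {y ∷ v} u<W v<W eq
  with digits-injective (keyᵛ W u) (keyᵛ W v) (ℕ.≤-<-trans (ℕ.m≤m+n x _) u<W) (ℕ.≤-<-trans (ℕ.m≤m+n y _) v<W) eq
... | x≡y , ku≡kv = ≡.cong₂ _∷_ x≡y
  (key-injective (ℕ.≤-<-trans (ℕ.m≤n+m _ x) u<W) (ℕ.≤-<-trans (ℕ.m≤n+m _ y) v<W) ku≡kv)

key-< : ∀ {n W} {u : Vec ℕ n} → Vec.sum u < W → keyᵛ W u < W ^ n
key-< {u = []}    _   = s≤s z≤n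
key-< {W = W} {u = x ∷ u} u<W = digits-< {W} (ℕ.≤-<-trans (ℕ.m≤m+n x _) u<W) (key-< {u = u} (ℕ.≤-<-trans (ℕ.m≤n+m _ x) u<W))

-- Only the high digits matter: M e x ≤ e k₀ < M (b + 1).
leading-digit-≤ : ∀ e {M k x k₀ k′ y b} → k + M * x ≤ k₀ → e * k₀ ≡ k′ + M * y → k′ < M → y ≤ b →
                  e * x ≤ b
leading-digit-≤ e {M} {k} {x} {k₀} {k′} {y} {b} ≤k₀ ek₀≡ k′<M y≤b =
  ℕ.≤-pred (ℕ.*-cancelˡ-< M (e * x) (suc b) (begin-strict
    M * (e * x)  ≡⟨ x∙yz≈y∙xz M e x ⟩
    e * (M * x)  ≤⟨ ℕ.*-monoʳ-≤ e (ℕ.≤-trans (ℕ.m≤n+m _ k) ≤k₀) ⟩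
    e * k₀         ≡⟨ ek₀≡ ⟩
    k′ + M * y   <⟨ digits-< k′<M (s≤s y≤b) ⟩
    M * suc b      ∎))
  where
  open ℕ.≤-Reasoning

≤-sumOf : ∀ {b} {B : Set b} (h : B → ℕ) {x xs} → x ∈ xs → h x ≤ foldr (λ y s → h y + s) 0 xs
≤-sumOf h (here ≡.refl) = ℕ.m≤m+n _ _
≤-sumOf h {xs = y ∷ _} (there x∈xs) = ℕ.≤-trans (≤-sumOf h x∈xs) (ℕ.m≤n+m _ (h y))

module Substitution {a ℓ} (F : Field a ℓ) (n : ℕ) where
  open FieldExtras F
  open Univariate F using (Below; mkBelow; above; ^ˢ-Below; ^ˢ-top; _^ˢ_; ^ˢ-cong)
  private module U = Univariate F
  private module R = CommutativeRing U.sumRing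
  module V = Products F (≡-dec {n = n} ℕ._≟_) (zipWith _+_)
  open SumMaps F (≡-dec {n = n} ℕ._≟_) ℕ._≟_ public
  open PolyArithmetic F {n} renaming (_≋_ to _≋ᵖ_)

  coeff≡coef : ∀ P u → coeff P u ≡ V.coef P u
  coeff≡coef []            u = ≡.refl
  coeff≡coef ((c , v) ∷ P) u with ≡-dec ℕ._≟_ v u
  ... | yes _ = ≡.cong (c +ᶠ_) (coeff≡coef P u)
  ... | no  _ = coeff≡coef P u

  ≋ᵖ⇒≋ : ∀ {P Q} → P ≋ᵖ Q → P V.≋ Q
  ≋ᵖ⇒≋ {P} {Q} h = V.coef-≋ λ u → trans (reflexive (≡.sym (coeff≡coef P u)))
    (trans (h u) (reflexive (coeff≡coef Q u)))

  module _ {h : Vec ℕ n → ℕ} (additive : Additive h) where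
    open Additive additive
    open ProductMaps F (≡-dec {n = n} ℕ._≟_) ℕ._≟_ (zipWith _+_) _+_ h +-homo

    reindex-^ : ∀ g e → reindex h (g ^ᵖ e) U.≋ reindex h g ^ˢ e
    reindex-^ g zero    rewrite 0-homo = U.≋-refl
    reindex-^ g (suc e) = U.≋-trans (reindex-⊛ g (g ^ᵖ e)) (R.*-congˡ {reindex h g} (reindex-^ g e))

    reindex-root : ∀ {g f} e → g ^ᵖ e ≋ᵖ f → reindex h g ^ˢ e U.≋ reindex h f
    reindex-root {g} {f} e g^e≋f = U.≋-trans (U.≋-sym (reindex-^ g e)) (reindex-cong h {g ^ᵖ e} (≋ᵖ⇒≋ g^e≋f))

  coef≉0⇒∈ : ∀ P {u} → ¬ V.coef P u ≈ 0# → ∃ λ t → t ∈ P × proj₂ t ≡ u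
  coef≉0⇒∈ []            c≉0 = contradiction refl c≉0
  coef≉0⇒∈ ((c , v) ∷ P) {u} c≉0 with ≡-dec ℕ._≟_ v u
  ... | yes v≡u = _ , here ≡.refl , v≡u
  ... | no  _ with coef≉0⇒∈ P c≉0
  ...   | t , t∈P , eq = t , there t∈P , eq

  ucoef≉0⇒∈ : ∀ P {k} → ¬ U.coef P k ≈ 0# → ∃ λ t → t ∈ P × proj₂ t ≡ k
  ucoef≉0⇒∈ []            c≉0 = contradiction refl c≉0
  ucoef≉0⇒∈ ((c , v) ∷ P) {k} c≉0 with v ℕ.≟ k
  ... | yes v≡k = _ , here ≡.refl , v≡k
  ... | no v≢k with ucoef≉0⇒∈ P (λ p≈0 → c≉0 (trans (U.coef-≢ {P = P} v≢k) p≈0))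
  ...   | t , t∈P , eq = t , there t∈P , eq

  -- The largest listed key may cancel. The search therefore descends from a crude bound, the sum of
  -- all keys, to the first nonzero coefficient, and stops at `k` at the latest.
  top-exists : ∀ A k → ¬ U.coef A k ≈ 0# → ∃ λ k₀ → k ≤ k₀ × Below A k₀ × ¬ U.coef A k₀ ≈ 0#
  top-exists A k c≉0 = go (foldr (λ t s → proj₂ t + s) 0 A) outside (inside c≉0)
    where
    inside : ∀ {j} → ¬ U.coef A j ≈ 0# → j ≤ foldr (λ t s → proj₂ t + s) 0 A
    inside cj≉0 with ucoef≉0⇒∈ A cj≉0
    ... | t , t∈A , ≡.refl = ≤-sumOf proj₂ t∈A
    outside : Below A (foldr (λ t s → proj₂ t + s) 0 A)
    outside = mkBelow λ j b<j → case U.coef A j ≟ 0# of λ where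
      (yes c≈0) → c≈0
      (no c≉0)  → contradiction (inside c≉0) (ℕ.<⇒≱ b<j)
    go : ∀ b → Below A b → k ≤ b → ∃ λ k₀ → k ≤ k₀ × Below A k₀ × ¬ U.coef A k₀ ≈ 0#
    go b A≤b k≤b with U.coef A b ≟ 0#
    ... | no cb≉0 = b , k≤b , A≤b , cb≉0
    go zero    A≤b z≤n | yes cb≈0 = contradiction cb≈0 c≉0
    go (suc b) A≤b k≤b | yes cb≈0 = go b (mkBelow below) (ℕ.≤-pred (ℕ.≤∧≢⇒< k≤b λ { ≡.refl → c≉0 cb≈0 }))
      where
      below : ∀ j → b < j → U.coef A j ≈ 0#
      below j b<j with ℕ.m≤n⇒m<n∨m≡n b<j
      ... | inj₁ b<j    = above A≤b j b<j
      ... | inj₂ ≡.refl = cb≈0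

  -- Order the monomials by l, breaking ties with a Kronecker key that is injective on all
  -- monomials in sight; leading terms are then multiplicative.
  degree-bound : ∀ {l : Vec ℕ n → ℕ} → Additive l → ∀ {f g : Poly F n} {e b} → g ^ᵖ e ≋ᵖ f →
                 (∀ t → t ∈ f → l (proj₂ t) ≤ b) → ∀ u → ¬ V.coef g u ≈ 0# → e * l u ≤ b
  degree-bound {l} additive {f} {g} {e} {b} g^e≋f l≤b u cu≉0 =
    let (t , t∈g , t≡u) = coef≉0⇒∈ g cu≉0
        u<W = ≡.subst (λ v → Vec.sum v < W) t≡u (g<W t∈g)
        (k₀ , hu≤k₀ , below , top≉0) = top-exists (reindex h g) (h u) λ c≈0 →
          cu≉0 (trans (sym (coef-reindex h g u (inj u<W))) c≈0)
        (s , s∈ , s≡) = ucoef≉0⇒∈ (reindex h f) λ c≈0 → ^-≉0 e top≉0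
          (trans (sym (^ˢ-top e below)) (trans (U.≋-coef (reindex-root h-additive {g} {f} e g^e≋f) (e * k₀)) c≈0))
        (s′ , s′∈f , s≡s′) = ∈-map⁻ (λ (c , v) → c , h v) s∈
    in leading-digit-≤ e hu≤k₀ (≡.trans (≡.sym s≡) (≡.cong proj₂ s≡s′)) (key-< {u = proj₂ s′} (f<W s′∈f)) (l≤b s′ s′∈f)
    where
    total : Poly F n → ℕ
    total = foldr (λ t s → Vec.sum (proj₂ t) + s) 0
    W : ℕ
    W = suc (total g + total f)
    h : Vec ℕ n → ℕ
    h v = keyᵛ W v + W ^ n * l v
    h-additive : Additive h
    h-additive = +-additive (key-additive W) (*-additive additive (W ^ n))
    g<W : ∀ {t} → t ∈ g → Vec.sum (proj₂ t) < W
    g<W t∈g = s≤s (ℕ.≤-trans (≤-sumOf (Vec.sum ∘ proj₂) t∈g) (ℕ.m≤m+n _ _))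
    f<W : ∀ {t} → t ∈ f → Vec.sum (proj₂ t) < W
    f<W t∈f = s≤s (ℕ.≤-trans (≤-sumOf (Vec.sum ∘ proj₂) t∈f) (ℕ.m≤n+m _ _))
    inj : Vec.sum u < W → All (λ t → h (proj₂ t) ≡ h u → proj₂ t ≡ u) g
    inj u<W = All.tabulate λ {t} t∈g eq → key-injective (g<W t∈g) u<W
      (proj₁ (digits-injective (l (proj₂ t)) (l u) (key-< {u = proj₂ t} (g<W t∈g)) (key-< {u = u} u<W) eq))

-- Time bounds for programs

-- Bounds the time of a run in which all loops iterate at most X times and no root is extracted.
costOf : ∀ {Γ τ} → Tm Γ τ → ℕ → ℕ
costOf (var _)            X = 1
costOf (let′ s t)         X = suc (costOf s X + costOf t X)
costOf (pair s t)         X = suc (costOf s X + (costOf t X + 0))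
costOf (fst t)            X = suc (costOf t X + 0)
costOf (snd t)            X = suc (costOf t X + 0)
costOf none               X = 1
costOf (some t)           X = suc (costOf t X + 0)
costOf (caseMaybe s t u)  X = suc (costOf s X + (costOf t X + costOf u X))
costOf nil                X = 1
costOf (cons s t)         X = suc (costOf s X + (costOf t X + 0))
costOf (caseList s t u)   X = suc (costOf s X + (costOf t X + costOf u X))
costOf (foldList s t u)   X = suc (costOf s X + (costOf t X + X * costOf u X))
costOf (lit _)            X = 1
costOf (add s t)          X = suc (costOf s X + (costOf t X + 0))
costOf (monus s t)        X = suc (costOf s X + (costOf t X + 0))
costOf (if≤ s t u v)      X = suc (costOf s X + (costOf t X + (costOf u X + costOf v X)))
costOf (iter s t u)       X = suc (costOf s X + (costOf t X + X * costOf u X))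
costOf 0ᶠ                 X = 1
costOf 1ᶠ                 X = 1
costOf (addᶠ s t)         X = suc (costOf s X + (costOf t X + 0))
costOf (mulᶠ s t)         X = suc (costOf s X + (costOf t X + 0))
costOf (negᶠ t)           X = suc (costOf t X + 0)
costOf (invᶠ t)           X = suc (costOf t X + 0)
costOf (if≈ s t u v)      X = suc (costOf s X + (costOf t X + (costOf u X + costOf v X)))
costOf (root t)           X = suc (costOf t X + 0)
costOf (frob t)           X = suc (costOf t X + 0)

-- One number serves as factor and as exponent, as in the time bound to be proved. From X = 1 on
-- exponents may be raised, so sums keep this form.
PolyBounded : (ℕ → ℕ) → Set
PolyBounded f = ∃ λ k → ∀ X → 1 ≤ X → f X ≤ k * X ^ k

private
  1≤X^ : ∀ {X} k → 1 ≤ X → 1 ≤ X ^ k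
  1≤X^ {X} k 1≤X = ≡.subst (_≤ X ^ k) (ℕ.^-zeroˡ k) (ℕ.^-monoˡ-≤ k 1≤X)

  pb-0 : PolyBounded (λ _ → 0)
  pb-0 = 0 , λ _ _ → z≤n

  pb-+ : ∀ {f g} → PolyBounded f → PolyBounded g → PolyBounded (λ X → f X + g X)
  pb-+ {f} {g} (j , fj) (k , gk) = j + k , bound
    where
    open ℕ.≤-Reasoning
    bound : ∀ X → 1 ≤ X → f X + g X ≤ (j + k) * X ^ (j + k)
    bound X@(suc _) 1≤X = begin
      f X + g X                                                   ≤⟨ ℕ.+-mono-≤ (fj X 1≤X) (gk X 1≤X) ⟩
      j * X ^ j + k * X ^ k                               ≤⟨ ℕ.+-mono-≤ (ℕ.*-monoʳ-≤ j (ℕ.^-monoʳ-≤ X (ℕ.m≤m+n j k)))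
                                                                         (ℕ.*-monoʳ-≤ k (ℕ.^-monoʳ-≤ X (ℕ.m≤n+m k j))) ⟩
      j * X ^ (j + k) + k * X ^ (j + k)               ≡⟨ ℕ.*-distribʳ-+ (X ^ (j + k)) j k ⟨
      (j + k) * X ^ (j + k)                                 ∎

  pb-suc : ∀ {f} → PolyBounded f → PolyBounded (λ X → suc (f X))
  pb-suc p = pb-+ {λ _ → 1} (1 , λ X 1≤X → ≡.subst (1 ≤_) (≡.sym (ℕ.*-identityˡ _)) (1≤X^ 1 1≤X)) p

  pb-X* : ∀ {f} → PolyBounded f → PolyBounded (λ X → X * f X)
  pb-X* {f} (k , fk) = suc k , λ X 1≤X → begin
    X * f X                  ≤⟨ ℕ.*-monoʳ-≤ X (fk X 1≤X) ⟩
    X * (k * X ^ k)      ≡⟨ x∙yz≈y∙xz X k (X ^ k) ⟩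
    k * (X * X ^ k)      ≤⟨ ℕ.*-monoˡ-≤ (X * X ^ k) (ℕ.n≤1+n k) ⟩
    suc k * (X * X ^ k)  ∎
    where
    open ℕ.≤-Reasoning

  pb-1 : PolyBounded (λ _ → 1)
  pb-1 = pb-suc pb-0

costOf-poly : ∀ {Γ τ} (t : Tm Γ τ) → PolyBounded (costOf t)
costOf-poly (var _)           = pb-1
costOf-poly (let′ s t)        = pb-suc (pb-+ (costOf-poly s) (costOf-poly t))
costOf-poly (pair s t)        = pb-suc (pb-+ (costOf-poly s) (pb-+ (costOf-poly t) pb-0))
costOf-poly (fst t)           = pb-suc (pb-+ (costOf-poly t) pb-0)
costOf-poly (snd t)           = pb-suc (pb-+ (costOf-poly t) pb-0)
costOf-poly none              = pb-1
costOf-poly (some t)          = pb-suc (pb-+ (costOf-poly t) pb-0)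
costOf-poly (caseMaybe s t u) = pb-suc (pb-+ (costOf-poly s) (pb-+ (costOf-poly t) (costOf-poly u)))
costOf-poly nil               = pb-1
costOf-poly (cons s t)        = pb-suc (pb-+ (costOf-poly s) (pb-+ (costOf-poly t) pb-0))
costOf-poly (caseList s t u)  = pb-suc (pb-+ (costOf-poly s) (pb-+ (costOf-poly t) (costOf-poly u)))
costOf-poly (foldList s t u)  = pb-suc (pb-+ (costOf-poly s) (pb-+ (costOf-poly t) (pb-X* (costOf-poly u))))
costOf-poly (lit _)           = pb-1
costOf-poly (add s t)         = pb-suc (pb-+ (costOf-poly s) (pb-+ (costOf-poly t) pb-0))
costOf-poly (monus s t)       = pb-suc (pb-+ (costOf-poly s) (pb-+ (costOf-poly t) pb-0))
costOf-poly (if≤ s t u v)     = pb-suc (pb-+ (costOf-poly s) (pb-+ (costOf-poly t) (pb-+ (costOf-poly u) (costOf-poly v))))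
costOf-poly (iter s t u)      = pb-suc (pb-+ (costOf-poly s) (pb-+ (costOf-poly t) (pb-X* (costOf-poly u))))
costOf-poly 0ᶠ                = pb-1
costOf-poly 1ᶠ                = pb-1
costOf-poly (addᶠ s t)        = pb-suc (pb-+ (costOf-poly s) (pb-+ (costOf-poly t) pb-0))
costOf-poly (mulᶠ s t)        = pb-suc (pb-+ (costOf-poly s) (pb-+ (costOf-poly t) pb-0))
costOf-poly (negᶠ t)          = pb-suc (pb-+ (costOf-poly t) pb-0)
costOf-poly (invᶠ t)          = pb-suc (pb-+ (costOf-poly t) pb-0)
costOf-poly (if≈ s t u v)     = pb-suc (pb-+ (costOf-poly s) (pb-+ (costOf-poly t) (pb-+ (costOf-poly u) (costOf-poly v))))
costOf-poly (root t)          = pb-suc (pb-+ (costOf-poly t) pb-0)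
costOf-poly (frob t)          = pb-suc (pb-+ (costOf-poly t) pb-0)

iterate : ∀ {b} {B : Set b} → (B → B) → B → ℕ → B
iterate f z zero    = z
iterate f z (suc k) = f (iterate f z k)

-- The value is exact but the time only an upper bound, since `costOf` adds up both branches of a
-- case distinction.
record Yields {b} {B : Set b} (m : Timed B) (v : B) (c : ℕ) : Set b where
  constructor yields
  field
    result : proj₁ m ≡ v
    time≤ : proj₂ m ≤ c
open Yields public

bind : ∀ {b c} {B : Set b} {C : Set c} {m : Timed B} {k : B → Timed C} {v w i j} →
       Yields m v i → Yields (k v) w j → Yields (m >>= k) w (i + j)
bind (yields ≡.refl i) (yields q j) = yields q (ℕ.+-mono-≤ i j)

yield-return : ∀ {b} {B : Set b} {x : B} → Yields (return x) x 0
yield-return = yields ≡.refl z≤n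

weaken : ∀ {b} {B : Set b} {m : Timed B} {v i j} → i ≤ j → Yields m v i → Yields m v j
weaken i≤j (yields v t) = yields v (ℕ.≤-trans t i≤j)

tick : ∀ {b} {B : Set b} {m : Timed B} {v i} → Yields m v i → Yields (charge 1 m) v (suc i)
tick (yields v t) = yields v (s≤s t)

if= : ∀ {Γ τ} → Tm Γ nat → Tm Γ nat → Tm Γ τ → Tm Γ τ → Tm Γ τ
if= s t u v = if≤ s t (if≤ t s u v) v

headTail : ∀ {b c} {B : Set b} {C : Set c} → C → (B → List B → C) → List B → C
headTail z f []       = z
headTail z f (x ∷ xs) = f x xs

module Rules {a ℓ} {F : Field a ℓ} {e : ℕ} (O : RootOracle F e) (X : ℕ) where
  open Field F using (Carrier; 0#; 1#; _+ᶠ_; _*ᶠ_; -ᶠ_; _⁻¹; _≟_)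
  open Semantics O using (⟦_⟧; eval; branch)

  -- `X` is the same for the whole run. Every loop rule asks for at most `X` iterations, and this is
  -- the only way in which sizes enter the time.
  record Runs {Γ τ} (t : Tm Γ τ) (ρ : All ⟦_⟧ Γ) (v : ⟦ τ ⟧) : Set a where
    constructor runs
    field yield : Yields (eval t ρ) v (costOf t X)
  open Runs public

  private variable
    Γ   : List Ty
    σ τ : Ty
    ρ   : All ⟦_⟧ Γ
    b c : Level
    B   : Set b
    C   : Set c

  conv : ∀ {t : Tm Γ τ} {v w} → v ≡ w → Runs t ρ v → Runs t ρ w
  conv ≡.refl r = r

  r-var : ∀ {i : τ ∈ Γ} {v} → lookup ρ i ≡ v → Runs (var i) ρ v
  r-var eq = runs (yields eq (s≤s z≤n))

  r-let : ∀ {s : Tm Γ σ} {t : Tm (σ ∷ Γ) τ} {x y} → Runs s ρ x → Runs t (x ∷ ρ) y → Runs (let′ s t) ρ y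
  r-let (runs p) (runs q) = runs (tick (bind p q))

  private
    un : ∀ {b b′} {B : Set b} {B′ : Set b′} {m : Timed B} {x i} {f : B → B′} →
         Yields m x i → Yields (charge 1 (m >>= λ x → return (f x))) (f x) (suc (i + 0))
    un {f = f} p = tick (bind {k = λ x → return (f x)} p yield-return)

    bin : ∀ {b b′ c} {B : Set b} {B′ : Set b′} {C : Set c} {m : Timed B} {m′ : Timed B′} {x y i j} {f : B → B′ → C} →
          Yields m x i → Yields m′ y j →
          Yields (charge 1 (m >>= λ x → m′ >>= λ y → return (f x y))) (f x y) (suc (i + (j + 0)))
    bin {m′ = m′} {f = f} p q = tick (bind {k = λ x → m′ >>= λ y → return (f x y)} p
      (bind {k = λ y → return (f _ y)} q yield-return))

  r-pair : ∀ {s : Tm Γ σ} {t : Tm Γ τ} {x y} → Runs s ρ x → Runs t ρ y → Runs (pair s t) ρ (x , y)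
  r-pair (runs p) (runs q) = runs (bin p q)

  r-fst : ∀ {t : Tm Γ (σ ⊗ τ)} {x} → Runs t ρ x → Runs (fst t) ρ (proj₁ x)
  r-fst (runs p) = runs (un p)

  r-snd : ∀ {t : Tm Γ (σ ⊗ τ)} {x} → Runs t ρ x → Runs (snd t) ρ (proj₂ x)
  r-snd (runs p) = runs (un p)

  r-none : Runs {τ = maybe τ} none ρ nothing
  r-none = runs (tick yield-return)

  r-some : ∀ {t : Tm Γ τ} {x} → Runs t ρ x → Runs (some t) ρ (just x)
  r-some (runs p) = runs (un p)

  r-nil : Runs {τ = list τ} nil ρ []
  r-nil = runs (tick yield-return)

  r-cons : ∀ {s : Tm Γ τ} {t : Tm Γ (list τ)} {x y} → Runs s ρ x → Runs t ρ y → Runs (cons s t) ρ (x ∷ y)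
  r-cons (runs p) (runs q) = runs (bin p q)

  r-lit : ∀ k → Runs (lit k) ρ (lift k)
  r-lit k = runs (tick yield-return)

  r-add : ∀ {s t : Tm Γ nat} {x y} → Runs s ρ (lift x) → Runs t ρ (lift y) → Runs (add s t) ρ (lift (x + y))
  r-add (runs p) (runs q) = runs (bin p q)

  r-monus : ∀ {s t : Tm Γ nat} {x y} → Runs s ρ (lift x) → Runs t ρ (lift y) → Runs (monus s t) ρ (lift (x ℕ.∸ y))
  r-monus (runs p) (runs q) = runs (bin p q)

  r-0ᶠ : Runs 0ᶠ ρ 0#
  r-0ᶠ = runs (tick yield-return)

  r-1ᶠ : Runs 1ᶠ ρ 1#
  r-1ᶠ = runs (tick yield-return)

  r-addᶠ : ∀ {s t : Tm Γ fld} {x y} → Runs s ρ x → Runs t ρ y → Runs (addᶠ s t) ρ (x +ᶠ y)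
  r-addᶠ (runs p) (runs q) = runs (bin p q)

  r-mulᶠ : ∀ {s t : Tm Γ fld} {x y} → Runs s ρ x → Runs t ρ y → Runs (mulᶠ s t) ρ (x *ᶠ y)
  r-mulᶠ (runs p) (runs q) = runs (bin p q)

  r-negᶠ : ∀ {t : Tm Γ fld} {x} → Runs t ρ x → Runs (negᶠ t) ρ (-ᶠ x)
  r-negᶠ (runs p) = runs (un p)

  r-invᶠ : ∀ {t : Tm Γ fld} {x} → Runs t ρ x → Runs (invᶠ t) ρ (x ⁻¹)
  r-invᶠ (runs p) = runs (un p)

  private
    yield-branch : ∀ {q} {Q : Set q} (Q? : Dec Q) {u v : Tm Γ τ} (h : B → ⟦ τ ⟧) {x y} →
                   Runs u ρ (h x) → Runs v ρ (h y) →
                   Yields (branch Q? u v ρ) (h (if does Q? then x else y)) (costOf u X + costOf v X)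
    yield-branch (yes _) h (runs p) _ = weaken (ℕ.m≤m+n _ _) p
    yield-branch (no  _) h _ (runs p) = weaken (ℕ.m≤n+m _ _) p

  -- `h` encodes pure data. With the conditional underneath it, the value of a program is the
  -- encoding of a pure function, whose correctness can be proved without programs.
  r-if≤ : ∀ {s t : Tm Γ nat} {u v : Tm Γ τ} (h : B → ⟦ τ ⟧) {m n x y} → Runs s ρ (lift m) → Runs t ρ (lift n) →
          Runs u ρ (h x) → Runs v ρ (h y) → Runs (if≤ s t u v) ρ (h (if does (m ℕ.≤? n) then x else y))
  r-if≤ {ρ = ρ} {t = t} {u} {v} h {m} {n} (runs p) (runs q) ru rv = runs (tick (bind
    {k = λ x → eval t ρ >>= λ y → branch (lower x ℕ.≤? lower y) u v ρ} p
    (bind {k = λ y → branch (m ℕ.≤? lower y) u v ρ} q (yield-branch (m ℕ.≤? n) h ru rv))))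

  r-if≈ : ∀ {s t : Tm Γ fld} {u v : Tm Γ τ} (h : B → ⟦ τ ⟧) {m n x y} → Runs s ρ m → Runs t ρ n →
          Runs u ρ (h x) → Runs v ρ (h y) → Runs (if≈ s t u v) ρ (h (if does (m ≟ n) then x else y))
  r-if≈ {ρ = ρ} {t = t} {u} {v} h {m} {n} (runs p) (runs q) ru rv = runs (tick (bind
    {k = λ x → eval t ρ >>= λ y → branch (x ≟ y) u v ρ} p
    (bind {k = λ y → branch (m ≟ y) u v ρ} q (yield-branch (m ≟ n) h ru rv))))

  r-if= : ∀ {s t : Tm Γ nat} {u v : Tm Γ τ} (h : B → ⟦ τ ⟧) {m n x y} → Runs s ρ (lift m) → Runs t ρ (lift n) →
          Runs u ρ (h x) → Runs v ρ (h y) → Runs (if= s t u v) ρ (h (if does (m ℕ.≟ n) then x else y))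
  r-if= h {m} {n} {x} {y} p q ru rv = conv (≡.cong h
    (both (m ℕ.≤? n) (n ℕ.≤? m) (m ℕ.≟ n) ℕ.≤-antisym ℕ.≤-reflexive (ℕ.≤-reflexive ∘ ≡.sym)))
    (r-if≤ h p q (r-if≤ h q p ru rv) rv)
    where
    both : ∀ {P Q R : Set} (P? : Dec P) (Q? : Dec Q) (R? : Dec R) → (P → Q → R) → (R → P) → (R → Q) →
           (if does P? then (if does Q? then x else y) else y) ≡ (if does R? then x else y)
    both (yes p) (yes q) R?      pqr _  _  rewrite dec-true R? (pqr p q) = ≡.refl
    both (yes p) (no ¬q) R?      _   _  rq rewrite dec-false R? (¬q ∘ rq) = ≡.refl
    both (no ¬p) Q?      R?      _   rp _  rewrite dec-false R? (¬p ∘ rp) = ≡.refl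

  r-caseMaybe : ∀ {s : Tm Γ (maybe σ)} {t : Tm Γ τ} {u : Tm (σ ∷ Γ) τ} (g : B → ⟦ σ ⟧) {m y} {f : B → ⟦ τ ⟧} →
                Runs s ρ (Maybe.map g m) → Runs t ρ y → (∀ x → Runs u (g x ∷ ρ) (f x)) →
                Runs (caseMaybe s t u) ρ (maybe′ f y m)
  r-caseMaybe {ρ = ρ} {s = s} {t} {u} g {m} {y} {f} (runs p) (runs q) r = runs (tick (cases m p))
    where
    cases : ∀ m → Yields (eval s ρ) (Maybe.map g m) (costOf s X) →
            Yields (Semantics.step O (caseMaybe s t u) ρ) (maybe′ f y m) (costOf s X + (costOf t X + costOf u X))
    cases m p with Semantics.step O s ρ | p
    cases nothing  p | _ , _ | yields ≡.refl l =
      yields (result q) (ℕ.+-mono-≤ l (ℕ.≤-trans (time≤ q) (ℕ.m≤m+n _ _)))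
    cases (just x) p | _ , _ | yields ≡.refl l =
      yields (result (yield (r x))) (ℕ.+-mono-≤ l (ℕ.≤-trans (time≤ (yield (r x))) (ℕ.m≤n+m _ _)))

  r-caseList : ∀ {s : Tm Γ (list σ)} {t : Tm Γ τ} {u : Tm (σ ∷ list σ ∷ Γ) τ} (g : B → ⟦ σ ⟧) (h : C → ⟦ τ ⟧)
               {xs y} {f : B → List B → C} →
               Runs s ρ (map g xs) → Runs t ρ (h y) → (∀ x xs → Runs u (g x ∷ map g xs ∷ ρ) (h (f x xs))) →
               Runs (caseList s t u) ρ (h (headTail y f xs))
  r-caseList {ρ = ρ} {s = s} {t} {u} g h {xs} {y} {f} (runs p) (runs q) r = runs (tick (cases xs p))
    where
    cases : ∀ xs → Yields (eval s ρ) (map g xs) (costOf s X) →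
            Yields (Semantics.step O (caseList s t u) ρ) (h (headTail y f xs)) (costOf s X + (costOf t X + costOf u X))
    cases xs p with Semantics.step O s ρ | p
    cases []       p | _ , _ | yields ≡.refl l =
      yields (result q) (ℕ.+-mono-≤ l (ℕ.≤-trans (time≤ q) (ℕ.m≤m+n _ _)))
    cases (x ∷ xs) p | _ , _ | yields ≡.refl l =
      yields (result (yield (r x xs))) (ℕ.+-mono-≤ l (ℕ.≤-trans (time≤ (yield (r x xs))) (ℕ.m≤n+m _ _)))

  private
    yield-foldM : ∀ {u : Tm (σ ∷ τ ∷ Γ) τ} (g : B → ⟦ σ ⟧) (h : C → ⟦ τ ⟧) (f : B → C → C) {i}
      (Inv : List B → C → Set i) xs {z k} → length xs ≤ k → Inv [] z →
      (∀ {x ys y} pre → xs ≡ pre ++ x ∷ ys → Inv ys y → Inv (x ∷ ys) (f x y) × Runs u (g x ∷ h y ∷ ρ) (h (f x y))) →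
      Inv xs (foldr f z xs) ×
      Yields (foldM (λ x y → eval u (x ∷ y ∷ ρ)) (h z) (map g xs)) (h (foldr f z xs)) (k * costOf u X)
    yield-foldM g h f Inv []       {k = k}     _       iz r = iz , weaken z≤n yield-return
    yield-foldM {ρ = ρ} {u = u} g h f Inv (x ∷ xs) {k = suc k} (s≤s l) iz r
      with yield-foldM {u = u} g h f Inv xs l iz (λ pre eq → r (x ∷ pre) (≡.cong (x ∷_) eq))
    ... | inv , p with r [] ≡.refl inv
    ...   | inv′ , runs q = inv′ , weaken (ℕ.≤-reflexive (ℕ.+-comm (k * costOf u X) (costOf u X)))
            (bind {k = λ y → eval u (g x ∷ y ∷ ρ)} p q)

    yield-iterM : ∀ {u : Tm (τ ∷ Γ) τ} (h : C → ⟦ τ ⟧) (f : C → C) {i} (Inv : ℕ → C → Set i) k {z} →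
      Inv 0 z → (∀ {j y} → j < k → Inv j y → Inv (suc j) (f y) × Runs u (h y ∷ ρ) (h (f y))) →
      Inv k (iterate f z k) ×
      Yields (iterM (λ y → eval u (y ∷ ρ)) (h z) k) (h (iterate f z k)) (k * costOf u X)
    yield-iterM h f Inv zero    iz r = iz , yield-return
    yield-iterM {ρ = ρ} {u = u} h f Inv (suc k) iz r
      with yield-iterM {u = u} h f Inv k iz (λ j<k → r (ℕ.m<n⇒m<1+n j<k))
    ... | inv , p with r (ℕ.n<1+n k) inv
    ...   | inv′ , runs q = inv′ , weaken (ℕ.≤-reflexive (ℕ.+-comm (k * costOf u X) (costOf u X)))
            (bind {k = λ y → eval u (y ∷ ρ)} p q)

  -- The invariant carries the size of the accumulator, on which loops in the body depend. Indexed
  -- by the suffix already processed, it can also pin down the accumulator itself.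
  r-foldSuffix : ∀ {s : Tm Γ (list σ)} {t : Tm Γ τ} {u : Tm (σ ∷ τ ∷ Γ) τ} (g : B → ⟦ σ ⟧) (h : C → ⟦ τ ⟧)
    (f : B → C → C) {i} (Inv : List B → C → Set i) {xs z} →
    Runs s ρ (map g xs) → Runs t ρ (h z) → length xs ≤ X → Inv [] z →
    (∀ {x ys y} pre → xs ≡ pre ++ x ∷ ys → Inv ys y → Inv (x ∷ ys) (f x y) × Runs u (g x ∷ h y ∷ ρ) (h (f x y))) →
    Runs (foldList s t u) ρ (h (foldr f z xs))
  r-foldSuffix {ρ = ρ} {t = t} {u} g h f Inv {xs} {z} (runs p) (runs q) l iz r = runs (tick (bind
    {k = λ xs → eval t ρ >>= λ z → foldM (λ x y → eval u (x ∷ y ∷ ρ)) z xs} p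
    (bind {k = λ z → foldM (λ x y → eval u (x ∷ y ∷ ρ)) z (map g xs)} q (proj₂ (yield-foldM {u = u} g h f Inv xs l iz r)))))

  r-foldInv : ∀ {s : Tm Γ (list σ)} {t : Tm Γ τ} {u : Tm (σ ∷ τ ∷ Γ) τ} (g : B → ⟦ σ ⟧) (h : C → ⟦ τ ⟧)
    (f : B → C → C) {i} (Inv : C → Set i) {xs z} →
    Runs s ρ (map g xs) → Runs t ρ (h z) → length xs ≤ X → Inv z →
    (∀ {x y} → x ∈ xs → Inv y → Inv (f x y) × Runs u (g x ∷ h y ∷ ρ) (h (f x y))) →
    Runs (foldList s t u) ρ (h (foldr f z xs))
  r-foldInv g h f Inv p q l iz r = r-foldSuffix g h f (λ _ → Inv) p q l iz
    (λ pre → λ { ≡.refl → r (∈-++⁺ʳ pre (here ≡.refl)) })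

  r-fold : ∀ {s : Tm Γ (list σ)} {t : Tm Γ τ} {u : Tm (σ ∷ τ ∷ Γ) τ} (g : B → ⟦ σ ⟧) (h : C → ⟦ τ ⟧)
    (f : B → C → C) {xs z} →
    Runs s ρ (map g xs) → Runs t ρ (h z) → length xs ≤ X →
    (∀ {x y} → x ∈ xs → Runs u (g x ∷ h y ∷ ρ) (h (f x y))) →
    Runs (foldList s t u) ρ (h (foldr f z xs))
  r-fold g h f p q l r = r-foldInv g h f (λ _ → ⊤) p q l tt (λ x∈ _ → tt , r x∈)

  r-iterInv : ∀ {s : Tm Γ nat} {t : Tm Γ τ} {u : Tm (τ ∷ Γ) τ} (h : C → ⟦ τ ⟧) (f : C → C) {i} (Inv : ℕ → C → Set i) {k z} →
    Runs s ρ (lift k) → Runs t ρ (h z) → k ≤ X → Inv 0 z →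
    (∀ {j y} → j < k → Inv j y → Inv (suc j) (f y) × Runs u (h y ∷ ρ) (h (f y))) →
    Runs (iter s t u) ρ (h (iterate f z k))
  r-iterInv {ρ = ρ} {t = t} {u} h f Inv {k} {z} (runs p) (runs q) l iz r = runs (tick (bind
    {k = λ k → eval t ρ >>= λ z → iterM (λ y → eval u (y ∷ ρ)) z (lower k)} p
    (bind {k = λ z → iterM (λ y → eval u (y ∷ ρ)) z k} q
      (weaken (ℕ.*-monoˡ-≤ (costOf u X) l) (proj₂ (yield-iterM {u = u} h f Inv k iz r))))))

  r-iter : ∀ {s : Tm Γ nat} {t : Tm Γ τ} {u : Tm (τ ∷ Γ) τ} (h : C → ⟦ τ ⟧) (f : C → C) {k z} →
    Runs s ρ (lift k) → Runs t ρ (h z) → k ≤ X →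
    (∀ {y} → Runs u (h y ∷ ρ) (h (f y))) →
    Runs (iter s t u) ρ (h (iterate f z k))
  r-iter h f p q l r = r-iterInv h f (λ _ _ → ⊤) p q l tt (λ _ _ → tt , r)

-- Programs on univariate sums

private variable
  Γ   : List Ty
  σ τ : Ty

pattern i0 = here ≡.refl
pattern i1 = there i0
pattern i2 = there i1
pattern i3 = there i2
pattern i4 = there i3
pattern i5 = there i4
pattern i6 = there i5
pattern i7 = there i6
pattern i8 = there i7
pattern i9 = there i8
pattern i10 = there i9
pattern i11 = there i10

pattern w1 i = there i
pattern w2 i = there (w1 i)
pattern w3 i = there (w2 i)
pattern w4 i = there (w3 i)
pattern w5 i = there (w4 i)
pattern w6 i = there (w5 i)
pattern w7 i = there (w6 i)
pattern w8 i = there (w7 i)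

pattern v0 = var i0
pattern v1 = var i1
pattern v2 = var i2
pattern v3 = var i3
pattern v4 = var i4
pattern v5 = var i5

vec uni : Ty
vec = list nat
uni = list (fld ⊗ nat)

-- The first factor counts iterations and is always a small number. Keys, which can be exponential
-- in the number of variables, occur only as the second factor.
mulNat : nat ∈ Γ → nat ∈ Γ → Tm Γ nat
mulNat x y = iter (var x) (lit 0) (add (var (w1 y)) v0)

sumOf : vec ∈ Γ → Tm Γ nat
sumOf u = foldList (var u) (lit 0) (add v0 v1)

keyOf : nat ∈ Γ → vec ∈ Γ → Tm Γ nat
keyOf w u = foldList (var u) (lit 0) (add v0 (mulNat (w2 w) i1))

lengthOf : list τ ∈ Γ → Tm Γ nat
lengthOf l = foldList (var l) (lit 0) (add (lit 1) v1)

tdegOf : polyTy ∈ Γ → Tm Γ nat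
tdegOf f = foldList (var f) (lit 0) (let′ (snd v0) (let′ (sumOf i0) (if≤ v0 v3 v3 v0)))

topKeyOf : uni ∈ Γ → Tm Γ nat
topKeyOf p = foldList (var p) (lit 0) (let′ (snd v0) (if≤ v0 v2 v2 v0))

coefOf : uni ∈ Γ → nat ∈ Γ → Tm Γ fld
coefOf p k = foldList (var p) 0ᶠ (if= (snd v0) (var (w2 k)) (addᶠ (fst v0) v1) v1)

removeKey : nat ∈ Γ → uni ∈ Γ → Tm Γ uni
removeKey k p = foldList (var p) nil (if= (snd v0) (var (w2 k)) v1 (cons v0 v1))

insertTerm : fld ∈ Γ → nat ∈ Γ → uni ∈ Γ → Tm Γ uni
insertTerm c k p = cons (pair (addᶠ (var c) (coefOf p k)) (var k)) (removeKey k p)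

productOf : uni ∈ Γ → uni ∈ Γ → Tm Γ uni
productOf a b = foldList (var a) nil (foldList (var (w2 b)) v1
  (let′ (mulᶠ (fst v2) (fst v0)) (let′ (add (snd v3) (snd v1)) (insertTerm i1 i0 i3))))

powerOf : uni ∈ Γ → nat ∈ Γ → Tm Γ uni
powerOf a q = iter (var q) (cons (pair 1ᶠ (lit 0)) nil) (productOf (w1 a) i0)

differenceOf : uni ∈ Γ → uni ∈ Γ → Tm Γ uni
differenceOf a b = foldList (var b) (var a) (let′ (negᶠ (fst v0)) (let′ (snd v1) (insertTerm i1 i0 i3)))

nonzeroFlag : uni ∈ Γ → Tm Γ nat
nonzeroFlag p = foldList (var p) (lit 0) (if≈ (fst v0) 0ᶠ v1 (lit 1))

scaledKey : nat ∈ Γ → nat ∈ Γ → vec ∈ Γ → Tm Γ nat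
scaledKey w p u = let′ (keyOf w u) (mulNat (w1 p) i0)

imageOf : nat ∈ Γ → nat ∈ Γ → polyTy ∈ Γ → Tm Γ uni
imageOf w p l = foldList (var l) nil
  (let′ (snd v0) (let′ (scaledKey (w3 w) (w3 p) i0) (cons (pair (fst v2) v0) v3)))

-- The head is deleted from `ys`; distinctness keeps the tail inside what is left.
unique-⊆-length : ∀ {b} {B : Set b} {xs ys : List B} → Unique xs → (∀ {x} → x ∈ xs → x ∈ ys) → length xs ≤ length ys
unique-⊆-length []       _  = z≤n
unique-⊆-length {xs = x ∷ xs} {ys} (x∉ ∷ d) ⊆ys = ℕ.≤-trans
  (s≤s (unique-⊆-length d λ w∈ → survives (⊆ys (here ≡.refl)) (⊆ys (there w∈)) (All.lookup x∉ w∈ ∘ ≡.sym)))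
  (ℕ.≤-reflexive (shorter (⊆ys (here ≡.refl))))
  where
  shorter : ∀ {x ys} (p : x ∈ ys) → suc (length (ys ─ p)) ≡ length ys
  shorter (here _)  = ≡.refl
  shorter (there p) = ≡.cong suc (shorter p)
  survives : ∀ {x w ys} (p : x ∈ ys) → w ∈ ys → w ≢ x → w ∈ (ys ─ p)
  survives (here ≡.refl) (here ≡.refl) w≢x = contradiction ≡.refl w≢x
  survives (here ≡.refl) (there q)     _   = q
  survives (there p)     (here ≡.refl) _   = here ≡.refl
  survives (there p)     (there q)     w≢x = there (survives p q w≢x)

module PureUnivariate {a ℓ} (F : Field a ℓ) where
  open FieldExtras F
  open Univariate F

  -- Repeats the steps of `productOf`, to be its exact value. Because of the merging it agrees with
  -- `⊛` only up to `≋`.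
  product : Sum → Sum → Sum
  product A B = foldr (λ s acc → foldr (λ t → insert (proj₁ s *ᶠ proj₁ t , proj₂ s + proj₂ t)) acc B) [] A

  power : Sum → ℕ → Sum
  power A q = iterate (product A) one q

  difference : Sum → Sum → Sum
  difference A B = foldr (λ t → insert (-ᶠ proj₁ t , proj₂ t)) A B

  nonzero : Sum → ℕ
  nonzero = foldr (λ t b → if does (proj₁ t ≟ 0#) then b else 1) 0

  product-pairing : ∀ A B φ → ⟨ product A B ∣ φ ⟩ ≈ ⟨ A ⊛ B ∣ φ ⟩
  product-pairing []      B φ = refl
  product-pairing ((c , u) ∷ A) B φ = begin
    ⟨ foldr (λ t → insert (c *ᶠ proj₁ t , u + proj₂ t)) (product A B) B ∣ φ ⟩  ≈⟨ row B ⟩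
    ⟨ map (λ (d , v) → c *ᶠ d , u + v) B ∣ φ ⟩ +ᶠ ⟨ product A B ∣ φ ⟩          ≈⟨ +-congˡ (product-pairing A B φ) ⟩
    ⟨ map (λ (d , v) → c *ᶠ d , u + v) B ∣ φ ⟩ +ᶠ ⟨ A ⊛ B ∣ φ ⟩
      ≈⟨ pairing-++ (map (λ (d , v) → c *ᶠ d , u + v) B) (A ⊛ B) φ ⟨
    ⟨ ((c , u) ∷ A) ⊛ B ∣ φ ⟩                                                   ∎
    where
    row : ∀ B {acc} → ⟨ foldr (λ t → insert (c *ᶠ proj₁ t , u + proj₂ t)) acc B ∣ φ ⟩ ≈
                      ⟨ map (λ (d , v) → c *ᶠ d , u + v) B ∣ φ ⟩ +ᶠ ⟨ acc ∣ φ ⟩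
    row []            = sym (+-identityˡ _)
    row ((d , v) ∷ B) {acc} = trans (insert-≋ (c *ᶠ d , u + v) (foldr (λ t → insert (c *ᶠ proj₁ t , u + proj₂ t)) acc B) φ)
      (trans (+-congˡ (row B)) (sym (+-assoc _ _ _)))

  power≋^ˢ : ∀ A q → power A q ≋ A ^ˢ q
  power≋^ˢ A zero    = ≋-refl
  power≋^ˢ A (suc q) = ≋-trans (mk (product-pairing A (power A q))) (⊛-cong {A} {A} ≋-refl (power≋^ˢ A q))

  difference-coef : ∀ A B k → coef (difference A B) k ≈ coef A k +ᶠ -ᶠ coef B k
  difference-coef A B k = trans (≋-coef {difference A B} {A ++ neg B} (mk eq) k)
    (trans (coef-++ A (neg B) k) (+-congˡ (coef-neg B k)))
    where
    eq : ∀ φ → ⟨ difference A B ∣ φ ⟩ ≈ ⟨ A ++ neg B ∣ φ ⟩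
    eq φ = trans (go B) (trans (+-comm _ _) (sym (pairing-++ A (neg B) φ)))
      where
      go : ∀ B → ⟨ difference A B ∣ φ ⟩ ≈ ⟨ neg B ∣ φ ⟩ +ᶠ ⟨ A ∣ φ ⟩
      go []      = sym (+-identityˡ _)
      go ((c , k) ∷ B) = trans (insert-≋ (-ᶠ c , k) (difference A B) φ)
        (trans (+-congˡ (go B)) (sym (+-assoc _ _ _)))

  -- Distinct keys from S: the invariant that keeps intermediate sums short.
  Within : List ℕ → Sum → Set a
  Within S P = Distinct P × All (λ t → proj₂ t ∈ S) P

  within-insert : ∀ {S} t P → proj₂ t ∈ S → Within S P → Within S (insert t P)
  within-insert t P t∈S (d , all) = insert-Distinct t P d , insert-All {Q = _∈ _} t P t∈S all

  within-foldr : ∀ {c} {C : Set c} {S} {xs : List C} {h : C → Carrier × ℕ} {z} → (∀ {x} → x ∈ xs → proj₂ (h x) ∈ S) →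
                 Within S z → Within S (foldr (λ x → insert (h x)) z xs)
  within-foldr {xs = []}     _   w = w
  within-foldr {xs = x ∷ xs} {h} {z} h∈S w = within-insert (h x) (foldr (λ x → insert (h x)) z xs) (h∈S (here ≡.refl))
    (within-foldr {xs = xs} (λ x∈ → h∈S (there x∈)) w)

  within-length : ∀ {S} P → Within S P → length P ≤ length S
  within-length {S} P (d , P⊆S) = ≡.subst (_≤ length S) (length-map proj₂ P)
    (unique-⊆-length (AllPairs.map⁺ d) λ k∈ → All.lookup (All.map⁺ P⊆S) k∈)

module MacroRuns {a ℓ} {F : Field a ℓ} {e : ℕ} (O : RootOracle F e) (X : ℕ) where
  open Field F using (Carrier; 0#; 1#; _+ᶠ_; _*ᶠ_; -ᶠ_; _⁻¹; _≟_)
  open Univariate F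
  open PureUnivariate F
  open Semantics O using (⟦_⟧; eval; branch)
  open Rules O X

  private variable
    ρ : All ⟦_⟧ Γ

  encU : Sum → ⟦ uni ⟧
  encU = map (λ (c , k) → c , lift k)

  encV : List ℕ → ⟦ vec ⟧
  encV = map lift

  mulNat-runs : ∀ {x y : nat ∈ Γ} {m k} → lookup ρ x ≡ lift m → lookup ρ y ≡ lift k → m ≤ X →
                Runs (mulNat x y) ρ (lift (m * k))
  mulNat-runs {m = m} {k} x≡ y≡ m≤X = conv (≡.cong lift (value m))
    (r-iter lift (k +_) (r-var x≡) (r-lit 0) m≤X (r-add (r-var y≡) (r-var ≡.refl)))
    where
    value : ∀ m → iterate (k +_) 0 m ≡ m * k
    value zero    = ≡.refl
    value (suc m) = ≡.cong (k +_) (value m)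

  sumOf-runs : ∀ {u : vec ∈ Γ} {us} → lookup ρ u ≡ encV us → length us ≤ X →
               Runs (sumOf u) ρ (lift (foldr _+_ 0 us))
  sumOf-runs u≡ l = r-fold lift lift _+_ (r-var u≡) (r-lit 0) l (λ _ → r-add (r-var ≡.refl) (r-var ≡.refl))

  keyOf-runs : ∀ {w : nat ∈ Γ} {u : vec ∈ Γ} {W us} → lookup ρ w ≡ lift W → lookup ρ u ≡ encV us →
               W ≤ X → length us ≤ X → Runs (keyOf w u) ρ (lift (key W us))
  keyOf-runs w≡ u≡ W≤X l = r-fold lift lift _ (r-var u≡) (r-lit 0) l
    (λ _ → r-add (r-var ≡.refl) (mulNat-runs w≡ ≡.refl W≤X))

  scaledKey-runs : ∀ {w p : nat ∈ Γ} {u : vec ∈ Γ} {W P us} → lookup ρ w ≡ lift W → lookup ρ p ≡ lift P →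
                   lookup ρ u ≡ encV us → W ≤ X → P ≤ X → length us ≤ X →
                   Runs (scaledKey w p u) ρ (lift (P * key W us))
  scaledKey-runs w≡ p≡ u≡ W≤X P≤X l = r-let (keyOf-runs w≡ u≡ W≤X l) (mulNat-runs p≡ ≡.refl P≤X)

  lengthOf-runs : ∀ {b} {B : Set b} {g : B → ⟦ τ ⟧} {l : list τ ∈ Γ} {xs} → lookup ρ l ≡ map g xs → length xs ≤ X →
                  Runs (lengthOf l) ρ (lift (length xs))
  lengthOf-runs {g = g} {xs = xs} l≡ len = conv (≡.cong lift (value xs))
    (r-fold g lift (λ _ → suc) (r-var l≡) (r-lit 0) len (λ _ → r-add (r-lit 1) (r-var ≡.refl)))
    where
    value : ∀ xs → foldr (λ _ → suc) 0 xs ≡ length xs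
    value []       = ≡.refl
    value (_ ∷ xs) = ≡.cong suc (value xs)

  if-⊔ : ∀ m n → (if does (m ℕ.≤? n) then n else m) ≡ m ℕ.⊔ n
  if-⊔ m n = go (m ℕ.≤? n)
    where
    go : (d : Dec (m ≤ n)) → (if does d then n else m) ≡ m ℕ.⊔ n
    go (yes m≤n) = ≡.sym (ℕ.m≤n⇒m⊔n≡n m≤n)
    go (no m≰n)  = ≡.sym (ℕ.m≥n⇒m⊔n≡m (ℕ.≰⇒≥ m≰n))

  topKeyOf-runs : ∀ {p : uni ∈ Γ} {P} → lookup ρ p ≡ encU P → length P ≤ X →
                  Runs (topKeyOf p) ρ (lift (foldr (λ t k → proj₂ t ℕ.⊔ k) 0 P))
  topKeyOf-runs p≡ l = r-fold _ lift (λ t k → proj₂ t ℕ.⊔ k) (r-var p≡) (r-lit 0) l (λ {x} {y} _ →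
    conv (≡.cong lift (if-⊔ (proj₂ x) y))
      (r-let (r-snd (r-var ≡.refl)) (r-if≤ lift (r-var ≡.refl) (r-var ≡.refl) (r-var ≡.refl) (r-var ≡.refl))))

  coefOf-runs : ∀ {p : uni ∈ Γ} {k : nat ∈ Γ} {P K} → lookup ρ p ≡ encU P → lookup ρ k ≡ lift K → length P ≤ X →
                Runs (coefOf p k) ρ (coef P K)
  coefOf-runs {P = P} {K} p≡ k≡ l = conv (value P)
    (r-fold _ id (λ t c → if does (proj₂ t ℕ.≟ K) then proj₁ t +ᶠ c else c) (r-var p≡) r-0ᶠ l (λ _ →
      r-if= id (r-snd (r-var ≡.refl)) (r-var k≡) (r-addᶠ (r-fst (r-var ≡.refl)) (r-var ≡.refl)) (r-var ≡.refl)))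
    where
    value : ∀ P → foldr (λ t c → if does (proj₂ t ℕ.≟ K) then proj₁ t +ᶠ c else c) 0# P ≡ coef P K
    value []      = ≡.refl
    value (t ∷ P) rewrite value P = ≡.refl

  removeKey-runs : ∀ {p : uni ∈ Γ} {k : nat ∈ Γ} {P K} → lookup ρ p ≡ encU P → lookup ρ k ≡ lift K → length P ≤ X →
                   Runs (removeKey k p) ρ (encU (remove K P))
  removeKey-runs {P = P} {K} p≡ k≡ l = conv (≡.cong encU (value P))
    (r-fold _ encU (λ t Q → if does (proj₂ t ℕ.≟ K) then Q else t ∷ Q) (r-var p≡) r-nil l (λ _ →
      r-if= encU (r-snd (r-var ≡.refl)) (r-var k≡) (r-var ≡.refl) (r-cons (r-var ≡.refl) (r-var ≡.refl))))
    where
    value : ∀ P → foldr (λ t Q → if does (proj₂ t ℕ.≟ K) then Q else t ∷ Q) [] P ≡ remove K P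
    value []      = ≡.refl
    value (t ∷ P) rewrite value P = ≡.refl

  insertTerm-runs : ∀ {c : fld ∈ Γ} {k : nat ∈ Γ} {p : uni ∈ Γ} {C K P} → lookup ρ c ≡ C → lookup ρ k ≡ lift K →
                    lookup ρ p ≡ encU P → length P ≤ X → Runs (insertTerm c k p) ρ (encU (insert (C , K) P))
  insertTerm-runs c≡ k≡ p≡ l = r-cons (r-pair (r-addᶠ (r-var c≡) (coefOf-runs p≡ k≡ l)) (r-var k≡)) (removeKey-runs p≡ k≡ l)

  productOf-runs : ∀ {p q : uni ∈ Γ} {A B S} → lookup ρ p ≡ encU A → lookup ρ q ≡ encU B →
    length A ≤ X → length B ≤ X → length S ≤ X → (∀ {s t} → s ∈ A → t ∈ B → proj₂ s + proj₂ t ∈ S) →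
    Within S (product A B) × Runs (productOf p q) ρ (encU (product A B))
  productOf-runs {A = A} {B} {S} p≡ q≡ lA lB lS sums∈S =
    inner A (λ s∈ → s∈) ,
    r-foldInv _ encU _ (Within S) (r-var p≡) r-nil lA ([] , []) (λ {s} {acc} s∈A w → within-foldr (sums∈S s∈A) w ,
      r-foldInv _ encU _ (Within S) (r-var q≡) (r-var ≡.refl) lB w (λ {t} {acc} t∈B w →
        within-insert _ acc (sums∈S s∈A t∈B) w ,
        r-let (r-mulᶠ (r-fst (r-var ≡.refl)) (r-fst (r-var ≡.refl)))
          (r-let (r-add (r-snd (r-var ≡.refl)) (r-snd (r-var ≡.refl)))
            (insertTerm-runs ≡.refl ≡.refl ≡.refl (ℕ.≤-trans (within-length acc w) lS)))))
    where
    inner : ∀ A′ → (∀ {s} → s ∈ A′ → s ∈ A) → Within S (product A′ B)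
    inner []       _  = [] , []
    inner (s ∷ A′) ⊆A = within-foldr (sums∈S (⊆A (here ≡.refl))) (inner A′ (λ s∈ → ⊆A (there s∈)))

  -- `S j` is a stock of keys for the j-th power. Thanks to merging, an intermediate power is no
  -- longer than its stock, however many products of terms contribute to it.
  powerOf-runs : ∀ {p : uni ∈ Γ} {q : nat ∈ Γ} {A Q} (S : ℕ → List ℕ) → lookup ρ p ≡ encU A → lookup ρ q ≡ lift Q →
    length A ≤ X → Q ≤ X → (∀ j → j ≤ Q → length (S j) ≤ X) → 0 ∈ S 0 →
    (∀ {j t l} → j < Q → t ∈ A → l ∈ S j → proj₂ t + l ∈ S (suc j)) →
    Within (S Q) (power A Q) × Runs (powerOf p q) ρ (encU (power A Q))
  powerOf-runs {A = A} {Q} S p≡ q≡ lA Q≤X lS 0∈S closed = within Q ℕ.≤-refl ,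
    r-iterInv encU _ (λ j B → Within (S j) B) (r-var q≡) (r-cons (r-pair r-1ᶠ (r-lit 0)) r-nil) Q≤X ([] ∷ [] , 0∈S ∷ [])
      (λ {j} {B} j<Q w → productOf-runs {S = S (suc j)} p≡ ≡.refl lA (ℕ.≤-trans (within-length B w) (lS j (ℕ.<⇒≤ j<Q))) (lS (suc j) j<Q)
        (λ s∈A t∈B → closed j<Q s∈A (All.lookup (proj₂ w) t∈B)))
    where
    product-within : ∀ {j B} → j < Q → Within (S j) B → ∀ A′ → (∀ {s} → s ∈ A′ → s ∈ A) → Within (S (suc j)) (product A′ B)
    product-within j<Q w []       _  = [] , []
    product-within j<Q w (s ∷ A′) ⊆A = within-foldr
      (λ t∈B → closed j<Q (⊆A (here ≡.refl)) (All.lookup (proj₂ w) t∈B)) (product-within j<Q w A′ (λ s∈ → ⊆A (there s∈)))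
    within : ∀ j → j ≤ Q → Within (S j) (power A j)
    within zero    _   = [] ∷ [] , 0∈S ∷ []
    within (suc j) j<Q = product-within j<Q (within j (ℕ.<⇒≤ j<Q)) A (λ s∈ → s∈)

  differenceOf-runs : ∀ {p q : uni ∈ Γ} {A B S} → lookup ρ p ≡ encU A → lookup ρ q ≡ encU B →
    Within S A → length S + length B ≤ X →
    length (difference A B) ≤ X × Runs (differenceOf p q) ρ (encU (difference A B))
  differenceOf-runs {A = A} {B} {S} p≡ q≡ (d , A⊆S) l =
    ℕ.≤-trans (within-length (difference A B) (within-foldr B⊆ start)) short ,
    r-foldInv _ encU _ (Within S′) (r-var q≡) (r-var p≡) (ℕ.≤-trans (ℕ.m≤n+m _ (length S)) l) start
      (λ {t} {acc} t∈B w → within-insert _ acc (B⊆ t∈B) w ,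
        r-let (r-negᶠ (r-fst (r-var ≡.refl))) (r-let (r-snd (r-var ≡.refl))
          (insertTerm-runs ≡.refl ≡.refl ≡.refl (ℕ.≤-trans (within-length acc w) short))))
    where
    S′ = S ++ map proj₂ B
    short : length S′ ≤ X
    short = ≡.subst (_≤ X) (≡.sym (≡.trans (length-++ S) (≡.cong (length S +_) (length-map proj₂ B)))) l
    start : Within S′ A
    start = d , All.map ∈-++⁺ˡ A⊆S
    B⊆ : ∀ {t} → t ∈ B → proj₂ t ∈ S′
    B⊆ t∈B = ∈-++⁺ʳ S (∈-map⁺ proj₂ t∈B)

  nonzeroFlag-runs : ∀ {p : uni ∈ Γ} {P} → lookup ρ p ≡ encU P → length P ≤ X →
                     Runs (nonzeroFlag p) ρ (lift (nonzero P))
  nonzeroFlag-runs p≡ l = r-fold _ lift _ (r-var p≡) (r-lit 0) l (λ _ →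
    r-if≈ lift (r-fst (r-var ≡.refl)) r-0ᶠ (r-var ≡.refl) (r-lit 1))

-- Candidate monomials

*-^ : ∀ m n k → (m * n) ^ k ≡ m ^ k * n ^ k
*-^ m n zero    = ≡.refl
*-^ m n (suc k) = ≡.trans (≡.cong (m * n *_) (*-^ m n k))
  (solve 4 (λ m n p q → m :* n :* (p :* q) := m :* p :* (n :* q)) ≡.refl m n (m ^ k) (n ^ k))
  where open +-*-Solver

private
  -- Bernoulli's inequality (1 - 1/(z + 1)) ^ j ≥ 1 - j/(z + 1) without fractions; `r` is z + 1 - j.
  bernoulli : ∀ z j r → j + r ≡ suc z → suc z ^ j * r ≤ z ^ j * suc z
  bernoulli z zero    r ≡.refl = ℕ.≤-refl
  bernoulli z (suc j) r eq = begin
    suc z * p * r               ≡⟨ solve 3 (λ z p r → (con 1 :+ z) :* p :* r := p :* r :+ p :* (z :* r)) ≡.refl z p r ⟩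
    p * r + p * (z * r)     ≤⟨ ℕ.+-monoˡ-≤ (p * (z * r)) (ℕ.*-monoʳ-≤ p r≤z) ⟩
    p * z + p * (z * r)     ≡⟨ solve 3 (λ z p r → p :* z :+ p :* (z :* r) := z :* (p :* (con 1 :+ r))) ≡.refl z p r ⟩
    z * (p * suc r)             ≤⟨ ℕ.*-monoʳ-≤ z (bernoulli z j (suc r) (≡.trans (ℕ.+-suc j r) eq)) ⟩
    z * (z ^ j * suc z)       ≡⟨ ℕ.*-assoc z (z ^ j) (suc z) ⟨
    z * z ^ j * suc z         ∎
    where
    open ℕ.≤-Reasoning
    open +-*-Solver
    p = suc z ^ j
    r≤z : r ≤ z
    r≤z = ≡.subst (r ≤_) (ℕ.suc-injective eq) (ℕ.m≤n+m r j)

  -- (1 − 1/(2s)) ^ (s D) ≥ 2 ^ (−D).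
  half-power : ∀ t D → let s = suc t; z = s + t in suc z ^ (s * D) ≤ 2 ^ D * z ^ (s * D)
  half-power t D = begin
    suc z ^ (s * D)              ≡⟨ ℕ.^-*-assoc (suc z) s D ⟨
    (suc z ^ s) ^ D              ≤⟨ ℕ.^-monoˡ-≤ D half ⟩
    (2 * z ^ s) ^ D            ≡⟨ *-^ 2 (z ^ s) D ⟩
    2 ^ D * (z ^ s) ^ D      ≡⟨ ≡.cong (2 ^ D *_) (ℕ.^-*-assoc z s D) ⟩
    2 ^ D * z ^ (s * D)      ∎
    where
    open ℕ.≤-Reasoning
    s = suc t
    z = s + t
    half : suc z ^ s ≤ 2 * z ^ s
    half = ℕ.*-cancelʳ-≤ (suc z ^ s) (2 * z ^ s) s (begin
      suc z ^ s * s      ≤⟨ bernoulli z s s (ℕ.+-suc s t) ⟩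
      z ^ s * suc z      ≡⟨ solve 2 (λ p t → p :* (con 1 :+ (con 1 :+ t :+ t)) := con 2 :* p :* (con 1 :+ t)) ≡.refl (z ^ s) t ⟩
      2 * z ^ s * s    ∎)
      where open +-*-Solver

  -- With z = 2 s - 1 the hypothesis reads T ≤ (2 s / (2 s - 1)) ^ N (2 s) ^ D. The base of the
  -- first power exceeds 1, so N may be raised to s D, where that power is at most 2 ^ D.
  weight-bound : ∀ t D N T → let s = suc t; z = s + t in N ≤ s * D →
                 z ^ N * T ≤ suc z ^ N * suc z ^ D → T ≤ (4 * s) ^ D
  weight-bound t D N T N≤ le = ℕ.*-cancelˡ-≤ (z ^ (s * D)) {{ℕ.m^n≢0 z (s * D)}} (begin
    z ^ (s * D) * T                               ≡⟨ ≡.cong (λ j → z ^ j * T) (ℕ.m∸n+n≡m N≤) ⟨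
    z ^ (k + N) * T                               ≡⟨ ≡.cong (ℕ._* T) (ℕ.^-distribˡ-+-* z k N) ⟩
    z ^ k * z ^ N * T                           ≡⟨ ℕ.*-assoc (z ^ k) (z ^ N) T ⟩
    z ^ k * (z ^ N * T)                         ≤⟨ ℕ.*-mono-≤ (ℕ.^-monoˡ-≤ k (ℕ.n≤1+n z)) le ⟩
    y ^ k * (y ^ N * y ^ D)                   ≡⟨ ℕ.*-assoc (y ^ k) (y ^ N) (y ^ D) ⟨
    y ^ k * y ^ N * y ^ D                     ≡⟨ ≡.cong (ℕ._* y ^ D) (ℕ.^-distribˡ-+-* y k N) ⟨
    y ^ (k + N) * y ^ D                         ≡⟨ ≡.cong (λ j → y ^ j * y ^ D) (ℕ.m∸n+n≡m N≤) ⟩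
    y ^ (s * D) * y ^ D                         ≤⟨ ℕ.*-monoˡ-≤ (y ^ D) (half-power t D) ⟩
    2 ^ D * z ^ (s * D) * y ^ D
      ≡⟨ solve 3 (λ p q r → p :* q :* r := q :* (p :* r)) ≡.refl (2 ^ D) (z ^ (s * D)) (y ^ D) ⟩
    z ^ (s * D) * (2 ^ D * y ^ D)           ≡⟨ ≡.cong (z ^ (s * D) *_) (*-^ 2 y D) ⟨
    z ^ (s * D) * (2 * y) ^ D
      ≡⟨ ≡.cong (λ x → z ^ (s * D) * x ^ D)
           (solve 1 (λ t → con 2 :* (con 1 :+ (con 1 :+ t :+ t)) := con 4 :* (con 1 :+ t)) ≡.refl t) ⟩
    z ^ (s * D) * (4 * s) ^ D                 ∎)
    where
    open ℕ.≤-Reasoning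
    open +-*-Solver
    s = suc t
    z = s + t
    y = suc z
    k = s * D ∸ N

support : List ℕ → ℕ
support []           = 0
support (zero  ∷ ms) = support ms
support (suc _ ∷ ms) = suc (support ms)

-- For s = 1 the exponents of a root are determined by those of f; admitting further candidates
-- would exceed the time bound.
module Candidates (e D s : ℕ) where

  -- `m` will be the sum of the exponents of one variable over all terms of f: it bounds each of
  -- them, is zero for an absent variable, and is the exponent itself if f has a single term.
  Fits : ℕ → ℕ → Set
  Fits m a = e * a ≤ m × (2 ≤ s ⊎ m ≤ e * a)

  Admits : ℕ → ℕ → List ℕ → Set
  Admits m a w = e * (a + sum w) ≤ D × Fits m a

  abstract
    admits? : ∀ m a w → Dec (Admits m a w)
    admits? m a w = (e * (a + sum w) ℕ.≤? D) ×-dec ((e * a ℕ.≤? m) ×-dec ((2 ℕ.≤? s) ⊎-dec (m ℕ.≤? e * a)))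

    does-admits? : ∀ m a w → does (admits? m a w) ≡
      does (e * (a + sum w) ℕ.≤? D) ∧ (does (e * a ℕ.≤? m) ∧ (does (2 ℕ.≤? s) ∨ does (m ℕ.≤? e * a)))
    does-admits? m a w = ≡.refl

  push : ℕ → ℕ → List ℕ → List (List ℕ) → List (List ℕ)
  push m a w L = if does (admits? m a w) then (a ∷ w) ∷ L else L

  column : ℕ → List ℕ → List (List ℕ) → ℕ → List (List ℕ)
  column m w L zero    = L
  column m w L (suc k) = push m k w (column m w L k)

  extend : ℕ → List (List ℕ) → List (List ℕ)
  extend m = foldr (λ w L → column m w L (suc D)) []

  candidates : List ℕ → List (List ℕ)
  candidates = foldr extend ([] ∷ [])

  Candidate : List ℕ → List ℕ → Set
  Candidate ms u = e * sum u ≤ D × Pointwise Fits ms u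

  private
    ∈-column⁻ : ∀ {m w L u} k → u ∈ column m w L k → u ∈ L ⊎ ∃ λ a → a < k × u ≡ a ∷ w × Admits m a w
    ∈-column⁻ zero    u∈ = inj₁ u∈
    ∈-column⁻ {m} {w} (suc k) u∈ with admits? m k w
    ∈-column⁻ (suc k) u∈ | no _ with ∈-column⁻ k u∈
    ... | inj₁ u∈L = inj₁ u∈L
    ... | inj₂ (a , a<k , eq , ok) = inj₂ (a , ℕ.m<n⇒m<1+n a<k , eq , ok)
    ∈-column⁻ (suc k) (here ≡.refl) | yes ok = inj₂ (k , ℕ.n<1+n k , ≡.refl , ok)
    ∈-column⁻ (suc k) (there u∈) | yes _ with ∈-column⁻ k u∈
    ... | inj₁ u∈L = inj₁ u∈L
    ... | inj₂ (a , a<k , eq , ok) = inj₂ (a , ℕ.m<n⇒m<1+n a<k , eq , ok)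

    ∈-column⁺ˡ : ∀ {m w L u} k → u ∈ L → u ∈ column m w L k
    ∈-column⁺ˡ zero    u∈ = u∈
    ∈-column⁺ˡ {m} {w} (suc k) u∈ with admits? m k w
    ... | yes _ = there (∈-column⁺ˡ k u∈)
    ... | no  _ = ∈-column⁺ˡ k u∈

    ∈-column⁺ʳ : ∀ {m w L a} k → a < k → Admits m a w → (a ∷ w) ∈ column m w L k
    ∈-column⁺ʳ {m} {w} (suc k) a<1+k ok with admits? m k w | ℕ.m<1+n⇒m<n∨m≡n a<1+k
    ... | yes _ | inj₁ a<k    = there (∈-column⁺ʳ k a<k ok)
    ... | no  _ | inj₁ a<k    = ∈-column⁺ʳ k a<k ok
    ... | yes _ | inj₂ ≡.refl = here ≡.refl
    ... | no ¬ok | inj₂ ≡.refl = contradiction ok ¬ok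

    ∈-extend⁻ : ∀ {m u} Cs → u ∈ extend m Cs → ∃₂ λ a w → w ∈ Cs × u ≡ a ∷ w × Admits m a w
    ∈-extend⁻ (w ∷ Cs) u∈ with ∈-column⁻ (suc D) u∈
    ... | inj₂ (a , _ , eq , ok) = a , w , here ≡.refl , eq , ok
    ... | inj₁ u∈′ with ∈-extend⁻ Cs u∈′
    ...   | a , w′ , w′∈ , eq , ok = a , w′ , there w′∈ , eq , ok

    ∈-extend⁺ : ∀ {m a w} Cs → a < suc D → w ∈ Cs → Admits m a w → (a ∷ w) ∈ extend m Cs
    ∈-extend⁺ (w ∷ Cs) a<  (here ≡.refl) ok = ∈-column⁺ʳ (suc D) a< ok
    ∈-extend⁺ (w ∷ Cs) a<  (there w∈)    ok = ∈-column⁺ˡ (suc D) (∈-extend⁺ Cs a< w∈ ok)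

  ∈-candidates⁻ : ∀ {u} ms → u ∈ candidates ms → Candidate ms u
  ∈-candidates⁻ []       (here ≡.refl) = ≡.subst (_≤ D) (≡.sym (ℕ.*-zeroʳ e)) z≤n , []
  ∈-candidates⁻ (m ∷ ms) u∈ with ∈-extend⁻ (candidates ms) u∈
  ... | a , w , w∈ , ≡.refl , (e≤D , fits) = e≤D , fits ∷ proj₂ (∈-candidates⁻ ms w∈)

  ∈-candidates⁺ : ∀ {u} ms → 1 ≤ e → Candidate ms u → u ∈ candidates ms
  ∈-candidates⁺ []       1≤e (_ , []) = here ≡.refl
  ∈-candidates⁺ {a ∷ w} (m ∷ ms) 1≤e (e≤D , fits ∷ pw) = ∈-extend⁺ (candidates ms)
    (s≤s (ℕ.≤-trans (ℕ.≤-trans (ℕ.m≤m+n a (sum w)) (ℕ.m≤n*m (a + sum w) e {{ℕ.>-nonZero 1≤e}})) e≤D))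
    (∈-candidates⁺ ms 1≤e (ℕ.≤-trans (ℕ.*-monoʳ-≤ e (ℕ.m≤n+m (sum w) a)) e≤D , pw))
    (e≤D , fits)

  private
    column-unique : ∀ {m w L} k → (∀ a → a ∷ w ∉ L) → Unique L → Unique (column m w L k)
    column-unique zero    _  uL = uL
    column-unique {m} {w} {L} (suc k) ∉L uL with admits? m k w
    ... | no  _ = column-unique k ∉L uL
    ... | yes _ = All.tabulate fresh ∷ column-unique k ∉L uL
      where
      fresh : ∀ {u} → u ∈ column m w L k → (k ∷ w) ≢ u
      fresh u∈ ≡.refl with ∈-column⁻ k u∈
      ... | inj₁ u∈L = ∉L k u∈L
      ... | inj₂ (a , a<k , ≡.refl , _) = ℕ.<-irrefl ≡.refl a<k

  candidates-unique : ∀ ms → Unique (candidates ms)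
  candidates-unique []       = [] ∷ []
  candidates-unique (m ∷ ms) = go (candidates ms) (candidates-unique ms)
    where
    go : ∀ Cs → Unique Cs → Unique (extend m Cs)
    go []       _          = []
    go (w ∷ Cs) (w∉ ∷ uCs) = column-unique (suc D) fresh (go Cs uCs)
      where
      fresh : ∀ a → a ∷ w ∉ extend m Cs
      fresh a aw∈ with ∈-extend⁻ Cs aw∈
      ... | _ , _ , w′∈ , ≡.refl , _ = All.lookup w∉ w′∈ ≡.refl

  module _ (1≤e : 1 ≤ e) where

    private
      ≤e* : ∀ x → x ≤ e * x
      ≤e* x = ℕ.m≤n*m x e {{ℕ.>-nonZero 1≤e}}

      -- The exponent has to solve e a = m, so a second extension is impossible. The right
      -- alternative remembers the solution in order to exclude another one.
      forced-column : s ≤ 1 → ∀ {m w L} k →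
        length (column m w L k) ≤ length L ⊎
        (length (column m w L k) ≤ suc (length L) × ∃ λ a → a < k × e * a ≡ m)
      forced-column s≤1 zero = inj₁ ℕ.≤-refl
      forced-column s≤1 {m} {w} {L} (suc k) with admits? m k w
      ... | no _ with forced-column s≤1 {m} {w} {L} k
      ...   | inj₁ l = inj₁ l
      ...   | inj₂ (l , a , a<k , eq) = inj₂ (l , a , ℕ.m<n⇒m<1+n a<k , eq)
      forced-column s≤1 {m} {w} {L} (suc k) | yes (_ , _ , inj₁ 2≤s) = contradiction s≤1 (ℕ.<⇒≱ 2≤s)
      forced-column s≤1 {m} {w} {L} (suc k) | yes (_ , ek≤m , inj₂ m≤ek) with forced-column s≤1 {m} {w} {L} k
      ...   | inj₁ l = inj₂ (s≤s l , k , ℕ.n<1+n k , ℕ.≤-antisym ek≤m m≤ek)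
      ...   | inj₂ (_ , a , a<k , eq) = contradiction
        (ℕ.*-cancelˡ-≡ a k e {{ℕ.>-nonZero 1≤e}} (≡.trans eq (ℕ.≤-antisym m≤ek ek≤m))) (ℕ.<⇒≢ a<k)

    candidates-forced : s ≤ 1 → ∀ ms → length (candidates ms) ≤ 1
    candidates-forced s≤1 []       = ℕ.≤-refl
    candidates-forced s≤1 (m ∷ ms) = go (candidates ms) (candidates-forced s≤1 ms)
      where
      go : ∀ Cs → length Cs ≤ 1 → length (extend m Cs) ≤ 1
      go []       _ = z≤n
      go (w ∷ []) _ with forced-column s≤1 {m} {w} {[]} (suc D)
      ... | inj₁ l       = ℕ.m≤n⇒m≤1+n l
      ... | inj₂ (l , _) = l
      go (_ ∷ _ ∷ _) (s≤s ())

    -- A candidate of degree b gets the weight y ^ (D − b), which makes the total weight of the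
    -- extensions of w by an exponent a geometric sum.
    module Weights (z : ℕ) where
      y : ℕ
      y = suc z

      weigh : List ℕ → ℕ
      weigh w = y ^ (D ∸ sum w)

      weight : List (List ℕ) → ℕ
      weight = foldr (λ w t → weigh w + t) 0

      length≤weight : ∀ L → length L ≤ weight L
      length≤weight []      = z≤n
      length≤weight (w ∷ L) = ℕ.+-mono-≤ (ℕ.m^n>0 y (D ∸ sum w)) (length≤weight L)

      private
        column-weight : ∀ m w L k →
          z * weight (column m w L k) + y ^ (suc D ∸ (k + sum w)) ≤ z * weight L + y ^ (suc D ∸ sum w)
        column-weight m w L zero = ℕ.≤-refl
        column-weight m w L (suc k) with admits? m k w
        ... | no _ = ℕ.≤-trans (ℕ.+-monoʳ-≤ (z * weight (column m w L k))
                (ℕ.^-monoʳ-≤ y (ℕ.∸-monoʳ-≤ (suc D) (ℕ.n≤1+n (k + sum w))))) (column-weight m w L k)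
        ... | yes (le , _) = begin
          z * (y ^ (D ∸ (k + S)) + T) + y ^ (D ∸ (k + S))
            ≡⟨ solve 3 (λ z p t → z :* (p :+ t) :+ p := z :* t :+ (p :+ z :* p)) ≡.refl z (y ^ (D ∸ (k + S))) T ⟩
          z * T + y ^ suc (D ∸ (k + S))
            ≡⟨ ≡.cong (λ j → z * T + y ^ j) (ℕ.+-∸-assoc 1 (ℕ.≤-trans (≤e* (k + S)) le)) ⟨
          z * T + y ^ (suc D ∸ (k + S))  ≤⟨ column-weight m w L k ⟩
          z * weight L + y ^ (suc D ∸ S)   ∎
          where
          open ℕ.≤-Reasoning
          open +-*-Solver
          S = sum w
          T = weight (column m w L k)

        -- An absent variable admits only the exponent 0, which does not change the weight of `w`.
        -- This keeps `n` out of the number of candidates.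
        column-weight-0 : ∀ w L k → weight (column 0 w L k) ≤ weight L ⊎
          (weight (column 0 w L k) ≤ weigh w + weight L × 0 < k)
        column-weight-0 w L zero = inj₁ ℕ.≤-refl
        column-weight-0 w L (suc k) with admits? 0 k w
        ... | no _ with column-weight-0 w L k
        ...   | inj₁ l       = inj₁ l
        ...   | inj₂ (l , _) = inj₂ (l , s≤s z≤n)
        column-weight-0 w L (suc k) | yes (_ , ek≤0 , _) with ℕ.≤-trans (≤e* k) ek≤0
        column-weight-0 w L (suc .0) | yes _ | z≤n = inj₂ (ℕ.≤-refl , s≤s z≤n)

        Light : List (List ℕ) → Set
        Light = All (λ w → sum w ≤ D)

        extend-weight : ∀ m Cs → Light Cs → z * weight (extend m Cs) ≤ y * weight Cs
        extend-weight m []       []         = ℕ.≤-reflexive (≡.trans (ℕ.*-zeroʳ z) (≡.sym (ℕ.*-zeroʳ y)))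
        extend-weight m (w ∷ Cs) (w≤D ∷ ls) = begin
          z * weight (column m w (extend m Cs) (suc D))   ≤⟨ ℕ.m≤m+n _ _ ⟩
          z * weight (column m w (extend m Cs) (suc D)) + y ^ (suc D ∸ (suc D + sum w))
                                                          ≤⟨ column-weight m w (extend m Cs) (suc D) ⟩
          z * weight (extend m Cs) + y ^ (suc D ∸ sum w)
            ≤⟨ ℕ.+-mono-≤ (extend-weight m Cs ls) (ℕ.≤-reflexive (≡.cong (y ^_) (ℕ.+-∸-assoc 1 w≤D))) ⟩
          y * weight Cs + y * weigh w               ≡⟨ ℕ.+-comm (y * weight Cs) _ ⟩
          y * weigh w + y * weight Cs               ≡⟨ ℕ.*-distribˡ-+ y (weigh w) (weight Cs) ⟨
          y * (weigh w + weight Cs)                   ∎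
          where open ℕ.≤-Reasoning

        extend-weight-0 : ∀ Cs → weight (extend 0 Cs) ≤ weight Cs
        extend-weight-0 []       = z≤n
        extend-weight-0 (w ∷ Cs) with column-weight-0 w (extend 0 Cs) (suc D)
        ... | inj₁ l       = ℕ.≤-trans l (ℕ.≤-trans (extend-weight-0 Cs) (ℕ.m≤n+m _ (weigh w)))
        ... | inj₂ (l , _) = ℕ.≤-trans l (ℕ.+-monoʳ-≤ (weigh w) (extend-weight-0 Cs))

        light : ∀ ms → Light (candidates ms)
        light ms = All.tabulate λ {u} u∈ → ℕ.≤-trans (≤e* (sum u)) (proj₁ (∈-candidates⁻ ms u∈))

      candidates-weight : ∀ ms → z ^ support ms * weight (candidates ms) ≤ y ^ support ms * y ^ D
      candidates-weight []           = ℕ.≤-reflexive (≡.cong (1 *_) (ℕ.+-identityʳ _))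
      candidates-weight (zero  ∷ ms) = ℕ.≤-trans (ℕ.*-monoʳ-≤ (z ^ support ms) (extend-weight-0 (candidates ms))) (candidates-weight ms)
      candidates-weight (suc m ∷ ms) = begin
        z * z ^ N * weight (extend (suc m) (candidates ms))
          ≡⟨ solve 3 (λ z p t → z :* p :* t := p :* (z :* t)) ≡.refl z (z ^ N) (weight (extend (suc m) (candidates ms))) ⟩
        z ^ N * (z * weight (extend (suc m) (candidates ms)))
          ≤⟨ ℕ.*-monoʳ-≤ (z ^ N) (extend-weight (suc m) (candidates ms) (light ms)) ⟩
        z ^ N * (y * weight (candidates ms))
          ≡⟨ solve 3 (λ z p t → p :* (z :* t) := z :* (p :* t)) ≡.refl y (z ^ N) (weight (candidates ms)) ⟩
        y * (z ^ N * weight (candidates ms))   ≤⟨ ℕ.*-monoʳ-≤ y (candidates-weight ms) ⟩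
        y * (y ^ N * y ^ D)                  ≡⟨ ℕ.*-assoc y (y ^ N) _ ⟨
        y * y ^ N * y ^ D                    ∎
        where
        open ℕ.≤-Reasoning
        open +-*-Solver
        N = support ms

    -- The constant 3 comes from 4 s ≤ s ^ 3, which holds for `s` at least 2. The weights are taken
    -- with z = 2 s - 1, the choice for which `weight-bound` is made.
    candidates-length : 2 ≤ s → ∀ ms → support ms ≤ s * D → length (candidates ms) ≤ s ^ (3 * D)
    candidates-length 2≤s ms N≤ = begin
      length (candidates ms)   ≤⟨ go s 2≤s N≤ ⟩
      (4 * s) ^ D          ≤⟨ ℕ.^-monoˡ-≤ D (ℕ.≤-trans (ℕ.*-monoˡ-≤ s (ℕ.*-mono-≤ 2≤s 2≤s))
                                    (ℕ.≤-reflexive (solve 1 (λ s → s :* s :* s := s :* (s :* (s :* con 1))) ≡.refl s))) ⟩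
      (s ^ 3) ^ D          ≡⟨ ℕ.^-*-assoc s 3 D ⟩
      s ^ (3 * D)          ∎
      where
      open ℕ.≤-Reasoning
      open +-*-Solver
      go : ∀ r → 2 ≤ r → support ms ≤ r * D → length (candidates ms) ≤ (4 * r) ^ D
      go (suc t) _ N≤ = ℕ.≤-trans (Weights.length≤weight (suc t + t) (candidates ms))
        (weight-bound t D (support ms) _ N≤ (Weights.candidates-weight (suc t + t) ms))

-- Programs for the candidates and for a single attempt

nthOf : nat ∈ Γ → vec ∈ Γ → Tm Γ nat
nthOf i u = let′ (iter (var i) (var u) (caseList v0 nil v1)) (caseList v0 (lit 0) v0)

colOf : nat ∈ Γ → polyTy ∈ Γ → Tm Γ nat
colOf i f = foldList (var f) (lit 0) (let′ (snd v0) (add (nthOf (w3 i) i0) v2))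

colsOf : nat ∈ Γ → polyTy ∈ Γ → Tm Γ vec
colsOf n f = snd (iter (var n) (pair (var n) nil)
  (let′ (monus (fst v0) (lit 1)) (pair v0 (cons (colOf i0 (w2 f)) (snd v1)))))

candidatesOf : vec ∈ Γ → nat ∈ Γ → nat ∈ Γ → nat ∈ Γ → Tm Γ (list vec)
candidatesOf ms e D s = foldList (var ms) (cons nil nil) (foldList v1 nil
  (snd (iter (add (lit 1) (var (w4 D))) (pair (lit 0) v1)
    (let′ (fst v0) (let′ (cons v0 v2) (let′ (sumOf i0) (let′ (mulNat (w8 e) i0) (let′ (mulNat (w8 (w1 e)) i3)
      (pair (add (lit 1) v4)
        (if≤ v1 (var (w8 (w2 D)))
          (if≤ v0 (var i8)
            (if≤ (lit 2) (var (w8 (w2 s))) (cons v3 (snd v5)) (if≤ (var i8) v0 (cons v3 (snd v5)) (snd v5)))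
            (snd v5))
          (snd v5)))))))))))

numbersOf : nat ∈ Γ → Tm Γ (list nat)
numbersOf e = snd (iter (var e) (pair (lit 0) nil) (let′ (add (lit 1) (fst v0)) (pair v0 (cons v0 (snd v1)))))

-- Division of `k` by `q` becomes a search for a key whose `q`-fold is `k`. The default 0 for an
-- unsuccessful search is harmless, as the outcome of an attempt is checked.
findKeyOf : list vec ∈ Γ → nat ∈ Γ → nat ∈ Γ → nat ∈ Γ → nat ∈ Γ → Tm Γ nat
findKeyOf cs w p q k = foldList (var cs) (lit 0)
  (let′ (scaledKey (w2 w) (w2 p) i0) (let′ (mulNat (w3 q) i0) (if= v0 (var (w4 k)) v1 v3)))

-- The first approximation is a single monomial with coefficient `y`. Smaller candidates are listed
-- with coefficient 0, so that corrections change coefficients and never positions.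
initialOf : list vec ∈ Γ → nat ∈ Γ → nat ∈ Γ → nat ∈ Γ → fld ∈ Γ → Tm Γ polyTy
initialOf cs w p k₀ y = foldList (var cs) nil
  (let′ (scaledKey (w2 w) (w2 p) i0)
    (if≤ v0 (var (w3 k₀)) (cons (pair (if≤ (var (w3 k₀)) v0 (var (w3 y)) 0ᶠ) v1) v2) v2))

-- Serves twice: with the guessed `p` and `q` it shows the errors of an approximation, with 1 and
-- `e` it tests g ^ e = f.
residualOf : nat ∈ Γ → nat ∈ Γ → nat ∈ Γ → polyTy ∈ Γ → uni ∈ Γ → Tm Γ uni
residualOf w p q l h = let′ (imageOf w p l) (let′ (powerOf i0 (w1 q)) (differenceOf i0 (w2 h)))

-- For the right guess `k` is q k₀, so the difference of `k` and `k₀` is the shift (q - 1) k₀ at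
-- which errors show up in the residual.
refineOf : polyTy ∈ Γ → uni ∈ Γ → nat ∈ Γ → nat ∈ Γ → nat ∈ Γ → nat ∈ Γ → nat ∈ Γ → fld ∈ Γ → Tm Γ polyTy
refineOf l h w p q k k₀ inv = let′ (residualOf w p q l h) (foldList (var (w1 l)) nil
  (let′ (snd v0) (let′ (scaledKey (w4 w) (w4 p) i0) (let′ (add (monus (var (w5 k)) (var (w5 k₀))) v0)
    (cons (pair (addᶠ (fst v3) (mulᶠ (negᶠ (coefOf i5 i0)) (var (w6 inv)))) v2) v4)))))

dropZerosOf : polyTy ∈ Γ → Tm Γ polyTy
dropZerosOf l = foldList (var l) nil (if≈ (fst v0) 0ᶠ v1 (cons v0 v1))

inverseOf : nat ∈ Γ → fld ∈ Γ → Tm Γ fld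
inverseOf q y = invᶠ (iter (monus (var q) (lit 1)) (iter (var q) 0ᶠ (addᶠ 1ᶠ v0)) (mulᶠ (var (w1 y)) v0))

attemptOf : nat ∈ Γ → nat ∈ Γ → list vec ∈ Γ → uni ∈ Γ → uni ∈ Γ → nat ∈ Γ → fld ∈ Γ → nat ∈ Γ → nat ∈ Γ →
            Tm Γ (maybe polyTy)
attemptOf w e cs f h k y p q =
  let′ (findKeyOf cs w p q k) (let′ (inverseOf (w1 q) (w1 y))
  -- One round of corrections per candidate; the list acts as a counter.
  (let′ (foldList (var (w2 cs)) (initialOf (w2 cs) (w2 w) (w2 p) i1 (w2 y))
          (refineOf i1 (w4 h) (w4 w) (w4 p) (w4 q) (w4 k) i3 i2))
  (let′ (dropZerosOf i0) (let′ (lit 1) (let′ (residualOf (w5 w) i0 (w5 e) i1 (w5 f))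
  (if≤ (nonzeroFlag i0) (lit 0) (some v2) none))))))

nth : ℕ → List ℕ → ℕ
nth i us = headTail 0 (λ x _ → x) (iterate (headTail [] (λ _ xs → xs)) us i)

private
  iterate-tail : ∀ k (us : List ℕ) → iterate (headTail [] (λ _ xs → xs)) us k ≡ drop k us
  iterate-tail zero    us = ≡.refl
  iterate-tail (suc k) us = ≡.trans (≡.cong (headTail [] (λ _ xs → xs)) (iterate-tail k us)) (tail-drop k us)
    where
    tail-drop : ∀ k (us : List ℕ) → headTail [] (λ _ xs → xs) (drop k us) ≡ drop (suc k) us
    tail-drop zero    []       = ≡.refl
    tail-drop zero    (_ ∷ us) = ≡.refl
    tail-drop (suc k) []       = ≡.refl
    tail-drop (suc k) (_ ∷ us) = tail-drop k us

nth-drop : ∀ k us → nth k us ≡ headTail 0 (λ x _ → x) (drop k us)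
nth-drop k us = ≡.cong (headTail 0 (λ x _ → x)) (iterate-tail k us)

drop-nth : ∀ k us → k < length us → drop k us ≡ nth k us ∷ drop (suc k) us
drop-nth k us k< = ≡.trans (go k us k<) (≡.cong (_∷ drop (suc k) us) (≡.sym (nth-drop k us)))
  where
  go : ∀ k us → k < length us → drop k us ≡ headTail 0 (λ x _ → x) (drop k us) ∷ drop (suc k) us
  go zero    (_ ∷ us) _        = ≡.refl
  go (suc k) (_ ∷ us) (s≤s k<) = go k us k<

nth-+ : ∀ {n} k (u v : Vec ℕ n) → nth k (toList (Vec.zipWith _+_ u v)) ≡ nth k (toList u) + nth k (toList v)
nth-+ k u v rewrite nth-drop k (toList (Vec.zipWith _+_ u v)) | nth-drop k (toList u) | nth-drop k (toList v) = go k u v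
  where
  hd : List ℕ → ℕ
  hd = headTail 0 (λ x _ → x)
  go : ∀ {n} k (u v : Vec ℕ n) → hd (drop k (toList (Vec.zipWith _+_ u v))) ≡ hd (drop k (toList u)) + hd (drop k (toList v))
  go zero    []      []      = ≡.refl
  go zero    (_ ∷ _) (_ ∷ _) = ≡.refl
  go (suc k) []      []      = ≡.refl
  go (suc k) (_ ∷ u) (_ ∷ v) = go k u v

nth-0 : ∀ {n} k → nth k (toList (Vec.replicate n 0)) ≡ 0
nth-0 {n} k rewrite nth-drop k (toList (Vec.replicate n 0)) = go n k
  where
  go : ∀ n k → headTail 0 (λ x _ → x) (drop k (toList (Vec.replicate n 0))) ≡ 0
  go zero    zero    = ≡.refl
  go zero    (suc k) = ≡.refl
  go (suc n) zero    = ≡.refl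
  go (suc n) (suc k) = go n k

collect : List ℕ → ℕ × List ℕ → ℕ × List ℕ
collect us (i , ms) = i ∸ 1 , nth (i ∸ 1) us ∷ ms

collect-drop : ∀ us {n} → length us ≡ n → ∀ j → j ≤ n → iterate (collect us) (n , []) j ≡ (n ∸ j , drop (n ∸ j) us)
collect-drop us {n} len zero    _   = ≡.cong (n ,_) (≡.sym (drop-all n us (ℕ.≤-reflexive len)))
  where
  drop-all : ∀ k (us : List ℕ) → length us ≤ k → drop k us ≡ []
  drop-all zero    []       _       = ≡.refl
  drop-all (suc k) []       _       = ≡.refl
  drop-all (suc k) (_ ∷ us) (s≤s l) = drop-all k us l
collect-drop us {n} len (suc j) j<n rewrite collect-drop us len j (ℕ.<⇒≤ j<n) | ℕ.∸-+-assoc n j 1 | ℕ.+-comm j 1 =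
  ≡.cong (n ∸ suc j ,_) (≡.sym (≡.trans
    (drop-nth (n ∸ suc j) us (≡.subst (n ∸ suc j <_) (≡.sym len) (ℕ.∸-monoʳ-< {n} (s≤s z≤n) j<n)))
    (≡.cong (λ k → nth (n ∸ suc j) us ∷ drop k us) (≡.sym (ℕ.+-∸-assoc 1 j<n)))))

countUp : ℕ × List ℕ → ℕ × List ℕ
countUp (i , ms) = suc i , suc i ∷ ms

columnSums : ∀ {b} {B : Set b} {n} → List (B × Vec ℕ n) → Vec ℕ n
columnSums = foldr (λ t → Vec.zipWith _+_ (proj₂ t)) (Vec.replicate _ 0)

numbers : ℕ → List ℕ
numbers zero    = []
numbers (suc k) = suc k ∷ numbers k

module EnumerationRuns {a ℓ} {F : Field a ℓ} {e : ℕ} (O : RootOracle F e) (X : ℕ) {n : ℕ} (n≤X : n ≤ X) where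
  open Field F using (Carrier; 0#; 1#; _+ᶠ_; _*ᶠ_; -ᶠ_; _⁻¹; _≟_)
  open Univariate F
  open PureUnivariate F
  open Semantics O using (⟦_⟧; eval; branch)
  open Rules O X
  open MacroRuns O X

  private variable
    ρ : All ⟦_⟧ Γ

  toList≤X : ∀ (u : Vec ℕ n) → length (toList u) ≤ X
  toList≤X u = ≡.subst (_≤ X) (≡.sym (length-toList u)) n≤X

  nthOf-runs : ∀ {i : nat ∈ Γ} {u : vec ∈ Γ} {k us} → lookup ρ i ≡ lift k → lookup ρ u ≡ encV us → k ≤ X →
               Runs (nthOf i u) ρ (lift (nth k us))
  nthOf-runs i≡ u≡ k≤X = r-let
    (r-iter encV (headTail [] (λ _ xs → xs)) (r-var i≡) (r-var u≡) k≤X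
      (r-caseList lift encV (r-var ≡.refl) r-nil (λ _ _ → r-var ≡.refl)))
    (r-caseList lift lift (r-var ≡.refl) (r-lit 0) (λ _ _ → r-var ≡.refl))

  colOf-runs : ∀ {i : nat ∈ Γ} {f : polyTy ∈ Γ} {k} {P : Poly F n} → lookup ρ i ≡ lift k → lookup ρ f ≡ encode O P →
               k ≤ X → length P ≤ X → Runs (colOf i f) ρ (lift (nth k (toList (columnSums P))))
  colOf-runs {k = k} {P} i≡ f≡ k≤X l = conv (≡.cong lift (value P))
    (r-fold _ lift (λ t m → nth k (toList (proj₂ t)) + m) (r-var f≡) (r-lit 0) l (λ _ →
      r-let (r-snd (r-var ≡.refl)) (r-add (nthOf-runs i≡ ≡.refl k≤X) (r-var ≡.refl))))
    where
    value : ∀ (P : Poly F n) → foldr (λ t m → nth k (toList (proj₂ t)) + m) 0 P ≡ nth k (toList (columnSums P))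
    value []      = ≡.sym (nth-0 k)
    value (t ∷ P) = ≡.trans (≡.cong (nth k (toList (proj₂ t)) +_) (value P))
      (≡.sym (nth-+ k (proj₂ t) (columnSums P)))

  colsOf-runs : ∀ {m : nat ∈ Γ} {f : polyTy ∈ Γ} {P : Poly F n} → lookup ρ m ≡ lift n → lookup ρ f ≡ encode O P →
                length P ≤ X → Runs (colsOf m f) ρ (encV (toList (columnSums P)))
  colsOf-runs {P = P} m≡ f≡ l = conv (≡.cong encV (≡.trans (≡.cong proj₂ (collect-drop us (length-toList (columnSums P)) n ℕ.≤-refl)) (≡.cong (λ j → drop j us) (ℕ.n∸n≡0 n))))
    (r-snd (r-iterInv (λ (i , ms) → lift i , encV ms) (collect us)
      (λ _ (i , _) → i ≤ X) (r-var m≡) (r-pair (r-var m≡) r-nil) n≤X n≤X (λ {_} {(i , _)} _ i≤X →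
        ℕ.≤-trans (ℕ.m∸n≤m i 1) i≤X ,
        r-let (r-monus (r-fst (r-var ≡.refl)) (r-lit 1))
          (r-pair (r-var ≡.refl) (r-cons (colOf-runs ≡.refl f≡ (ℕ.≤-trans (ℕ.m∸n≤m i 1) i≤X) l) (r-snd (r-var ≡.refl)))))))
    where
    us = toList (columnSums P)

  numbersOf-runs : ∀ {m : nat ∈ Γ} {k} → lookup ρ m ≡ lift k → k ≤ X → Runs (numbersOf m) ρ (encV (numbers k))
  numbersOf-runs {k = k} m≡ k≤X = conv (≡.cong (encV ∘ proj₂) (value k))
    (r-snd (r-iter (λ (i , ms) → lift i , encV ms) countUp (r-var m≡) (r-pair (r-lit 0) r-nil) k≤X
      (r-let (r-add (r-lit 1) (r-fst (r-var ≡.refl))) (r-pair (r-var ≡.refl) (r-cons (r-var ≡.refl) (r-snd (r-var ≡.refl)))))))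
    where
    value : ∀ k → iterate countUp (0 , []) k ≡ (k , numbers k)
    value zero    = ≡.refl
    value (suc k) rewrite value k = ≡.refl

  module _ {e D s : ℕ} where
    open Candidates e D s

    pushNext : ℕ → List ℕ → ℕ × List (List ℕ) → ℕ × List (List ℕ)
    pushNext m w (a , L) = suc a , push m a w L

    -- The outer loop passes through the candidates for every suffix of `Ms`. The length bound is
    -- therefore required for each suffix and not only for the final list.
    candidatesOf-runs : ∀ {ms : vec ∈ Γ} {eᵢ Dᵢ sᵢ : nat ∈ Γ} {Ms} → lookup ρ ms ≡ encV Ms →
      lookup ρ eᵢ ≡ lift e → lookup ρ Dᵢ ≡ lift D → lookup ρ sᵢ ≡ lift s → e ≤ X → suc D ≤ X → length Ms ≤ X →
      (∀ pre ys → Ms ≡ pre ++ ys → length (candidates ys) ≤ X) →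
      Runs (candidatesOf ms eᵢ Dᵢ sᵢ) ρ (map encV (candidates Ms))
    candidatesOf-runs {Ms = Ms} ms≡ e≡ D≡ s≡ e≤X D<X lM lC = r-foldSuffix lift (map encV) extend (λ ys Cs → Cs ≡ candidates ys)
      (r-var ms≡) (r-cons r-nil r-nil) lM ≡.refl λ {m} {ys} {Cs} pre Ms≡ → λ { ≡.refl → ≡.refl ,
        r-fold encV (map encV) (λ w L → column m w L (suc D)) (r-var ≡.refl) r-nil
          (lC (pre ++ m ∷ []) ys (≡.trans Ms≡ (≡.sym (++-assoc pre (m ∷ []) ys))))
          (λ {w} {L} w∈ → conv (≡.cong (map encV ∘ proj₂) (value m w L (suc D)))
            (r-snd (r-iter (λ (a , L) → lift a , map encV L) (pushNext m w)
              (r-add (r-lit 1) (r-var D≡)) (r-pair (r-lit 0) (r-var ≡.refl)) D<X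
              (λ {y} → r-let (r-fst (r-var ≡.refl)) (r-let (r-cons (r-var ≡.refl) (r-var ≡.refl))
                (r-let (sumOf-runs ≡.refl (w-length pre Ms≡ w∈)) (r-let (mulNat-runs e≡ ≡.refl e≤X) (r-let (mulNat-runs e≡ ≡.refl e≤X)
                  (r-pair (r-add (r-lit 1) (r-var ≡.refl)) (conv (≡.cong (map encV) (push-if m (proj₁ y) w (proj₂ y)))
                    (r-if≤ (map encV) (r-var ≡.refl) (r-var D≡)
                      (r-if≤ (map encV) (r-var ≡.refl) (r-var ≡.refl)
                        (r-if≤ (map encV) (r-lit 2) (r-var s≡) (r-cons (r-var ≡.refl) (r-snd (r-var ≡.refl)))
                          (r-if≤ (map encV) (r-var ≡.refl) (r-var ≡.refl) (r-cons (r-var ≡.refl) (r-snd (r-var ≡.refl))) (r-snd (r-var ≡.refl))))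
                        (r-snd (r-var ≡.refl)))
                      (r-snd (r-var ≡.refl))))))))))))) }
      where
      open import Data.List.Properties using (++-assoc)
      w-length : ∀ {m ys w} pre → Ms ≡ pre ++ m ∷ ys → w ∈ candidates ys → suc (length w) ≤ X
      w-length {m} {ys} {w} pre ≡.refl w∈ = ℕ.≤-trans (≡.subst (λ k → suc k ≤ length (pre ++ m ∷ ys))
        (Pointwise-length (proj₂ (∈-candidates⁻ ys w∈))) (≡.subst (suc (length ys) ≤_) (≡.sym (length-++ pre)) (ℕ.m≤n+m _ (length pre)))) lM
      value : ∀ m w L k → iterate (pushNext m w) (0 , L) k ≡ (k , column m w L k)
      value m w L zero    = ≡.refl
      value m w L (suc k) rewrite value m w L k = ≡.refl
      push-if : ∀ m a w L →
        (if does (e * (a + foldr _+_ 0 w) ℕ.≤? D) then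
          (if does (e * a ℕ.≤? m) then
            (if does (2 ℕ.≤? s) then (a ∷ w) ∷ L else (if does (m ℕ.≤? e * a) then (a ∷ w) ∷ L else L)) else L) else L)
        ≡ push m a w L
      push-if m a w L rewrite does-admits? m a w
        with does (e * (a + foldr _+_ 0 w) ℕ.≤? D) | does (e * a ℕ.≤? m) | does (2 ℕ.≤? s) | does (m ℕ.≤? e * a)
      ... | true  | true  | true  | _     = ≡.refl
      ... | true  | true  | false | true  = ≡.refl
      ... | true  | true  | false | false = ≡.refl
      ... | true  | false | _     | _     = ≡.refl
      ... | false | _     | _     | _     = ≡.refl

-- Approximating a root

module PureAttempt {a ℓ} (F : Field a ℓ) (n : ℕ) where
  open Field F using (Carrier; 0#; 1#; _+ᶠ_; _*ᶠ_; -ᶠ_; _⁻¹; _≟_)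
  open Univariate F using (Sum; coef)
  open PureUnivariate F
  open Substitution F n using (reindex)

  scaled : ℕ → ℕ → Vec ℕ n → ℕ
  scaled W P u = P * keyᵛ W u

  image : ℕ → ℕ → Poly F n → Sum
  image W P = reindex (scaled W P)

  findKey : List (Vec ℕ n) → ℕ → ℕ → ℕ → ℕ → ℕ
  findKey Cs W P q K = foldr (λ u k → if does (q * scaled W P u ℕ.≟ K) then scaled W P u else k) 0 Cs

  initial : List (Vec ℕ n) → ℕ → ℕ → ℕ → Carrier → Poly F n
  initial Cs W P k₀ y = foldr (λ u L → if does (scaled W P u ℕ.≤? k₀)
    then ((if does (k₀ ℕ.≤? scaled W P u) then y else 0#) , u) ∷ L else L) [] Cs

  inverse : ℕ → Carrier → Carrier
  inverse q y = iterate (y *ᶠ_) (iterate (1# +ᶠ_) 0# q) (q ∸ 1) ⁻¹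

  residual : ℕ → ℕ → ℕ → Sum → Poly F n → Sum
  residual W P q H L = difference (power (image W P L) q) H

  refine : ℕ → ℕ → ℕ → Sum → ℕ → ℕ → Carrier → Poly F n → Poly F n
  refine W P q H K k₀ inv L = map (λ t →
    proj₁ t +ᶠ (-ᶠ coef (residual W P q H L) ((K ∸ k₀) + scaled W P (proj₂ t))) *ᶠ inv , proj₂ t) L

  dropZeros : Poly F n → Poly F n
  dropZeros = foldr (λ t L → if does (proj₁ t ≟ 0#) then L else t ∷ L) []

  approximate : List (Vec ℕ n) → ℕ → Sum → ℕ → Carrier → ℕ → ℕ → Poly F n
  approximate Cs W H K y P q = foldr (λ (_ : Vec ℕ n) → refine W P q H K k₀ (inverse q y)) (initial Cs W P k₀ y) Cs
    where
    k₀ : ℕ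
    k₀ = findKey Cs W P q K

  check : ℕ → ℕ → Sum → Poly F n → Maybe (Poly F n)
  check W e f g = if does (nonzero (residual W 1 e f g) ℕ.≤? 0) then just g else nothing

  attempt : List (Vec ℕ n) → ℕ → ℕ → Sum → Sum → ℕ → Carrier → ℕ → ℕ → Maybe (Poly F n)
  attempt Cs W e f H K y P q = check W e f (dropZeros (approximate Cs W H K y P q))

  -- A stock of keys for every power up to `e` of any polynomial supported on `Cs`, whether it
  -- approximates a root or not. It keeps residuals short even for wrong guesses of P and q.
  record PowerKeys (Cs : List (Vec ℕ n)) (W P e : ℕ) (bound : ℕ) : Set where
    field
      S      : ℕ → List ℕ
      small  : ∀ j → j ≤ e → length (S j) ≤ bound
      zero∈  : 0 ∈ S 0
      closed : ∀ {j u l} → j < e → u ∈ Cs → l ∈ S j → scaled W P u + l ∈ S (suc j)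

  Supported : List (Vec ℕ n) → Poly F n → Set a
  Supported Cs L = length L ≤ length Cs × All (λ t → proj₂ t ∈ Cs) L

  initial-supported : ∀ Cs W P k₀ y → Supported Cs (initial Cs W P k₀ y)
  initial-supported Cs W P k₀ y = go Cs (λ u∈ → u∈)
    where
    go : ∀ Cs′ → (∀ {u} → u ∈ Cs′ → u ∈ Cs) →
         length (initial Cs′ W P k₀ y) ≤ length Cs′ × All (λ t → proj₂ t ∈ Cs) (initial Cs′ W P k₀ y)
    go []        _  = z≤n , []
    go (u ∷ Cs′) ⊆Cs with go Cs′ (⊆Cs ∘ there) | does (scaled W P u ℕ.≤? k₀)
    ... | l , all | true  = s≤s l , ⊆Cs (here ≡.refl) ∷ all
    ... | l , all | false = ℕ.m≤n⇒m≤1+n l , all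

  map-supported : ∀ {Cs} (h : Term F n → Carrier) L → Supported Cs L → Supported Cs (map (λ t → h t , proj₂ t) L)
  map-supported {Cs} h L (l , all) = ≡.subst (_≤ length Cs) (≡.sym (length-map _ L)) l , go all
    where
    go : ∀ {L} → All (λ t → proj₂ t ∈ Cs) L → All (λ t → proj₂ t ∈ Cs) (map (λ t → h t , proj₂ t) L)
    go []       = []
    go (p ∷ ps) = p ∷ go ps

  approximate-supported : ∀ Cs W H K y P q → Supported Cs (approximate Cs W H K y P q)
  approximate-supported Cs W H K y P q = go Cs
    where
    k₀ = findKey Cs W P q K
    go : ∀ Cs′ → Supported Cs (foldr (λ _ → refine W P q H K k₀ (inverse q y)) (initial Cs W P k₀ y) Cs′)
    go []        = initial-supported Cs W P k₀ y
    go (_ ∷ Cs′) = map-supported _ (foldr (λ _ → refine W P q H K k₀ (inverse q y)) (initial Cs W P k₀ y) Cs′) (go Cs′)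

  dropZeros-supported : ∀ {Cs} L → Supported Cs L → Supported Cs (dropZeros L)
  dropZeros-supported {Cs} L (l , all) = ℕ.≤-trans (shorter L) l , go all
    where
    shorter : ∀ L → length (dropZeros L) ≤ length L
    shorter []      = z≤n
    shorter (t ∷ L) with does (proj₁ t ≟ 0#)
    ... | true  = ℕ.m≤n⇒m≤1+n (shorter L)
    ... | false = s≤s (shorter L)
    go : ∀ {L} → All (λ t → proj₂ t ∈ Cs) L → All (λ t → proj₂ t ∈ Cs) (dropZeros L)
    go []       = []
    go {t ∷ L} (p ∷ ps) with does (proj₁ t ≟ 0#)
    ... | true  = go ps
    ... | false = p ∷ go ps

module AttemptRuns {a ℓ} {F : Field a ℓ} {e : ℕ} (O : RootOracle F e) (X : ℕ) {n : ℕ} (n≤X : n ≤ X)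
  {Cs : List (Vec ℕ n)} {W s bound : ℕ} (W≤X : W ≤ X) (e≤X : e ≤ X) (1≤X : 1 ≤ X) (Cs≤X : length Cs ≤ X)
  (bound≤X : bound + s ≤ X) where
  open Field F using (Carrier; 0#; 1#; _+ᶠ_; _*ᶠ_; -ᶠ_; _⁻¹; _≟_)
  open Univariate F using (Sum; coef)
  open PureUnivariate F
  open PureAttempt F n
  open Semantics O using (⟦_⟧; eval; branch)
  open Rules O X
  open MacroRuns O X
  open EnumerationRuns O X n≤X

  private variable
    ρ : All ⟦_⟧ Γ

  encVᵛ : Vec ℕ n → ⟦ vec ⟧
  encVᵛ = encV ∘ toList

  imageOf-runs : ∀ {w p : nat ∈ Γ} {l : polyTy ∈ Γ} {P L} → lookup ρ w ≡ lift W → lookup ρ p ≡ lift P →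
    lookup ρ l ≡ encode O L → P ≤ X → length L ≤ X → Runs (imageOf w p l) ρ (encU (image W P L))
  imageOf-runs {P = P} {L} w≡ p≡ l≡ P≤X l = conv (≡.cong encU (unfold L))
    (r-fold _ encU (λ t A → (proj₁ t , scaled W P (proj₂ t)) ∷ A) (r-var l≡) r-nil l (λ {t} _ →
      r-let (r-snd (r-var ≡.refl)) (r-let (scaledKey-runs {us = toList (proj₂ t)} w≡ p≡ ≡.refl W≤X P≤X (toList≤X (proj₂ t)))
        (r-cons (r-pair (r-fst (r-var ≡.refl)) (r-var ≡.refl)) (r-var ≡.refl)))))
    where
    unfold : ∀ L → foldr (λ t A → (proj₁ t , scaled W P (proj₂ t)) ∷ A) [] L ≡ image W P L
    unfold []      = ≡.refl
    unfold (t ∷ L) = ≡.cong (_ ∷_) (unfold L)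

  findKeyOf-runs : ∀ {cs : list vec ∈ Γ} {w p q k : nat ∈ Γ} {P Q K} → lookup ρ cs ≡ map encVᵛ Cs →
    lookup ρ w ≡ lift W → lookup ρ p ≡ lift P → lookup ρ q ≡ lift Q → lookup ρ k ≡ lift K → P ≤ X → Q ≤ X →
    Runs (findKeyOf cs w p q k) ρ (lift (findKey Cs W P Q K))
  findKeyOf-runs cs≡ w≡ p≡ q≡ k≡ P≤X Q≤X = r-fold encVᵛ lift _ (r-var cs≡) (r-lit 0) Cs≤X (λ {u} _ →
    r-let (scaledKey-runs {us = toList u} w≡ p≡ ≡.refl W≤X P≤X (toList≤X u)) (r-let (mulNat-runs q≡ ≡.refl Q≤X)
      (r-if= lift (r-var ≡.refl) (r-var k≡) (r-var ≡.refl) (r-var ≡.refl))))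

  initialOf-runs : ∀ {cs : list vec ∈ Γ} {w p k : nat ∈ Γ} {yᵢ : fld ∈ Γ} {P K y} → lookup ρ cs ≡ map encVᵛ Cs →
    lookup ρ w ≡ lift W → lookup ρ p ≡ lift P → lookup ρ k ≡ lift K → lookup ρ yᵢ ≡ y → P ≤ X →
    Runs (initialOf cs w p k yᵢ) ρ (encode O (initial Cs W P K y))
  initialOf-runs cs≡ w≡ p≡ k≡ y≡ P≤X = r-fold encVᵛ (encode O) _ (r-var cs≡) r-nil Cs≤X (λ {u} _ →
    r-let (scaledKey-runs {us = toList u} w≡ p≡ ≡.refl W≤X P≤X (toList≤X u))
      (r-if≤ (encode O) (r-var ≡.refl) (r-var k≡)
        (r-cons (r-pair (r-if≤ id (r-var k≡) (r-var ≡.refl) (r-var y≡) r-0ᶠ) (r-var ≡.refl)) (r-var ≡.refl)) (r-var ≡.refl)))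

  inverseOf-runs : ∀ {q : nat ∈ Γ} {yᵢ : fld ∈ Γ} {Q y} → lookup ρ q ≡ lift Q → lookup ρ yᵢ ≡ y → Q ≤ X →
    Runs (inverseOf q yᵢ) ρ (inverse Q y)
  inverseOf-runs {Q = Q} {y} q≡ y≡ Q≤X = r-invᶠ (r-iter id (y *ᶠ_) (r-monus (r-var q≡) (r-lit 1))
    (r-iter id (1# +ᶠ_) (r-var q≡) r-0ᶠ Q≤X (r-addᶠ r-1ᶠ (r-var ≡.refl))) (ℕ.≤-trans (ℕ.m∸n≤m Q 1) Q≤X)
    (r-mulᶠ (r-var y≡) (r-var ≡.refl)))

  dropZerosOf-runs : ∀ {l : polyTy ∈ Γ} {L : Poly F n} → lookup ρ l ≡ encode O L → length L ≤ X →
    Runs (dropZerosOf l) ρ (encode O (dropZeros L))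
  dropZerosOf-runs l≡ l = r-fold _ (encode O) _ (r-var l≡) r-nil l (λ _ →
    r-if≈ (encode O) (r-fst (r-var ≡.refl)) r-0ᶠ (r-var ≡.refl) (r-cons (r-var ≡.refl) (r-var ≡.refl)))

  residualOf-runs : ∀ {w p q : nat ∈ Γ} {l : polyTy ∈ Γ} {h : uni ∈ Γ} {P Q L H} → PowerKeys Cs W P e bound →
    lookup ρ w ≡ lift W → lookup ρ p ≡ lift P → lookup ρ q ≡ lift Q → lookup ρ l ≡ encode O L → lookup ρ h ≡ encU H →
    P ≤ X → Q ≤ e → Supported Cs L → length H ≤ s →
    length (residual W P Q H L) ≤ X × Runs (residualOf w p q l h) ρ (encU (residual W P Q H L))
  residualOf-runs {ρ = ρ} {h = h} {P = P} {Q} {L} {H} keys w≡ p≡ q≡ l≡ h≡ P≤X Q≤e (lL , L⊆Cs) lH =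
    proj₁ (diff {ρ = ρ} {h} h≡) ,
    r-let (imageOf-runs w≡ p≡ l≡ P≤X (ℕ.≤-trans lL Cs≤X)) (r-let (proj₂ (pow ≡.refl q≡)) (proj₂ (diff h≡)))
    where
    open PowerKeys keys
    A = image W P L
    image-closed : ∀ {j t l} → j < Q → t ∈ A → l ∈ S j → proj₂ t + l ∈ S (suc j)
    image-closed j<Q t∈A l∈ with ∈-map⁻ _ t∈A
    ... | t′ , t′∈L , ≡.refl = closed (ℕ.<-≤-trans j<Q Q≤e) (All.lookup L⊆Cs t′∈L) l∈
    S≤X : ∀ j → j ≤ Q → length (S j) ≤ X
    S≤X j j≤Q = ℕ.≤-trans (small j (ℕ.≤-trans j≤Q Q≤e)) (ℕ.≤-trans (ℕ.m≤m+n bound s) bound≤X)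
    pow : ∀ {Γ} {ρ : All ⟦_⟧ Γ} {i : uni ∈ Γ} {q : nat ∈ Γ} → lookup ρ i ≡ encU A → lookup ρ q ≡ lift Q →
          Within (S Q) (power A Q) × Runs (powerOf i q) ρ (encU (power A Q))
    pow i≡ q≡ = powerOf-runs S i≡ q≡ (ℕ.≤-trans (ℕ.≤-reflexive (length-map _ L)) (ℕ.≤-trans lL Cs≤X))
      (ℕ.≤-trans Q≤e e≤X) S≤X zero∈ image-closed
    diff : ∀ {Γ} {ρ : All ⟦_⟧ Γ} {h : uni ∈ Γ} → lookup ρ h ≡ encU H → length (difference (power A Q) H) ≤ X ×
           Runs (differenceOf i0 (w1 h)) (encU (power A Q) ∷ ρ) (encU (difference (power A Q) H))
    diff {ρ = ρ} h≡ = differenceOf-runs {S = S Q} ≡.refl h≡ (proj₁ (pow {ρ = encU A ∷ lift Q ∷ []} {i = i0} {q = i1} ≡.refl ≡.refl))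
      (ℕ.≤-trans (ℕ.+-mono-≤ (small Q Q≤e) lH) bound≤X)

  refineOf-runs : ∀ {w p q k k₀ : nat ∈ Γ} {l : polyTy ∈ Γ} {h : uni ∈ Γ} {i : fld ∈ Γ} {P Q L H K K₀ inv} → PowerKeys Cs W P e bound →
    lookup ρ w ≡ lift W → lookup ρ p ≡ lift P → lookup ρ q ≡ lift Q → lookup ρ l ≡ encode O L → lookup ρ h ≡ encU H →
    lookup ρ k ≡ lift K → lookup ρ k₀ ≡ lift K₀ → lookup ρ i ≡ inv →
    P ≤ X → Q ≤ e → Supported Cs L → length H ≤ s →
    Runs (refineOf l h w p q k k₀ i) ρ (encode O (refine W P Q H K K₀ inv L))
  refineOf-runs {P = P} {Q} {L} {H} {K} {K₀} {inv} keys w≡ p≡ q≡ l≡ h≡ k≡ k₀≡ i≡ P≤X Q≤e sup lH =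
    let (lR , run) = residualOf-runs keys w≡ p≡ q≡ l≡ h≡ P≤X Q≤e sup lH in
    conv (≡.cong (encode O) (unfold L)) (r-let run
      (r-fold _ (encode O) (λ t L′ → update t ∷ L′) (r-var l≡) r-nil (ℕ.≤-trans (proj₁ sup) Cs≤X) (λ {t} _ →
        r-let (r-snd (r-var ≡.refl)) (r-let (scaledKey-runs {us = toList (proj₂ t)} w≡ p≡ ≡.refl W≤X P≤X (toList≤X (proj₂ t)))
          (r-let (r-add (r-monus (r-var k≡) (r-var k₀≡)) (r-var ≡.refl))
            (r-cons (r-pair (r-addᶠ (r-fst (r-var ≡.refl)) (r-mulᶠ (r-negᶠ (coefOf-runs ≡.refl ≡.refl lR)) (r-var i≡)))
              (r-var ≡.refl)) (r-var ≡.refl)))))))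
    where
    update : Term F n → Term F n
    update t = proj₁ t +ᶠ (-ᶠ coef (residual W P Q H L) ((K ∸ K₀) + scaled W P (proj₂ t))) *ᶠ inv , proj₂ t
    unfold : ∀ L′ → foldr (λ t L′ → update t ∷ L′) [] L′ ≡ map update L′
    unfold []       = ≡.refl
    unfold (t ∷ L′) = ≡.cong (update t ∷_) (unfold L′)

  attemptOf-runs : ∀ {w eᵢ p q k : nat ∈ Γ} {cs : list vec ∈ Γ} {f h : uni ∈ Γ} {yᵢ : fld ∈ Γ} {G H K y P Q} →
    PowerKeys Cs W P e bound → PowerKeys Cs W 1 e bound →
    lookup ρ w ≡ lift W → lookup ρ eᵢ ≡ lift e → lookup ρ cs ≡ map encVᵛ Cs → lookup ρ f ≡ encU G → lookup ρ h ≡ encU H →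
    lookup ρ k ≡ lift K → lookup ρ yᵢ ≡ y → lookup ρ p ≡ lift P → lookup ρ q ≡ lift Q →
    P ≤ X → Q ≤ e → length H ≤ s → length G ≤ s →
    Runs (attemptOf w eᵢ cs f h k yᵢ p q) ρ (Maybe.map (encode O) (attempt Cs W e G H K y P Q))
  attemptOf-runs {G = G} {H} {K} {y} {P} {Q} keys keys₁ w≡ e≡ cs≡ f≡ h≡ k≡ y≡ p≡ q≡ P≤X Q≤e lH lG =
    r-let (findKeyOf-runs cs≡ w≡ p≡ q≡ k≡ P≤X Q≤X)
    (r-let (inverseOf-runs q≡ y≡ Q≤X)
    (r-let (r-foldInv encVᵛ (encode O) (λ _ → refine W P Q H K (findKey Cs W P Q K) (inverse Q y)) (Supported Cs) (r-var cs≡)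
             (initialOf-runs cs≡ w≡ p≡ ≡.refl y≡ P≤X) Cs≤X (initial-supported Cs W P _ y)
             (λ {_} {L} _ sup → map-supported _ L sup ,
               refineOf-runs keys w≡ p≡ q≡ ≡.refl h≡ k≡ ≡.refl ≡.refl P≤X Q≤e sup lH))
    (r-let (dropZerosOf-runs {L = approximate Cs W H K y P Q} ≡.refl (ℕ.≤-trans (proj₁ sup) Cs≤X))
    (r-let (r-lit 1)
    (r-let (proj₂ (residualOf-runs {L = g} keys₁ w≡ ≡.refl e≡ ≡.refl f≡ 1≤X ℕ.≤-refl sup′ lG))
    (r-if≤ (Maybe.map (encode O)) (nonzeroFlag-runs ≡.refl lR) (r-lit 0) (r-some (r-var ≡.refl)) r-none))))))
    where
    Q≤X = ℕ.≤-trans Q≤e e≤X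
    sup = approximate-supported Cs W H K y P Q
    g = dropZeros (approximate Cs W H K y P Q)
    sup′ = dropZeros-supported (approximate Cs W H K y P Q) sup
    lR : length (residual W 1 e G g) ≤ X
    -- The length does not depend on the environment, so a small one is made up for the occasion.
    lR = proj₁ (residualOf-runs {ρ = lift W ∷ lift 1 ∷ lift e ∷ encode O g ∷ encU G ∷ []} {i0} {i1} {i2} {i3} {i4}
      keys₁ ≡.refl ≡.refl ≡.refl ≡.refl ≡.refl 1≤X ℕ.≤-refl sup′ lG)

-- The algorithm

searchOf : nat ∈ Γ → nat ∈ Γ → list vec ∈ Γ → uni ∈ Γ → uni ∈ Γ → nat ∈ Γ → fld ∈ Γ → vec ∈ Γ → Tm Γ (maybe polyTy)
searchOf w e cs f h k y ns = foldList (var ns) none (foldList (var (w2 ns)) v1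
  (caseMaybe (attemptOf (w4 w) (w4 e) (w4 cs) (w4 f) (w4 h) (w4 k) (w4 y) i2 i0) v1 (some v0)))

-- If the leading coefficient has no e-th root, then f has none either, and whatever the default 0
-- leads to is rejected by the final test.
rootOrZeroOf : uni ∈ Γ → nat ∈ Γ → Tm Γ fld
rootOrZeroOf f k = caseMaybe (root (coefOf f k)) 0ᶠ v0

-- The default is the coefficient itself. It is the right value if the characteristic does not
-- divide e, since then P = 1 while `frob` always fails; in the other case a failure means that f
-- has no root.
frobeniusRootsOf : uni ∈ Γ → Tm Γ uni
frobeniusRootsOf f = foldList (var f) nil (cons (pair (caseMaybe (frob (fst v0)) (fst v0) v0) (snd v0)) v1)

-- f is compared with g ^ e through the substitution xᵢ ↦ x ^ (D + 1)ⁱ, which separates the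
-- monomials of degree at most D.
algorithm : Algorithm
algorithm = let′ (tdegOf i2) (if≤ (var i2) v0
  (let′ (add (lit 1) v0) (let′ (lengthOf i4) (let′ (colsOf i3 i5) (let′ (candidatesOf i0 i5 i3 i1)
  (let′ (lit 1) (let′ (imageOf i4 i0 i8) (let′ (topKeyOf i0) (let′ (rootOrZeroOf i1 i0)
  (let′ (frobeniusRootsOf i2) (let′ (numbersOf i11)
  (searchOf i9 (w1 i11) i6 i4 i1 i3 i2 i0)))))))))))
  none)

sum-toList : ∀ {n} (u : Vec ℕ n) → foldr _+_ 0 (toList u) ≡ Vec.sum u
sum-toList []      = ≡.refl
sum-toList (x ∷ u) = ≡.cong (x +_) (sum-toList u)

module PureSearch {a ℓ} (F : Field a ℓ) (n : ℕ) where
  open Field F using (Carrier)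
  open Univariate F using (Sum)
  open PureAttempt F n

  search : List (Vec ℕ n) → ℕ → ℕ → Sum → Sum → ℕ → Carrier → Maybe (Poly F n)
  search Cs W e f H K y = foldr (λ P r → foldr (λ q r′ → maybe′ just r′ (attempt Cs W e f H K y P q)) r (numbers e))
    nothing (numbers e)

length-numbers : ∀ e → length (numbers e) ≡ e
length-numbers zero    = ≡.refl
length-numbers (suc e) = ≡.cong suc (length-numbers e)

∈-numbers⁻ : ∀ {k} e → k ∈ numbers e → 1 ≤ k × k ≤ e
∈-numbers⁻ (suc e) (here ≡.refl) = s≤s z≤n , ℕ.≤-refl
∈-numbers⁻ (suc e) (there k∈) with ∈-numbers⁻ e k∈
... | 1≤k , k≤e = 1≤k , ℕ.m≤n⇒m≤1+n k≤e

∈-numbers⁺ : ∀ {k} e → 1 ≤ k → k ≤ e → k ∈ numbers e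
∈-numbers⁺ zero    1≤k k≤0 = contradiction (ℕ.≤-trans 1≤k k≤0) λ ()
∈-numbers⁺ (suc e) 1≤k k≤e with ℕ.m≤n⇒m<n∨m≡n k≤e
... | inj₁ (s≤s k≤e′) = there (∈-numbers⁺ e 1≤k k≤e′)
... | inj₂ ≡.refl = here ≡.refl

-- Runs that consult the oracle

module OracleRules {a ℓ} {F : Field a ℓ} {e : ℕ} (O : RootOracle F e) (X : ℕ) where
  open Field F using (Carrier; 0#; _+ᶠ_; _≟_)
  open RootOracle O
  open Semantics O using (⟦_⟧; eval; branch; frobRoot)
  open Rules O X
  open MacroRuns O X
  open Univariate F using (Sum; coef)

  private variable
    ρ : All ⟦_⟧ Γ

  -- `r` is the oracle cost on top of `costOf`. It is kept apart because it enters the final bound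
  -- linearly, outside the polynomial.
  record RunsO (r : ℕ) (t : Tm Γ τ) (ρ : All ⟦_⟧ Γ) (v : ⟦ τ ⟧) : Set a where
    constructor runsO
    field yieldO : Yields (eval t ρ) v (costOf t X + r)
  open RunsO public

  o-pure : ∀ {t : Tm Γ τ} {v r} → Runs t ρ v → RunsO r t ρ v
  o-pure (runs p) = runsO (weaken (ℕ.m≤m+n _ _) p)

  private
    regroup : ∀ c r c′ r′ → suc ((c + r) + (c′ + r′)) ≡ suc (c + c′) + (r + r′)
    regroup = solve 4 (λ c r c′ r′ → con 1 :+ ((c :+ r) :+ (c′ :+ r′)) := con 1 :+ (c :+ c′) :+ (r :+ r′)) ≡.refl
      where open +-*-Solver

  o-let : ∀ {s : Tm Γ σ} {t : Tm (σ ∷ Γ) τ} {x y r r′} → RunsO r s ρ x → RunsO r′ t (x ∷ ρ) y →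
          RunsO (r + r′) (let′ s t) ρ y
  o-let {ρ = ρ} {s = s} {t} {r = r} {r′} (runsO p) (runsO q) = runsO (weaken (ℕ.≤-reflexive (regroup (costOf s X) r (costOf t X) r′))
    (tick (bind {k = λ x → eval t (x ∷ ρ)} p q)))

  o-pureLet : ∀ {s : Tm Γ σ} {t : Tm (σ ∷ Γ) τ} {x y r} → Runs s ρ x → RunsO r t (x ∷ ρ) y → RunsO r (let′ s t) ρ y
  o-pureLet p q = o-let {r = 0} (o-pure p) q

  -- Each branch may assume the outcome of the test. This is how loops of length e become
  -- affordable: they run only after e ≤ D has been established.
  o-if≤ : ∀ {s t : Tm Γ nat} {u v : Tm Γ τ} {r m k x} → Runs s ρ (lift m) → Runs t ρ (lift k) →
          (m ≤ k → RunsO r u ρ x) → (¬ m ≤ k → RunsO r v ρ x) → RunsO r (if≤ s t u v) ρ x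
  o-if≤ {ρ = ρ} {s = s} {t} {u} {v} {r} {m} {k} {x} (runs p) (runs q) ru rv = runsO (weaken (ℕ.≤-reflexive arith) (tick (bind
    {k = λ x → eval t ρ >>= λ y → branch (lower x ℕ.≤? lower y) u v ρ} p
    (bind {k = λ y → branch (m ℕ.≤? lower y) u v ρ} q (cases (m ℕ.≤? k))))))
    where
    cases : (d : Dec (m ≤ k)) → Yields (branch d u v ρ) x (costOf u X + costOf v X + r)
    cases (yes m≤k) = weaken (ℕ.+-monoˡ-≤ r (ℕ.m≤m+n _ _)) (yieldO (ru m≤k))
    cases (no m≰k)  = weaken (ℕ.+-monoˡ-≤ r (ℕ.m≤n+m _ _)) (yieldO (rv m≰k))
    arith : suc (costOf s X + (costOf t X + (costOf u X + costOf v X + r))) ≡ costOf (if≤ s t u v) X + r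
    arith = solve 4 (λ s t w r → con 1 :+ (s :+ (t :+ (w :+ r))) := con 1 :+ (s :+ (t :+ w)) :+ r) ≡.refl
      (costOf s X) (costOf t X) (costOf u X + costOf v X) r
      where open +-*-Solver

  private
    o-caseMaybe : ∀ {s : Tm Γ (maybe σ)} {t : Tm Γ τ} {u : Tm (σ ∷ Γ) τ} {m : Maybe ⟦ σ ⟧} {y} {f : ⟦ σ ⟧ → ⟦ τ ⟧} {r} →
      RunsO r s ρ m → Runs t ρ y → (∀ x → Runs u (x ∷ ρ) (f x)) → RunsO r (caseMaybe s t u) ρ (maybe′ f y m)
    o-caseMaybe {ρ = ρ} {s = s} {t} {u} {m} {y} {f} {r} (runsO p) (runs q) ru =
      runsO (weaken (ℕ.≤-reflexive arith) (tick (cases m p)))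
      where
      cases : ∀ m → Yields (eval s ρ) m (costOf s X + r) → Yields (Semantics.step O (caseMaybe s t u) ρ) (maybe′ f y m)
        (costOf s X + r + (costOf t X + costOf u X))
      cases m p with Semantics.step O s ρ | p
      cases nothing  p | _ , _ | yields ≡.refl l =
        yields (result q) (ℕ.+-mono-≤ l (ℕ.≤-trans (time≤ q) (ℕ.m≤m+n _ _)))
      cases (just x) p | _ , _ | yields ≡.refl l =
        yields (result (yield (ru x))) (ℕ.+-mono-≤ l (ℕ.≤-trans (time≤ (yield (ru x))) (ℕ.m≤n+m _ _)))
      arith : suc (costOf s X + r + (costOf t X + costOf u X)) ≡ costOf (caseMaybe s t u) X + r
      arith = solve 3 (λ s w r → con 1 :+ (s :+ r :+ w) := con 1 :+ (s :+ w) :+ r) ≡.refl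
        (costOf s X) (costOf t X + costOf u X) r
        where open +-*-Solver

    o-root : ∀ {t : Tm Γ fld} {x} → Runs t ρ x → RunsO rootCost (root t) ρ (decToMaybe (root? x))
    o-root {t = t} {x} (runs p) = runsO (weaken (ℕ.≤-reflexive (arith (costOf t X) rootCost)) (tick (bind
      {k = λ x → charge rootCost (return (decToMaybe (root? x)))} p (yields ≡.refl ℕ.≤-refl))))
      where
      arith : ∀ c r → suc (c + (r + 0)) ≡ suc (c + 0) + r
      arith c r = ≡.cong₂ (λ x y → suc (x + y)) (≡.sym (ℕ.+-identityʳ c)) (ℕ.+-identityʳ r)

    o-frob : ∀ {t : Tm Γ fld} {x} → Runs t ρ x → RunsO frobCost (frob t) ρ (frobRoot x)
    o-frob {t = t} {x} (runs p) = runsO (weaken (ℕ.≤-reflexive (arith (costOf t X) frobCost)) (tick (bind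
      {k = λ x → charge frobCost (return (frobRoot x))} p (yields ≡.refl ℕ.≤-refl))))
      where
      arith : ∀ c r → suc (c + (r + 0)) ≡ suc (c + 0) + r
      arith c r = ≡.cong₂ (λ x y → suc (x + y)) (≡.sym (ℕ.+-identityʳ c)) (ℕ.+-identityʳ r)

  rootOrZero : Carrier → Carrier
  rootOrZero x = maybe′ id 0# (decToMaybe (root? x))

  frobeniusRoot : Carrier → Carrier
  frobeniusRoot x = maybe′ id x (frobRoot x)

  frobeniusRoots : Sum → Sum
  frobeniusRoots = map (λ (c , k) → frobeniusRoot c , k)

  rootOrZeroOf-runs : ∀ {f : uni ∈ Γ} {k : nat ∈ Γ} {A K} → lookup ρ f ≡ encU A → lookup ρ k ≡ lift K → length A ≤ X →
                      RunsO rootCost (rootOrZeroOf f k) ρ (rootOrZero (coef A K))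
  rootOrZeroOf-runs f≡ k≡ l = o-caseMaybe (o-root (coefOf-runs f≡ k≡ l)) r-0ᶠ (λ _ → r-var ≡.refl)

  frobeniusRootsOf-runs : ∀ {f : uni ∈ Γ} {A} → lookup ρ f ≡ encU A → length A ≤ X →
                          RunsO (length A * frobCost) (frobeniusRootsOf f) ρ (encU (frobeniusRoots A))
  frobeniusRootsOf-runs {Γ = Γ} {ρ = ρ} {f} {A} f≡ l = runsO (weaken bound (tick (bind
      {k = λ xs → eval {τ = uni} nil ρ >>= λ z → foldM (λ x y → eval body (x ∷ y ∷ ρ)) z xs} (yield (r-var {ρ = ρ} {i = f} f≡))
      (bind {k = λ z → foldM (λ x y → eval body (x ∷ y ∷ ρ)) z (encU A)} (yield (r-nil {τ = fld ⊗ nat} {ρ = ρ})) (loop A)))))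
    where
    body : Tm (fld ⊗ nat ∷ uni ∷ Γ) uni
    body = cons (pair (caseMaybe (frob (fst v0)) (fst v0) v0) (snd v0)) v1
    one-step : ∀ {ρ : All ⟦_⟧ Γ} (t : Carrier × ℕ) H → Yields (eval body ((proj₁ t , lift (proj₂ t)) ∷ encU H ∷ ρ))
      (encU ((frobeniusRoot (proj₁ t) , proj₂ t) ∷ H)) (costOf body X + frobCost)
    one-step {ρ} (c , k) H = weaken (ℕ.≤-reflexive arith) (tick (bind
        {k = λ x → eval v1 ρ′ >>= λ xs → return (x ∷ xs)} (tick (bind
          {k = λ x → eval (snd v0) ρ′ >>= λ y → return (x , y)}
          (yieldO (o-caseMaybe {u = v0} (o-frob (r-fst head-runs)) (r-fst head-runs) (λ _ → r-var ≡.refl)))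
          (bind {k = λ y → return (_ , y)} (yield (r-snd head-runs)) yield-return)))
        (bind {k = λ xs → return (_ ∷ xs)} (yield (r-var {ρ = ρ′} {i = i1} ≡.refl)) yield-return)))
      where
      ρ′ : All ⟦_⟧ (fld ⊗ nat ∷ uni ∷ Γ)
      ρ′ = (c , lift k) ∷ encU H ∷ ρ
      head-runs : Runs {τ = fld ⊗ nat} v0 ρ′ (c , lift k)
      head-runs = r-var ≡.refl
      arith : suc (suc (costOf {fld ⊗ nat ∷ uni ∷ Γ} (caseMaybe (frob (fst v0)) (fst v0) v0) X + frobCost + (2 + 0)) + (1 + 0))
              ≡ costOf body X + frobCost
      arith = solve 2 (λ c r → con 1 :+ ((con 1 :+ (c :+ r :+ con 2)) :+ con 1) := (c :+ con 5) :+ r) ≡.refl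
        (costOf {fld ⊗ nat ∷ uni ∷ Γ} (caseMaybe (frob (fst v0)) (fst v0) v0) X) frobCost
        where open +-*-Solver
    loop : ∀ A → Yields (foldM (λ x y → eval body (x ∷ y ∷ ρ)) [] (encU A)) (encU (frobeniusRoots A))
      (length A * (costOf body X + frobCost))
    loop []      = yield-return
    loop (t ∷ A) = weaken (ℕ.≤-reflexive (ℕ.+-comm (length A * _) _))
      (bind {k = λ y → eval body ((proj₁ t , lift (proj₂ t)) ∷ y ∷ ρ)} (loop A) (one-step t (frobeniusRoots A)))
    bound : suc (1 + (1 + length A * (costOf body X + frobCost))) ≤ costOf (frobeniusRootsOf f) X + length A * frobCost
    bound = ℕ.≤-trans (ℕ.≤-reflexive (≡.cong (3 +_) (ℕ.*-distribˡ-+ (length A) (costOf body X) frobCost)))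
      (ℕ.≤-trans (ℕ.≤-reflexive (≡.sym (ℕ.+-assoc 3 (length A * costOf body X) _)))
        (ℕ.+-monoˡ-≤ (length A * frobCost) (ℕ.+-monoʳ-≤ 3 (ℕ.*-monoˡ-≤ (costOf body X) l))))

module DegreeRuns {a ℓ} {F : Field a ℓ} {e : ℕ} (O : RootOracle F e) (X : ℕ) {n : ℕ} (f : SparsePoly F n)
  (n≤X : n ≤ X) (s≤X : ‖ f ‖₀ ≤ X) where
  open SparsePoly f using (terms)
  open Semantics O using (⟦_⟧; eval)
  open Rules O X
  open OracleRules O X
  open MacroRuns O X
  open EnumerationRuns O X n≤X

  private variable
    ρ : All ⟦_⟧ Γ

  tdegOf-runs : ∀ {fᵢ : polyTy ∈ Γ} → lookup ρ fᵢ ≡ encode O terms → Runs (tdegOf fᵢ) ρ (lift (tdeg f))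
  tdegOf-runs f≡ = conv (≡.cong lift (≡.sym (foldr-map ℕ._⊔_ (Vec.sum ∘ proj₂) 0 terms)))
    (r-fold _ lift (λ t k → Vec.sum (proj₂ t) ℕ.⊔ k) (r-var f≡) (r-lit 0) s≤X (λ {t} {k} _ →
      conv (≡.cong lift (≡.trans (≡.cong (λ m → if does (m ℕ.≤? k) then k else m) (sum-toList (proj₂ t))) (if-⊔ _ k)))
        (r-let (r-snd (r-var ≡.refl)) (r-let (sumOf-runs {us = toList (proj₂ t)} ≡.refl (toList≤X (proj₂ t)))
          (r-if≤ lift (r-var ≡.refl) (r-var ≡.refl) (r-var ≡.refl) (r-var ≡.refl))))))

  -- An e-th power of positive degree has degree at least e.
  algorithm-high-exponent : ¬ e ≤ tdeg f → RunsO 0 algorithm (lift n ∷ lift e ∷ encode O terms ∷ []) nothing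
  algorithm-high-exponent e≰D = o-pureLet (tdegOf-runs ≡.refl) (o-if≤ (r-var ≡.refl) (r-var ≡.refl)
    (λ e≤D → contradiction e≤D e≰D) (λ _ → o-pure r-none))

module MainRuns {a ℓ} {F : Field a ℓ} {e : ℕ} (O : RootOracle F e) (X : ℕ) {n : ℕ} (f : SparsePoly F n)
  (e≤D : e ≤ tdeg f) (n≤X : n ≤ X) (D<X : suc (tdeg f) ≤ X) (s≤X : ‖ f ‖₀ ≤ X) where
  open SparsePoly f using (terms)
  open RootOracle O
  open Semantics O using (⟦_⟧; eval)
  open Rules O X
  open OracleRules O X
  open MacroRuns O X
  open EnumerationRuns O X n≤X
  open Univariate F using (Sum; coef)
  open PureAttempt F n
  open PureSearch F n

  private
    D = tdeg f
    W = suc D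
    s = ‖ f ‖₀
    e≤X : e ≤ X
    e≤X = ℕ.≤-trans e≤D (ℕ.<⇒≤ D<X)

  ms : Vec ℕ n
  ms = columnSums terms

  substituted : Sum
  substituted = image W 1 terms

  topKey : ℕ
  topKey = foldr (λ t k → proj₂ t ℕ.⊔ k) 0 substituted

  open Candidates e D s

  module _ (Cs : List (Vec ℕ n)) (Cs≡ : map toList Cs ≡ candidates (toList ms))
    {bound} (bound≤X : bound + s ≤ X) (keys : ∀ P → 1 ≤ P → P ≤ e → PowerKeys Cs W P e bound) (1≤e : 1 ≤ e)
    (lC : ∀ pre ys → toList ms ≡ pre ++ ys → length (candidates ys) ≤ X) where

    private
      Cs≤X : length Cs ≤ X
      Cs≤X = ≡.subst (_≤ X) (≡.trans (≡.cong length (≡.sym Cs≡)) (length-map toList Cs)) (lC [] (toList ms) ≡.refl)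

    open AttemptRuns O X n≤X {Cs} {W} {s} {bound} D<X e≤X (ℕ.≤-trans (s≤s z≤n) D<X) Cs≤X bound≤X

    outcome : Maybe (Poly F n)
    outcome = search Cs W e substituted (frobeniusRoots substituted) topKey (rootOrZero (coef substituted topKey))

    private variable
      ρ : All ⟦_⟧ Γ

    searchOf-runs : ∀ {w eᵢ k : nat ∈ Γ} {cs : list vec ∈ Γ} {fᵢ h : uni ∈ Γ} {yᵢ : fld ∈ Γ} {ns : vec ∈ Γ} {G H K y} →
      lookup ρ w ≡ lift W → lookup ρ eᵢ ≡ lift e → lookup ρ cs ≡ map encVᵛ Cs → lookup ρ fᵢ ≡ encU G → lookup ρ h ≡ encU H →
      lookup ρ k ≡ lift K → lookup ρ yᵢ ≡ y → lookup ρ ns ≡ encV (numbers e) → length H ≤ s → length G ≤ s →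
      Runs (searchOf w eᵢ cs fᵢ h k yᵢ ns) ρ (Maybe.map (encode O) (search Cs W e G H K y))
    searchOf-runs {G = G} {H} {K} {y} w≡ e≡ cs≡ f≡ h≡ k≡ y≡ ns≡ lH lG =
      r-fold lift (Maybe.map (encode O)) _ (r-var ns≡) r-none ns≤X (λ {P} {r} P∈ →
        r-fold lift (Maybe.map (encode O)) _ (r-var ns≡) (r-var ≡.refl) ns≤X (λ {q} {r′} q∈ →
          let (1≤P , P≤e) = ∈-numbers⁻ e P∈ in
          conv (or-else r′ (attempt Cs W e G H K y P q)) (r-caseMaybe (encode O) {m = attempt Cs W e G H K y P q}
            (attemptOf-runs (keys P 1≤P P≤e) (keys 1 ℕ.≤-refl 1≤e) w≡ e≡ cs≡ f≡ h≡ k≡ y≡ ≡.refl ≡.refl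
              (ℕ.≤-trans P≤e e≤X) (proj₂ (∈-numbers⁻ e q∈)) lH lG)
            (r-var ≡.refl) (λ _ → r-some (r-var ≡.refl)))))
      where
      ns≤X : length (numbers e) ≤ X
      ns≤X = ≡.subst (_≤ X) (≡.sym (length-numbers e)) e≤X
      or-else : ∀ (r m : Maybe (Poly F n)) →
        maybe′ (just ∘ encode O) (Maybe.map (encode O) r) m ≡ Maybe.map (encode O) (maybe′ just r m)
      or-else r nothing  = ≡.refl
      or-else r (just _) = ≡.refl

    algorithm-runs : RunsO (rootCost + (s * frobCost + 0)) algorithm (lift n ∷ lift e ∷ encode O terms ∷ [])
                       (Maybe.map (encode O) outcome)
    algorithm-runs = o-pureLet (DegreeRuns.tdegOf-runs O X f n≤X s≤X ≡.refl) (o-if≤ (r-var ≡.refl) (r-var ≡.refl) (λ _ →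
      o-pureLet (r-add (r-lit 1) (r-var ≡.refl)) (o-pureLet (lengthOf-runs {xs = terms} ≡.refl s≤X)
      (o-pureLet (colsOf-runs {P = terms} ≡.refl ≡.refl s≤X)
      (o-pureLet (conv candidates≡ (candidatesOf-runs ≡.refl ≡.refl ≡.refl ≡.refl e≤X D<X (toList≤X ms) lC))
      (o-pureLet (r-lit 1) (o-pureLet (imageOf-runs {L = terms} ≡.refl ≡.refl ≡.refl (ℕ.≤-trans (s≤s z≤n) D<X) s≤X)
      (o-pureLet (topKeyOf-runs {P = substituted} ≡.refl ls≤X) (o-let {r = rootCost} (rootOrZeroOf-runs ≡.refl ≡.refl ls≤X)
      (o-let {r = s * frobCost} {0} (convR (frobeniusRootsOf-runs {A = substituted} ≡.refl ls≤X))
      (o-pureLet (numbersOf-runs ≡.refl e≤X)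
      (o-pure (searchOf-runs ≡.refl ≡.refl ≡.refl ≡.refl ≡.refl ≡.refl ≡.refl ≡.refl
        (ℕ.≤-reflexive (≡.trans (length-map _ substituted) ls)) (ℕ.≤-reflexive ls)))))))))))))
      (λ e≰D → contradiction e≤D e≰D))
      where
      ls : length substituted ≡ s
      ls = length-map _ terms
      ls≤X : length substituted ≤ X
      ls≤X = ≡.subst (_≤ X) (≡.sym ls) s≤X
      candidates≡ : map encV (candidates (toList ms)) ≡ map encVᵛ Cs
      candidates≡ = ≡.trans (≡.cong (map encV) (≡.sym Cs≡)) (≡.sym (map-∘ Cs))
      convR : ∀ {t : Tm Γ τ} {v} → RunsO (length substituted * frobCost) t ρ v → RunsO (s * frobCost) t ρ v
      convR {t = t} {v} p = ≡.subst (λ k → RunsO (k * frobCost) t _ v) ls p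

-- Soundness

module Faithfulness {a ℓ} (F : Field a ℓ) (n : ℕ) where
  open FieldExtras F
  private module U = Univariate F
  open Substitution F n
  open PureUnivariate F
  open PureAttempt F n
  open PolyArithmetic F {n} renaming (_≋_ to _≋ᵖ_)

  ^ᵖ-All : ∀ {h b} → Additive h → ∀ g j → All (λ t → h (proj₂ t) ≤ b) g → All (λ t → h (proj₂ t) ≤ j * b) (g ^ᵖ j)
  ^ᵖ-All H g zero    _   = ℕ.≤-reflexive (Additive.0-homo H) ∷ []
  ^ᵖ-All {h} {b} H g (suc j) all = All.concat⁺ (All.map⁺ (All.map (λ {t} ht → All.map⁺ (All.map (λ {t′} ht′ →
    ≡.subst (_≤ suc j * b) (≡.sym (Additive.+-homo H (proj₂ t) (proj₂ t′))) (ℕ.+-mono-≤ ht ht′)) (^ᵖ-All H g j all))) all))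

  ^ᵖ-cong : ∀ {g g′} j → g V.≋ g′ → g ^ᵖ j V.≋ g′ ^ᵖ j
  ^ᵖ-cong zero    _   = V.≋-refl
  ^ᵖ-cong {g} {g′} (suc j) g≋g′ = V.⊛-cong {g} {g′} {g ^ᵖ j} {g′ ^ᵖ j} g≋g′ (^ᵖ-cong j g≋g′)

  ≋⇒≋ᵖ : ∀ {P Q} → P V.≋ Q → P ≋ᵖ Q
  ≋⇒≋ᵖ {P} {Q} h u = trans (reflexive (coeff≡coef P u)) (trans (V.≋-coef h u) (reflexive (≡.sym (coeff≡coef Q u))))

  φ-injective : ∀ {W u v} → Vec.sum u < W → Vec.sum v < W → scaled W 1 u ≡ scaled W 1 v → u ≡ v
  φ-injective {W} {u} {v} u<W v<W eq = key-injective {W = W} u<W v<W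
    (≡.trans (≡.sym (ℕ.*-identityˡ (keyᵛ W u))) (≡.trans eq (ℕ.*-identityˡ (keyᵛ W v))))

  scaled-additive : ∀ W P → Additive (scaled W P)
  scaled-additive W P = *-additive (key-additive W) P

  coef-image : ∀ {W} P u → All (λ t → Vec.sum (proj₂ t) < W) P → Vec.sum u < W →
               U.coef (image W 1 P) (scaled W 1 u) ≈ V.coef P u
  coef-image {W} P u P<W u<W = coef-reindex (scaled W 1) P u (All.map (λ {t} t<W → φ-injective t<W u<W) P<W)

  -- Below degree `W` the keys separate monomials, and at any other `u` both coefficients are zero.
  image-faithful : ∀ {W} P Q → All (λ t → Vec.sum (proj₂ t) < W) P → All (λ t → Vec.sum (proj₂ t) < W) Q →
                   image W 1 P U.≋ image W 1 Q → P V.≋ Q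
  image-faithful {W} P Q P<W Q<W eq = V.coef-≋ λ u → case Vec.sum u ℕ.<? W of λ where
    (yes u<W) → trans (sym (coef-image P u P<W u<W)) (trans (U.≋-coef eq (scaled W 1 u)) (coef-image Q u Q<W u<W))
    (no u≮W)  → trans (V.coef-∉ P (All.map (λ { t<W ≡.refl → u≮W t<W }) P<W))
                  (sym (V.coef-∉ Q (All.map (λ { t<W ≡.refl → u≮W t<W }) Q<W)))

  root-from-image : ∀ {D e} g f → 1 ≤ e → All (λ t → e * Vec.sum (proj₂ t) ≤ D) g → All (λ t → Vec.sum (proj₂ t) ≤ D) f →
    image (suc D) 1 g U.^ˢ e U.≋ image (suc D) 1 f → g ^ᵖ e ≋ᵖ f
  root-from-image {D} {e} g f 1≤e g≤ f≤ eq = ≋⇒≋ᵖ (image-faithful (g ^ᵖ e) f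
    -- Terms of `g` satisfy e deg ≤ D, so those of its e-th power satisfy e deg ≤ e D. Carrying the
    -- factor e along avoids the quotient D / e.
    (All.map (λ le → s≤s (ℕ.*-cancelˡ-≤ e {{ℕ.>-nonZero 1≤e}} le)) (^ᵖ-All (*-additive sum-additive e) g e g≤))
    (All.map s≤s f≤) (U.≋-trans (reindex-^ (scaled-additive (suc D) 1) g e) eq))

  nonzero⇒coef : ∀ P → nonzero P ≤ 0 → ∀ k → U.coef P k ≈ 0#
  nonzero⇒coef []            _ k = refl
  nonzero⇒coef ((c , j) ∷ P) le k with c ≟ 0#
  nonzero⇒coef ((c , j) ∷ P) () k | no _
  ... | yes c≈0 with j ℕ.≟ k
  ...   | yes j≡k = trans (U.coef-≡ {P = P} j≡k) (trans (+-cong c≈0 (nonzero⇒coef P le k)) (+-identityˡ _))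
  ...   | no j≢k  = trans (U.coef-≢ {P = P} j≢k) (nonzero⇒coef P le k)

  -- The flag inspects listed coefficients. Repeated monomials could list nonzero coefficients that
  -- cancel, which distinctness rules out.
  coef⇒nonzero : ∀ P → U.Distinct P → (∀ k → U.coef P k ≈ 0#) → nonzero P ≤ 0
  coef⇒nonzero []            _        _  = z≤n
  coef⇒nonzero ((c , j) ∷ P) (j∉ ∷ d) P≈0 with c ≟ 0#
  ... | no c≉0 = contradiction (trans (sym (trans (U.coef-≡ {P = P} ≡.refl)
          (trans (+-congˡ (U.coef-∉ P (All.map (_∘ ≡.sym) j∉))) (+-identityʳ c)))) (P≈0 j)) c≉0
  ... | yes c≈0 = coef⇒nonzero P d λ k → case j ℕ.≟ k of λ where
    (yes ≡.refl) → U.coef-∉ P (All.map (_∘ ≡.sym) j∉)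
    (no j≢k)     → trans (sym (U.coef-≢ {P = P} j≢k)) (P≈0 k)

  foldr-insert-Distinct : ∀ {c} {C : Set c} (h : C → Carrier × ℕ) xs {z} → U.Distinct z →
                          U.Distinct (foldr (λ x → U.insert (h x)) z xs)
  foldr-insert-Distinct h []       d = d
  foldr-insert-Distinct h (x ∷ xs) d = U.insert-Distinct (h x) _ (foldr-insert-Distinct h xs d)

  power-Distinct : ∀ A q → U.Distinct (power A q)
  power-Distinct A zero    = [] ∷ []
  power-Distinct A (suc q) = rows A
    where
    rows : ∀ A′ → U.Distinct (product A′ (power A q))
    rows []       = []
    rows (s ∷ A′) = foldr-insert-Distinct _ (power A q) (rows A′)

  residual-coef : ∀ W P q H L k → U.coef (residual W P q H L) k ≈ U.coef (image W P L U.^ˢ q) k +ᶠ -ᶠ U.coef H k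
  residual-coef W P q H L k = trans (difference-coef (power (image W P L) q) H k) (+-congʳ (U.≋-coef (power≋^ˢ (image W P L) q) k))

  private
    if-just : ∀ {b q} {B : Set b} {Q : Set q} (Q? : Dec Q) {g g′ : B} →
              (if does Q? then just g else nothing) ≡ just g′ → g′ ≡ g × Q
    if-just (yes q) ≡.refl = ≡.refl , q

  check-just : ∀ {W e f g g′} → check W e f g ≡ just g′ → g′ ≡ g × image W 1 g U.^ˢ e U.≋ f
  check-just {W} {e} {f} {g} eq with if-just (nonzero (residual W 1 e f g) ℕ.≤? 0) eq
  ... | g′≡g , le = g′≡g , U.coef-≋ λ k →
    x+-y≈0⇒x≈y (trans (sym (residual-coef W 1 e f g k)) (nonzero⇒coef (residual W 1 e f g) le k))

  check-accepts : ∀ {W e f g} → image W 1 g U.^ˢ e U.≋ f → check W e f g ≡ just g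
  check-accepts {W} {e} {f} {g} eq = ≡.cong (if_then just g else nothing) (dec-true (nonzero (residual W 1 e f g) ℕ.≤? 0)
    (coef⇒nonzero (residual W 1 e f g) (foldr-insert-Distinct _ f (power-Distinct (image W 1 g) e))
      λ k → trans (residual-coef W 1 e f g k) (x≈y⇒x+-y≈0 (U.≋-coef eq k))))

  open PureSearch F n

  search-just : ∀ Cs W e f H K y {g} → search Cs W e f H K y ≡ just g → ∃₂ λ P q → attempt Cs W e f H K y P q ≡ just g
  search-just Cs W e f H K y = outer (numbers e)
    where
    inner : ∀ P qs {r g} → foldr (λ q r′ → maybe′ just r′ (attempt Cs W e f H K y P q)) r qs ≡ just g →
            r ≡ just g ⊎ ∃ λ q → attempt Cs W e f H K y P q ≡ just g
    inner P []       eq = inj₁ eq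
    inner P (q ∷ qs) eq with attempt Cs W e f H K y P q in eq′
    ... | just _  = inj₂ (q , ≡.trans eq′ eq)
    ... | nothing = inner P qs eq
    outer : ∀ Ps {g} → foldr (λ P r → foldr (λ q r′ → maybe′ just r′ (attempt Cs W e f H K y P q)) r (numbers e)) nothing Ps ≡ just g →
            ∃₂ λ P q → attempt Cs W e f H K y P q ≡ just g
    outer (P ∷ Ps) eq with inner P (numbers e) eq
    ... | inj₁ eq′       = outer Ps eq′
    ... | inj₂ (q , eq′) = P , q , eq′

  search-nothing : ∀ Cs W e f H K y → search Cs W e f H K y ≡ nothing → ∀ {P q} → P ∈ numbers e → q ∈ numbers e →
                   attempt Cs W e f H K y P q ≡ nothing
  search-nothing Cs W e f H K y eq P∈ q∈ = outer (numbers e) eq P∈ q∈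
    where
    inner : ∀ P qs {r} → foldr (λ q r′ → maybe′ just r′ (attempt Cs W e f H K y P q)) r qs ≡ nothing →
            r ≡ nothing × (∀ {q} → q ∈ qs → attempt Cs W e f H K y P q ≡ nothing)
    inner P []       eq = eq , λ ()
    inner P (q ∷ qs) eq with attempt Cs W e f H K y P q in eq′
    ... | nothing with inner P qs eq
    ...   | r≡ , rest = r≡ , λ { (here ≡.refl) → eq′ ; (there q∈) → rest q∈ }
    outer : ∀ Ps → foldr (λ P r → foldr (λ q r′ → maybe′ just r′ (attempt Cs W e f H K y P q)) r (numbers e)) nothing Ps ≡ nothing →
            ∀ {P q} → P ∈ Ps → q ∈ numbers e → attempt Cs W e f H K y P q ≡ nothing
    outer (P ∷ Ps) eq (here ≡.refl) q∈ = proj₂ (inner P (numbers e) eq) q∈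
    outer (P ∷ Ps) eq (there P∈)    q∈ = outer Ps (proj₁ (inner P (numbers e) eq)) P∈ q∈

  dropZeros-nonzero : ∀ L → All (λ t → ¬ proj₁ t ≈ 0#) (dropZeros L)
  dropZeros-nonzero []      = []
  dropZeros-nonzero (t ∷ L) with proj₁ t ≟ 0#
  ... | yes _   = dropZeros-nonzero L
  ... | no t≉0 = t≉0 ∷ dropZeros-nonzero L

  dropZeros-unique : ∀ L → Unique (map proj₂ L) → Unique (map proj₂ (dropZeros L))
  dropZeros-unique []      _        = []
  dropZeros-unique (t ∷ L) (t∉ ∷ u) with proj₁ t ≟ 0#
  ... | yes _ = dropZeros-unique L u
  ... | no  _ = All.map⁺ (fresh L (All.map⁻ t∉)) ∷ dropZeros-unique L u
    where
    fresh : ∀ L → All (λ t′ → proj₂ t ≢ proj₂ t′) L → All (λ t′ → proj₂ t ≢ proj₂ t′) (dropZeros L)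
    fresh []       []       = []
    fresh (t′ ∷ L) (p ∷ ps) with proj₁ t′ ≟ 0#
    ... | yes _ = fresh L ps
    ... | no  _ = p ∷ fresh L ps

  initial-unique : ∀ Cs W P k₀ y → Unique Cs → Unique (map proj₂ (initial Cs W P k₀ y))
  initial-unique []       W P k₀ y _        = []
  initial-unique (u ∷ Cs) W P k₀ y (u∉ ∷ d) with does (scaled W P u ℕ.≤? k₀)
  ... | true  = All.map⁺ (All.map (All.lookup u∉) (proj₂ (initial-supported Cs W P k₀ y))) ∷ initial-unique Cs W P k₀ y d
  ... | false = initial-unique Cs W P k₀ y d

  approximate-unique : ∀ Cs W H K y P q → Unique Cs → Unique (map proj₂ (approximate Cs W H K y P q))
  approximate-unique Cs W H K y P q d = go Cs
    where
    k₀ = findKey Cs W P q K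
    L : List (Vec ℕ n) → Poly F n
    L = foldr (λ _ → refine W P q H K k₀ (inverse q y)) (initial Cs W P k₀ y)
    go : ∀ Cs′ → Unique (map proj₂ (L Cs′))
    go []        = initial-unique Cs W P k₀ y d
    go (_ ∷ Cs′) = ≡.subst Unique (map-∘ (L Cs′)) (go Cs′)

  sparse : ∀ Cs W H K y P q → Unique Cs → SparsePoly F n
  sparse Cs W H K y P q d = record
    { terms    = dropZeros (approximate Cs W H K y P q)
    ; nonzero  = dropZeros-nonzero (approximate Cs W H K y P q)
    ; distinct = dropZeros-unique (approximate Cs W H K y P q) (approximate-unique Cs W H K y P q d) }

  attempt-sound : ∀ {Cs D e f H K y P q g} → 1 ≤ e → Unique Cs → (∀ {u} → u ∈ Cs → e * Vec.sum u ≤ D) →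
    All (λ t → Vec.sum (proj₂ t) ≤ D) f → attempt Cs (suc D) e (image (suc D) 1 f) H K y P q ≡ just g →
    ∃ λ (h : SparsePoly F n) → g ≡ SparsePoly.terms h × SparsePoly.terms h ^ᵖ e ≋ᵖ f
  attempt-sound {Cs} {D} {e} {f} {H} {K} {y} {P} {q} 1≤e d Cs≤ f≤ eq with check-just {suc D} {e} {image (suc D) 1 f} eq
  ... | g≡ , eq′ = sparse Cs (suc D) H K y P q d , g≡ ,
    root-from-image (dropZeros L) f 1≤e
      (All.map Cs≤ (proj₂ (dropZeros-supported {Cs} L (approximate-supported Cs (suc D) H K y P q)))) f≤ eq′
    where
    L = approximate Cs (suc D) H K y P q

-- Completeness

module Ranks {b} {B : Set b} (κ : B → ℕ) where

  -- Measures progress: a coefficient is final once the number of rounds exceeds the number of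
  -- candidates with larger keys.
  rank : ℕ → List B → ℕ
  rank i []      = 0
  rank i (v ∷ L) = (if does (i ℕ.<? κ v) then 1 else 0) + rank i L

  private
    indicator-mono : ∀ {i j k} → i ≤ j → (if does (j ℕ.<? k) then 1 else 0) ≤ (if does (i ℕ.<? k) then 1 else 0)
    indicator-mono {i} {j} {k} i≤j = go (j ℕ.<? k) (i ℕ.<? k)
      where
      go : (d : Dec (j < k)) (d′ : Dec (i < k)) → (if does d then 1 else 0) ≤ (if does d′ then 1 else 0)
      go (yes j<k) (yes _)   = ℕ.≤-refl
      go (yes j<k) (no i≮k)  = contradiction (ℕ.≤-<-trans i≤j j<k) i≮k
      go (no _)    _         = z≤n

  rank-mono : ∀ {i j} L → i ≤ j → rank j L ≤ rank i L
  rank-mono []      i≤j = z≤n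
  rank-mono (v ∷ L) i≤j = ℕ.+-mono-≤ (indicator-mono {k = κ v} i≤j) (rank-mono L i≤j)

  -- `w` is counted at `i` and no longer at `j`.
  rank-strict : ∀ {i j w} L → i ≤ j → w ∈ L → i < κ w → κ w ≤ j → rank j L < rank i L
  rank-strict {i} {j} {w} (.w ∷ L) i≤j (here ≡.refl) i<w w≤j
    rewrite dec-true (i ℕ.<? κ w) i<w | dec-false (j ℕ.<? κ w) (ℕ.≤⇒≯ w≤j) = s≤s (rank-mono L i≤j)
  rank-strict (v ∷ L) i≤j (there w∈) i<w w≤j = ℕ.+-mono-≤-< (indicator-mono {k = κ v} i≤j) (rank-strict L i≤j w∈ i<w w≤j)

  rank≤length : ∀ i L → rank i L ≤ length L
  rank≤length i []      = z≤n
  rank≤length i (v ∷ L) = ℕ.+-mono-≤ (bit (i ℕ.<? κ v)) (rank≤length i L)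
    where
    bit : (d : Dec (i < κ v)) → (if does d then 1 else 0) ≤ 1
    bit (yes _) = ℕ.≤-refl
    bit (no _)  = z≤n

  rank<length : ∀ {u} L → u ∈ L → rank (κ u) L < length L
  rank<length {u} (.u ∷ L) (here ≡.refl) rewrite dec-false (κ u ℕ.<? κ u) (ℕ.<-irrefl ≡.refl) = s≤s (rank≤length (κ u) L)
  rank<length {u} (v ∷ L)  (there u∈) = ℕ.+-mono-≤-< (bit (κ u ℕ.<? κ v)) (rank<length L u∈)
    where
    bit : (d : Dec (κ u < κ v)) → (if does d then 1 else 0) ≤ 1
    bit (yes _) = ℕ.≤-refl
    bit (no _)  = z≤n

module Graphs {a ℓ} (F : Field a ℓ) (n : ℕ) where
  open FieldExtras F
  open Univariate F
  open Substitution F n using (module V; reindex; coef-reindex)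

  -- An approximation is a coefficient function on a fixed list of candidates, so a round is a map
  -- between functions and can simply be iterated.
  graph : (Vec ℕ n → Carrier) → (Vec ℕ n → ℕ) → List (Vec ℕ n) → Sum
  graph t κ = map (λ u → t u , κ u)

  graphᵛ : (Vec ℕ n → Carrier) → List (Vec ℕ n) → Poly F n
  graphᵛ t = map (λ u → t u , u)

  graph-agree : ∀ {t c κ} C k → (∀ {w} → w ∈ C → κ w ≡ k → t w ≈ c w) → coef (graph t κ C) k ≈ coef (graph c κ C) k
  graph-agree []      k h = refl
  graph-agree {t} {c} {κ} (w ∷ C) k h with κ w ℕ.≟ k
  ... | yes eq = trans (coef-≡ {P = graph t κ C} eq) (trans (+-cong (h (here ≡.refl) eq) (graph-agree C k (h ∘ there)))
                   (sym (coef-≡ {P = graph c κ C} eq)))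
  ... | no neq = trans (coef-≢ {P = graph t κ C} neq) (trans (graph-agree C k (h ∘ there)) (sym (coef-≢ {P = graph c κ C} neq)))

  graph-cong : ∀ {t c κ} C → (∀ {w} → w ∈ C → t w ≈ c w) → graph t κ C ≋ graph c κ C
  graph-cong C h = coef-≋ λ k → graph-agree C k (λ w∈ _ → h w∈)

  graph-∉ : ∀ {t κ} C k → (∀ {w} → w ∈ C → κ w ≢ k) → coef (graph t κ C) k ≈ 0#
  graph-∉ {t} {κ} C k h = coef-∉ (graph t κ C) (All.map⁺ (All.tabulate h))

  graphᵛ-coef : ∀ {t} C {u} → Unique C → u ∈ C → V.coef (graphᵛ t C) u ≈ t u
  graphᵛ-coef {t} (u ∷ C) (u∉ ∷ d) (here ≡.refl) = trans (V.coef-≡ {P = graphᵛ t C} ≡.refl)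
    (trans (+-congˡ (V.coef-∉ (graphᵛ t C) (All.map⁺ (All.map (_∘ ≡.sym) u∉)))) (+-identityʳ _))
  graphᵛ-coef {t} (w ∷ C) (w∉ ∷ d) (there u∈) = trans (V.coef-≢ {P = graphᵛ t C} (All.lookup w∉ u∈)) (graphᵛ-coef C d u∈)

  graph-coef : ∀ {t κ} C {u} → Unique C → (∀ {v w} → v ∈ C → w ∈ C → κ v ≡ κ w → v ≡ w) → u ∈ C → coef (graph t κ C) (κ u) ≈ t u
  graph-coef {t} {κ} C {u} d inj u∈ = trans (reflexive (≡.cong (λ A → coef A (κ u)) (map-∘ C)))
    (trans (coef-reindex κ (graphᵛ t C) u (All.map⁺ (All.tabulate λ w∈ → inj w∈ u∈))) (graphᵛ-coef C d u∈))

-- One round corrects the coefficient at the largest key where the approximation is wrong.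
module Rounds {a ℓ} (F : Field a ℓ) (n : ℕ) where
  open FieldExtras F
  open Univariate F
  open Graphs F n

  module Correction {C : List (Vec ℕ n)} {κ : Vec ℕ n → ℕ} {t : Vec ℕ n → Carrier} {H : Sum} {q : ℕ} {k₀ : ℕ}
    {y inv : Carrier} {u₀ : Vec ℕ n} (unique : Unique C) (injective : ∀ {v w} → v ∈ C → w ∈ C → κ v ≡ κ w → v ≡ w)
    (κ≤k₀ : ∀ {u} → u ∈ C → κ u ≤ k₀) (u₀∈C : u₀ ∈ C) (κu₀ : κ u₀ ≡ k₀) (tu₀ : t u₀ ≈ y)
    (root : ∀ k → coef (graph t κ C ^ˢ suc q) k ≈ coef H k)
    (inv-inverse : ((suc q ×ᶠ 1#) *ᶠ y ^ᶠ q) *ᶠ inv ≈ 1#)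
    (next : (Vec ℕ n → Carrier) → Vec ℕ n → Carrier)
    (next-spec : ∀ c u → next c u ≈
      c u +ᶠ (-ᶠ (coef (graph c κ C ^ˢ suc q) (q * k₀ + κ u) +ᶠ -ᶠ coef H (q * k₀ + κ u))) *ᶠ inv) where

    private
      graph-Below : ∀ c → Below (graph c κ C) k₀
      graph-Below c = mkBelow λ k k₀<k → graph-∉ {c} C k λ w∈ κw≡k → ℕ.<⇒≱ k₀<k (≡.subst (_≤ k₀) κw≡k (κ≤k₀ w∈))

      top-coef : ∀ {c} → c u₀ ≈ y → coef (graph c κ C) k₀ ≈ y
      top-coef {c} cu₀ = trans (reflexive (≡.cong (coef (graph c κ C)) (≡.sym κu₀)))
        (trans (graph-coef C unique injective u₀∈C) cu₀)

    -- The coefficient that is read off involves only `u` and larger keys, so smaller ones may still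
    -- be arbitrary; hence all can be updated in the same round. A coefficient that is already
    -- correct is covered as well and stays correct.
    next-correct : ∀ {c u} → c u₀ ≈ y → u ∈ C → (∀ {w} → w ∈ C → κ u < κ w → t w ≈ c w) → next c u ≈ t u
    next-correct {c} {u} cu₀ u∈ agree = begin
      next c u                                                   ≈⟨ next-spec c u ⟩
      c u +ᶠ (-ᶠ (coef (B ^ˢ suc q) m +ᶠ -ᶠ coef H m)) *ᶠ inv     ≈⟨ +-congˡ (*-congʳ flip) ⟩
      c u +ᶠ (coef (A ^ˢ suc q) m +ᶠ -ᶠ coef (B ^ˢ suc q) m) *ᶠ inv
        ≈⟨ +-congˡ (*-congʳ (^ˢ-difference-top (graph-Below t) (graph-Below c) (top-coef tu₀) (top-coef cu₀) (κ≤k₀ u∈) above-agree q)) ⟩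
      c u +ᶠ (N *ᶠ (coef A (κ u) +ᶠ -ᶠ coef B (κ u))) *ᶠ inv
        ≈⟨ +-congˡ (*-congʳ (*-congˡ (+-cong (graph-coef C unique injective u∈) (-‿cong (graph-coef C unique injective u∈))))) ⟩
      c u +ᶠ (N *ᶠ (t u +ᶠ -ᶠ c u)) *ᶠ inv
        ≈⟨ +-congˡ (solve 3 (λ n d i → n :* d :* i := n :* i :* d) refl N (t u +ᶠ -ᶠ c u) inv) ⟩
      c u +ᶠ N *ᶠ inv *ᶠ (t u +ᶠ -ᶠ c u)                         ≈⟨ +-congˡ (trans (*-congʳ inv-inverse) (*-identityˡ _)) ⟩
      c u +ᶠ (t u +ᶠ -ᶠ c u)                                     ≈⟨ solve 3 (λ c t d → c :+ (t :+ d) := t :+ (c :+ d)) refl (c u) (t u) (-ᶠ c u) ⟩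
      t u +ᶠ (c u +ᶠ -ᶠ c u)                                     ≈⟨ trans (+-congˡ (-‿inverseʳ (c u))) (+-identityʳ _) ⟩
      t u                                                        ∎
      where
      A = graph t κ C
      B = graph c κ C
      N = (suc q ×ᶠ 1#) *ᶠ y ^ᶠ q
      m = q * k₀ + κ u
      above-agree : ∀ k → κ u < k → coef A k ≈ coef B k
      above-agree k u<k = graph-agree C k λ { w∈ ≡.refl → agree w∈ u<k }
      flip : -ᶠ (coef (B ^ˢ suc q) m +ᶠ -ᶠ coef H m) ≈ coef (A ^ˢ suc q) m +ᶠ -ᶠ coef (B ^ˢ suc q) m
      flip = trans (sym (-‿+-comm _ _)) (trans (+-congˡ (-‿involutive _)) (trans (+-comm _ _) (+-congʳ (sym (root m)))))

    open Ranks κ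

    rounds : (Vec ℕ n → Carrier) → ℕ → Vec ℕ n → Carrier
    rounds c r = iterate next c r

    module _ {c : Vec ℕ n → Carrier} (cu₀ : c u₀ ≈ y) where

      -- No key in `C` lies above that of `u₀`, so the agreement demanded by `next-correct` is
      -- vacuous there.
      rounds-top : ∀ r → rounds c r u₀ ≈ y
      rounds-top zero    = cu₀
      rounds-top (suc r) = trans (next-correct (rounds-top r) u₀∈C
        (λ w∈ u₀<w → contradiction (κ≤k₀ w∈) (ℕ.<⇒≱ (≡.subst (_< κ _) κu₀ u₀<w)))) tu₀

      -- Whatever lies above `u` has smaller rank and was correct one round earlier.
      rounds-correct : ∀ r {u} → u ∈ C → rank (κ u) C < r → rounds c r u ≈ t u
      rounds-correct (suc r) {u} u∈ (s≤s rank≤r) = next-correct (rounds-top r) u∈ λ {w} w∈ u<w →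
        sym (rounds-correct r w∈ (ℕ.<-≤-trans (rank-strict C (ℕ.<⇒≤ u<w) w∈ u<w ℕ.≤-refl) rank≤r))

      rounds-done : ∀ r → length C ≤ r → ∀ {u} → u ∈ C → rounds c r u ≈ t u
      rounds-done r l u∈ = rounds-correct r u∈ (ℕ.<-≤-trans (rank<length C u∈) l)

module Completeness {a ℓ} (F : Field a ℓ) (n : ℕ) where
  open FieldExtras F
  open Univariate F
  open Substitution F n using (module V; reindex; reindex-cong)
  open PureAttempt F n
  open Faithfulness F n
  open Graphs F n
  open Characteristic F
  private
    module R = CommutativeRing sumRing
    module ℕ→ℕ = SumMaps F ℕ._≟_ ℕ._≟_

  -- The monomials that `initial` retains. They are described by the keys for 1, of which the keys
  -- for `P` are multiples, so the list is the same for every `P`.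
  kept : ℕ → Vec ℕ n → List (Vec ℕ n) → List (Vec ℕ n)
  kept W u₀ = foldr (λ u L → if does (scaled W 1 u ℕ.≤? scaled W 1 u₀) then u ∷ L else L) []

  module _ (W : ℕ) (u₀ : Vec ℕ n) where
    ∈-kept⁻ : ∀ Cs {u} → u ∈ kept W u₀ Cs → u ∈ Cs × scaled W 1 u ≤ scaled W 1 u₀
    ∈-kept⁻ (w ∷ Cs) u∈ = go (scaled W 1 w ℕ.≤? scaled W 1 u₀) u∈
      where
      go : ∀ {u} (d : Dec (scaled W 1 w ≤ scaled W 1 u₀)) → u ∈ (if does d then w ∷ kept W u₀ Cs else kept W u₀ Cs) →
           u ∈ w ∷ Cs × scaled W 1 u ≤ scaled W 1 u₀
      go (yes le) (here ≡.refl) = here ≡.refl , le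
      go (yes _)  (there u∈) with ∈-kept⁻ Cs u∈
      ... | u∈Cs , le = there u∈Cs , le
      go (no _)   u∈ with ∈-kept⁻ Cs u∈
      ... | u∈Cs , le = there u∈Cs , le

    ∈-kept⁺ : ∀ Cs {u} → u ∈ Cs → scaled W 1 u ≤ scaled W 1 u₀ → u ∈ kept W u₀ Cs
    ∈-kept⁺ (w ∷ Cs) (here ≡.refl) le rewrite dec-true (scaled W 1 w ℕ.≤? scaled W 1 u₀) le = here ≡.refl
    ∈-kept⁺ (w ∷ Cs) (there u∈)    le with does (scaled W 1 w ℕ.≤? scaled W 1 u₀)
    ... | true  = there (∈-kept⁺ Cs u∈ le)
    ... | false = ∈-kept⁺ Cs u∈ le

    kept-unique : ∀ Cs → Unique Cs → Unique (kept W u₀ Cs)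
    kept-unique []       _        = []
    kept-unique (w ∷ Cs) (w∉ ∷ d) with does (scaled W 1 w ℕ.≤? scaled W 1 u₀)
    ... | true  = All.tabulate (λ u∈ → All.lookup w∉ (proj₁ (∈-kept⁻ Cs u∈))) ∷ kept-unique Cs d
    ... | false = kept-unique Cs d

    kept-length : ∀ Cs → length (kept W u₀ Cs) ≤ length Cs
    kept-length []       = z≤n
    kept-length (w ∷ Cs) with does (scaled W 1 w ℕ.≤? scaled W 1 u₀)
    ... | true  = s≤s (kept-length Cs)
    ... | false = ℕ.m≤n⇒m≤1+n (kept-length Cs)

  reindex-*-^ˢ : ∀ P A q → ℕ→ℕ.reindex (P *_) (A ^ˢ q) ≋ ℕ→ℕ.reindex (P *_) A ^ˢ q
  reindex-*-^ˢ P A zero    rewrite ℕ.*-zeroʳ P = ≋-refl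
  reindex-*-^ˢ P A (suc q) = ≋-trans (reindex-⊛ A (A ^ˢ q)) (R.*-congˡ {ℕ→ℕ.reindex (P *_) A} (reindex-*-^ˢ P A q))
    where open ProductMaps F ℕ._≟_ ℕ._≟_ _+_ _+_ (P *_) (ℕ.*-distribˡ-+ P)

  -- A ^ e is the P-th power of A ^ q, and Frobenius raises each coefficient and multiplies each
  -- exponent by `P`. Roots of the coefficients undo only the former, which is why keys are scaled
  -- by `P`.
  coef-^ˢ-frobenius : ∀ {P q e} (Φ : FrobeniusPower P) A → P * q ≡ e → ∀ k →
                      coef (A ^ˢ e) k ≈ coef (ℕ→ℕ.reindex (P *_) (A ^ˢ q)) k ^ᶠ P
  coef-^ˢ-frobenius {P} {q} {e} Φ A Pq≡e k = begin
    coef (A ^ˢ e) k                                ≡⟨ ≡.cong (λ j → coef (A ^ˢ j) k) (≡.trans (≡.sym Pq≡e) (ℕ.*-comm P q)) ⟩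
    coef (A ^ˢ (q * P)) k                        ≈⟨ ≋-coef (^ˢ-assocʳ A q P) k ⟨
    coef ((A ^ˢ q) ^ˢ P) k                         ≈⟨ ≋-coef (^ˢP≋frobSum (A ^ˢ q)) k ⟩
    coef (frobSum (A ^ˢ q)) k                      ≡⟨ ≡.cong (λ B → coef B k) (map-∘ (A ^ˢ q)) ⟩
    coef (map (λ (c , j) → c ^ᶠ P , j) (ℕ→ℕ.reindex (P *_) (A ^ˢ q))) k
                                                   ≈⟨ coef-^P (ℕ→ℕ.reindex (P *_) (A ^ˢ q)) k ⟩
    coef (ℕ→ℕ.reindex (P *_) (A ^ˢ q)) k ^ᶠ P    ∎
    where open FrobeniusMap Φ

  dropZeros-≋ : ∀ L → dropZeros L V.≋ L
  dropZeros-≋ L = V.mk (go L)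
    where
    go : ∀ L φ → V.⟨ dropZeros L ∣ φ ⟩ ≈ V.⟨ L ∣ φ ⟩
    go []            φ = refl
    go ((c , u) ∷ L) φ with c ≟ 0#
    ... | yes c≈0 = trans (go L φ) (sym (trans (+-congʳ (trans (*-congʳ c≈0) (zeroˡ _))) (+-identityˡ _)))
    ... | no  _   = +-congˡ (go L φ)

  inverse-inverse : ∀ q y → ¬ (suc q ×ᶠ 1#) ≈ 0# → ¬ y ≈ 0# → ((suc q ×ᶠ 1#) *ᶠ y ^ᶠ q) *ᶠ inverse (suc q) y ≈ 1#
  inverse-inverse q y q≉0 y≉0 = trans (*-congʳ (sym value)) (*-inv _ λ eq → *-≉0 q≉0 (^-≉0 q y≉0) (trans (sym value) eq))
    where
    ones : ∀ k → iterate (1# +ᶠ_) 0# k ≡ k ×ᶠ 1#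
    ones zero    = ≡.refl
    ones (suc k) = ≡.cong (1# +ᶠ_) (ones k)
    powers : ∀ k z → iterate (y *ᶠ_) z k ≈ z *ᶠ y ^ᶠ k
    powers zero    z = sym (*-identityʳ z)
    powers (suc k) z = trans (*-congˡ (powers k z)) (solve 3 (λ y z p → y :* (z :* p) := z :* (y :* p)) refl y z (y ^ᶠ k))
    value : iterate (y *ᶠ_) (iterate (1# +ᶠ_) 0# (suc q)) q ≈ (suc q ×ᶠ 1#) *ᶠ y ^ᶠ q
    value = trans (powers q _) (*-congʳ (reflexive (ones (suc q))))

  module _ {Cs : List (Vec ℕ n)} {W e : ℕ} {G H : Sum} {K : ℕ} {y : Carrier} {t : Vec ℕ n → Carrier} {u₀ : Vec ℕ n}
    (Cs-unique : Unique Cs) (Cs<W : ∀ {u} → u ∈ Cs → Vec.sum u < W) (u₀∈Cs : u₀ ∈ Cs) (tu₀≈y : t u₀ ≈ y) (y≉0 : ¬ y ≈ 0#)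
    (root : graph t (scaled W 1) (kept W u₀ Cs) ^ˢ e ≋ G) (K≡ : K ≡ e * scaled W 1 u₀)
    {P : ℕ} (frob : FrobeniusPower P) (G≈H^P : ∀ k → coef G k ≈ coef H k ^ᶠ P) where

    open FrobeniusMap frob
    private
      C = kept W u₀ Cs
      φ = scaled W 1
      κ = scaled W P
      A = graph t φ C
      κ≡Pφ : ∀ u → κ u ≡ P * φ u
      κ≡Pφ u = ≡.cong (P *_) (≡.sym (ℕ.*-identityˡ (keyᵛ W u)))
      instance
        P≢0 : NonZero P
        P≢0 = ℕ.>-nonZero (FrobeniusPower.positive frob)

    -- The P-th powers of both sides are coefficients of `G`, and taking P-th powers is injective.
    H-root : ∀ q → P * q ≡ e → ∀ k → coef (graph t κ C ^ˢ q) k ≈ coef H k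
    H-root q Pq≡e k = ^P-injective (sym (begin
      coef H k ^ᶠ P                                ≈⟨ G≈H^P k ⟨
      coef G k                                     ≈⟨ ≋-coef root k ⟨
      coef (A ^ˢ e) k                              ≈⟨ coef-^ˢ-frobenius frob A Pq≡e k ⟩
      coef (ℕ→ℕ.reindex (P *_) (A ^ˢ q)) k ^ᶠ P  ≈⟨ ^-congˡ P (≋-coef (reindex-*-^ˢ P A q) k) ⟩
      coef (ℕ→ℕ.reindex (P *_) A ^ˢ q) k ^ᶠ P    ≡⟨ ≡.cong (λ B → coef (B ^ˢ q) k ^ᶠ P) scaled-graph ⟩
      coef (graph t κ C ^ˢ q) k ^ᶠ P               ∎))
      where
      scaled-graph : ℕ→ℕ.reindex (P *_) A ≡ graph t κ C
      scaled-graph = ≡.trans (≡.sym (map-∘ C)) (map-cong (λ u → ≡.cong (t u ,_) (≡.sym (κ≡Pφ u))) C)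

    attempt-complete : ∀ {q} → P * q ≡ e → ¬ (q ×ᶠ 1#) ≈ 0# → ∃ λ g → attempt Cs W e G H K y P q ≡ just g
    attempt-complete {zero}   _    q≉0 = contradiction refl q≉0
    attempt-complete {suc q} Pq≡e q≉0 = dropZeros L , check-accepts {W} {e} {G} {dropZeros L} (≋-trans (^ˢ-cong e image≋A) root)
      where
      L = approximate Cs W H K y P (suc q)
      k₀ = κ u₀
      inv = inverse (suc q) y

      K≡qk₀ : K ≡ suc q * k₀
      K≡qk₀ = ≡.trans K≡ (≡.trans (≡.cong (ℕ._* φ u₀) (≡.trans (≡.sym Pq≡e) (ℕ.*-comm P (suc q))))
        (≡.trans (ℕ.*-assoc (suc q) P (φ u₀)) (≡.cong (suc q *_) (≡.sym (κ≡Pφ u₀)))))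

      K∸k₀ : K ∸ k₀ ≡ q * k₀
      K∸k₀ = ≡.trans (≡.cong (_∸ k₀) K≡qk₀) (ℕ.m+n∸m≡n k₀ (q * k₀))

      findKey≡ : ∀ Cs′ → u₀ ∈ Cs′ → findKey Cs′ W P (suc q) K ≡ k₀
      findKey≡ (w ∷ Cs′) u₀∈ = go (suc q * κ w ℕ.≟ K) u₀∈
        where
        go : (d : Dec (suc q * κ w ≡ K)) → u₀ ∈ w ∷ Cs′ → (if does d then κ w else findKey Cs′ W P (suc q) K) ≡ k₀
        -- Any match will do: cancelling `suc q` shows that its key is `k₀`.
        go (yes eq) _             = ℕ.*-cancelˡ-≡ (κ w) k₀ (suc q) (≡.trans eq K≡qk₀)
        go (no neq) (here ≡.refl) = contradiction (≡.sym K≡qk₀) neq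
        go (no _)   (there u₀∈)   = findKey≡ Cs′ u₀∈

      -- Kept candidates have keys up to `k₀`, so the comparison singles out the leading one.
      c₀ : Vec ℕ n → Carrier
      c₀ u = if does (k₀ ℕ.≤? κ u) then y else 0#

      initial≡ : ∀ Cs′ → initial Cs′ W P k₀ y ≡ graphᵛ c₀ (kept W u₀ Cs′)
      initial≡ []        = ≡.refl
      initial≡ (w ∷ Cs′) rewrite does-⇔ (mk⇔ (λ le → ℕ.*-cancelˡ-≤ P (≡.subst₂ _≤_ (κ≡Pφ w) (κ≡Pφ u₀) le))
          (λ le → ≡.subst₂ _≤_ (≡.sym (κ≡Pφ w)) (≡.sym (κ≡Pφ u₀)) (ℕ.*-monoʳ-≤ P le))) (κ w ℕ.≤? k₀) (φ w ℕ.≤? φ u₀)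
        with does (φ w ℕ.≤? φ u₀)
      ... | true  = ≡.cong (_ ∷_) (initial≡ Cs′)
      ... | false = initial≡ Cs′

      next : (Vec ℕ n → Carrier) → Vec ℕ n → Carrier
      next c u = c u +ᶠ (-ᶠ coef (residual W P (suc q) H (graphᵛ c C)) ((K ∸ k₀) + κ u)) *ᶠ inv

      next-spec : ∀ c u → next c u ≈
        c u +ᶠ (-ᶠ (coef (graph c κ C ^ˢ suc q) (q * k₀ + κ u) +ᶠ -ᶠ coef H (q * k₀ + κ u))) *ᶠ inv
      next-spec c u rewrite K∸k₀ = +-congˡ (*-congʳ (-‿cong (trans (residual-coef W P (suc q) H (graphᵛ c C) _)
        (+-congʳ (reflexive (≡.cong (λ B → coef (B ^ˢ suc q) (q * k₀ + κ u)) (≡.sym (map-∘ C))))))))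

      C-injective : ∀ {v w} → v ∈ C → w ∈ C → κ v ≡ κ w → v ≡ w
      C-injective {v} {w} v∈ w∈ eq = φ-injective {W} (Cs<W (proj₁ (∈-kept⁻ W u₀ Cs v∈))) (Cs<W (proj₁ (∈-kept⁻ W u₀ Cs w∈)))
        (ℕ.*-cancelˡ-≡ (φ v) (φ w) P (≡.trans (≡.sym (κ≡Pφ v)) (≡.trans eq (κ≡Pφ w))))

      C≤k₀ : ∀ {u} → u ∈ C → κ u ≤ k₀
      C≤k₀ {u} u∈ = ≡.subst₂ _≤_ (≡.sym (κ≡Pφ u)) (≡.sym (κ≡Pφ u₀)) (ℕ.*-monoʳ-≤ P (proj₂ (∈-kept⁻ W u₀ Cs u∈)))

      open Rounds.Correction F n {C} {κ} {t} {H} {q} {k₀} {y} {inv} {u₀} (kept-unique W u₀ Cs Cs-unique) C-injective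
        C≤k₀ (∈-kept⁺ W u₀ Cs u₀∈Cs ℕ.≤-refl) ≡.refl tu₀≈y (H-root (suc q) Pq≡e) (inverse-inverse q y q≉0 y≉0) next next-spec

      c₀u₀ : c₀ u₀ ≈ y
      c₀u₀ rewrite dec-true (k₀ ℕ.≤? k₀) ℕ.≤-refl = refl

      final : Vec ℕ n → Carrier
      final = rounds c₀ (length Cs)

      L≡ : L ≡ graphᵛ final C
      L≡ rewrite findKey≡ Cs u₀∈Cs = go Cs
        where
        go : ∀ Cs′ → foldr (λ _ → refine W P (suc q) H K k₀ inv) (initial Cs W P k₀ y) Cs′ ≡ graphᵛ (rounds c₀ (length Cs′)) C
        go []        = initial≡ Cs
        go (_ ∷ Cs′) rewrite go Cs′ = ≡.sym (map-∘ C)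

      image≋A : image W 1 (dropZeros L) ≋ A
      image≋A = ≋-trans (reindex-cong φ (dropZeros-≋ L)) (≡.subst (λ B → image W 1 B ≋ A) (≡.sym L≡)
        (≡.subst (_≋ A) (map-∘ C) (graph-cong C (rounds-done c₀u₀ (length Cs) (kept-length W u₀ Cs)))))

private
  vectors : ∀ {n} L → All (λ (w : List ℕ) → length w ≡ n) L → List (Vec ℕ n)
  vectors []      []              = []
  vectors (w ∷ L) (≡.refl ∷ lens) = fromList w ∷ vectors L lens

  vectors-toList : ∀ {n} L (lens : All (λ (w : List ℕ) → length w ≡ n) L) → map toList (vectors L lens) ≡ L
  vectors-toList []      []              = ≡.refl
  vectors-toList (w ∷ L) (≡.refl ∷ lens) = ≡.cong₂ _∷_ (toList∘fromList w) (vectors-toList L lens)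

  toList-inj : ∀ {n} {u v : Vec ℕ n} → toList u ≡ toList v → u ≡ v
  toList-inj {u = []}    {[]}    _  = ≡.refl
  toList-inj {u = x ∷ u} {y ∷ v} eq with ∷-injective eq
  ... | ≡.refl , eq′ = ≡.cong (x ∷_) (toList-inj eq′)

  Pointwise⇒lookup : ∀ {r} {R : ℕ → ℕ → Set r} {n} (u v : Vec ℕ n) → Pointwise R (toList u) (toList v) → ∀ i → R (Vec.lookup u i) (Vec.lookup v i)
  Pointwise⇒lookup (_ ∷ u) (_ ∷ v) (p ∷ ps) Fin.zero    = p
  Pointwise⇒lookup (_ ∷ u) (_ ∷ v) (p ∷ ps) (Fin.suc i) = Pointwise⇒lookup u v ps i

  lookup⇒Pointwise : ∀ {r} {R : ℕ → ℕ → Set r} {n} (u v : Vec ℕ n) → (∀ i → R (Vec.lookup u i) (Vec.lookup v i)) → Pointwise R (toList u) (toList v)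
  lookup⇒Pointwise []      []      h = []
  lookup⇒Pointwise (_ ∷ u) (_ ∷ v) h = h Fin.zero ∷ lookup⇒Pointwise u v (h ∘ Fin.suc)

-- Candidates as exponent vectors

module VectorCandidates (e D s : ℕ) {n : ℕ} (ms : Vec ℕ n) where
  open Candidates e D s

  private
    lengths : All (λ w → length w ≡ n) (candidates (toList ms))
    lengths = All.tabulate λ w∈ → ≡.trans (≡.sym (Pointwise-length (proj₂ (∈-candidates⁻ (toList ms) w∈)))) (length-toList ms)

  candidatesᵛ : List (Vec ℕ n)
  candidatesᵛ = vectors (candidates (toList ms)) lengths

  candidatesᵛ-toList : map toList candidatesᵛ ≡ candidates (toList ms)
  candidatesᵛ-toList = vectors-toList (candidates (toList ms)) lengths

  Candidateᵛ : Vec ℕ n → Set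
  Candidateᵛ u = e * Vec.sum u ≤ D × (∀ i → Fits (Vec.lookup ms i) (Vec.lookup u i))

  ∈-candidatesᵛ⁻ : ∀ {u} → u ∈ candidatesᵛ → Candidateᵛ u
  ∈-candidatesᵛ⁻ {u} u∈ with ∈-candidates⁻ (toList ms) (≡.subst (toList u ∈_) candidatesᵛ-toList (∈-map⁺ toList u∈))
  ... | e≤D , fits = ≡.subst (λ k → e * k ≤ D) (sum-toList u) e≤D , Pointwise⇒lookup ms u fits

  ∈-candidatesᵛ⁺ : ∀ {u} → 1 ≤ e → Candidateᵛ u → u ∈ candidatesᵛ
  ∈-candidatesᵛ⁺ {u} 1≤e (e≤D , fits) with ∈-map⁻ toList (≡.subst (toList u ∈_) (≡.sym candidatesᵛ-toList)
    (∈-candidates⁺ (toList ms) 1≤e (≡.subst (λ k → e * k ≤ D) (≡.sym (sum-toList u)) e≤D , lookup⇒Pointwise ms u fits)))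
  ... | v , v∈ , eq = ≡.subst (_∈ candidatesᵛ) (≡.sym (toList-inj eq)) v∈

  candidatesᵛ-unique : Unique candidatesᵛ
  candidatesᵛ-unique = go candidatesᵛ (≡.subst Unique (≡.sym candidatesᵛ-toList) (candidates-unique (toList ms)))
    where
    go : ∀ (L : List (Vec ℕ n)) → Unique (map toList L) → Unique L
    go []      _        = []
    go (w ∷ L) (w∉ ∷ d) = All.map (λ neq eq → neq (≡.cong toList eq)) (All.map⁻ w∉) ∷ go L d

columnSums-lookup : ∀ {b} {B : Set b} {n} (L : List (B × Vec ℕ n)) {t} i → t ∈ L → Vec.lookup (proj₂ t) i ≤ Vec.lookup (columnSums L) i
columnSums-lookup (t ∷ L) i t∈ rewrite lookup-zipWith _+_ i (proj₂ t) (columnSums L) with t∈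
... | here ≡.refl = ℕ.m≤m+n _ _
... | there t∈L   = ℕ.≤-trans (columnSums-lookup L i t∈L) (ℕ.m≤n+m _ _)

≤-foldr-⊔ : ∀ {b} {B : Set b} (h : B → ℕ) L {x} → x ∈ L → h x ≤ foldr (λ y m → h y ℕ.⊔ m) 0 L
≤-foldr-⊔ h (y ∷ L) (here ≡.refl) = ℕ.m≤m⊔n _ _
≤-foldr-⊔ h (y ∷ L) (there x∈)    = ℕ.≤-trans (≤-foldr-⊔ h L x∈) (ℕ.m≤n⊔m (h y) _)

foldr-⊔-≤ : ∀ {b} {B : Set b} (h : B → ℕ) L {k} → (∀ {x} → x ∈ L → h x ≤ k) → foldr (λ y m → h y ℕ.⊔ m) 0 L ≤ k
foldr-⊔-≤ h []      _ = z≤n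
foldr-⊔-≤ h (y ∷ L) b = ℕ.⊔-lub (b (here ≡.refl)) (foldr-⊔-≤ h L (b ∘ there))

module _ {a ℓ} {F : Field a ℓ} {n : ℕ} (f : SparsePoly F n) where
  open SparsePoly f

  sum≤tdeg : ∀ {t} → t ∈ terms → Vec.sum (proj₂ t) ≤ tdeg f
  sum≤tdeg t∈ = ≡.subst (_ ≤_) (≡.sym (foldr-map ℕ._⊔_ (Vec.sum ∘ proj₂) 0 terms)) (≤-foldr-⊔ (Vec.sum ∘ proj₂) terms t∈)

module OracleExponent {a ℓ} {F : Field a ℓ} {e : ℕ} (O : RootOracle F e) (X : ℕ) (1≤e : 1 ≤ e) where
  open FieldExtras F
  open Characteristic F
  open OracleRules O X using (frobeniusRoot; rootOrZero)

  -- The splitting of `e` that the program has to guess. `isRoot` includes the default of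
  -- `frobeniusRoot`: for P = 1 every coefficient is its own root.
  record Exponents : Set (a ⊔ ℓ) where
    field
      {P q}          : ℕ
      P*q≡e          : P * q ≡ e
      frobeniusPower : FrobeniusPower P
      q≉0            : ¬ (q ×ᶠ 1#) ≈ 0#
      isRoot         : ∀ {c x} → x ^ᶠ P ≈ c → frobeniusRoot c ^ᶠ P ≈ c

  rootOrZero-root : ∀ {c x} → x ^ᶠ e ≈ c → rootOrZero c ^ᶠ e ≈ c
  rootOrZero-root {c} x^e≈c with RootOracle.root? O c
  ... | yes (y , y^e≈c) = y^e≈c
  ... | no ¬root        = contradiction (_ , x^e≈c) ¬root

exponents : ∀ {a ℓ} {F : Field a ℓ} {e : ℕ} (O : RootOracle F e) (X : ℕ) (1≤e : 1 ≤ e) → OracleExponent.Exponents O X 1≤e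
exponents {F = F} {e} record { frobenius = char∤e char∤ } X 1≤e = record
  { P*q≡e = ℕ.*-identityˡ e
  ; frobeniusPower = frobeniusPower-1
  ; q≉0 = λ e≈0 → let (p , char , p∣e) = positiveChar e 1≤e e≈0 in char∤ p char p∣e
  ; isRoot = λ {c} _ → Field.*-identityʳ F c }
  where open Characteristic F
exponents {F = F} {e} O@record { frobenius = char∣e p r q char p∣e e≡ p∤q frobRoot? _ } X 1≤e = record
  { P*q≡e = ≡.sym e≡
  ; frobeniusPower = frobeniusPower-char r char
  ; q≉0 = λ q≈0 → p∤q (×1≈0⇒char∣ char q q≈0)
  ; isRoot = isRoot }
  where
  open Characteristic F
  open Field F using (_≈_; _^ᶠ_)
  isRoot : ∀ {c x} → x ^ᶠ (p ^ r) ≈ c → OracleRules.frobeniusRoot O X c ^ᶠ (p ^ r) ≈ c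
  isRoot {c} x^P≈c with frobRoot? c
  ... | yes (y , y^P≈c) = y^P≈c
  ... | no ¬root        = contradiction (_ , x^P≈c) ¬root

-- The leading term of an assumed root

module RootData {a ℓ} (F : Field a ℓ) (n : ℕ) (f : SparsePoly F n) (e : ℕ) (1≤e : 1 ≤ e)
  {g₀ : Poly F n} (g₀^e≋f : PolyArithmetic._≋_ F (PolyArithmetic._^ᵖ_ F g₀ e) (SparsePoly.terms f)) where
  open FieldExtras F
  open SparsePoly f
  open Univariate F
  open Substitution F n
  open PureAttempt F n
  open Faithfulness F n
  open Graphs F n
  open Completeness F n
  private module R = CommutativeRing sumRing

  D W s : ℕ
  D = tdeg f
  W = suc D
  s = ‖ f ‖₀

  ms : Vec ℕ n
  ms = columnSums terms

  φ : Vec ℕ n → ℕ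
  φ = scaled W 1

  substituted : Sum
  substituted = image W 1 terms

  t₀ : Vec ℕ n → Carrier
  t₀ = V.coef g₀

  -- `degree-bound` is applied to the total degree here and to single variables in `support-fits`.
  -- Together they place the support of any root among the candidates, unless exponents are forced.
  support-degree : ∀ {u} → ¬ t₀ u ≈ 0# → e * Vec.sum u ≤ D
  support-degree {u} = degree-bound sum-additive {terms} {g₀} {e} g₀^e≋f (λ t t∈ → sum≤tdeg f t∈) u

  support-fits : ∀ {u} → ¬ t₀ u ≈ 0# → ∀ i → e * Vec.lookup u i ≤ Vec.lookup ms i
  support-fits {u} u≉0 i = degree-bound (lookup-additive i) {terms} {g₀} {e} g₀^e≋f (λ t t∈ → columnSums-lookup terms i t∈) u u≉0

  terms<W : All (λ t → Vec.sum (proj₂ t) < W) terms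
  terms<W = All.tabulate (λ t∈ → s≤s (sum≤tdeg f t∈))

  terms-coef : ∀ L → Unique (map proj₂ L) → ∀ {t} → t ∈ L → V.coef L (proj₂ t) ≈ proj₁ t
  terms-coef (t ∷ L) (t∉ ∷ d) (here ≡.refl) = trans (V.coef-≡ {P = L} ≡.refl)
    (trans (+-congˡ (V.coef-∉ L (All.map (_∘ ≡.sym) (All.map⁻ t∉)))) (+-identityʳ _))
  terms-coef (t ∷ L) (t∉ ∷ d) (there t′∈) = trans (V.coef-≢ {P = L} (All.lookup (All.map⁻ t∉) t′∈)) (terms-coef L d t′∈)

  substituted-coef : ∀ {t} → t ∈ terms → coef substituted (φ (proj₂ t)) ≈ proj₁ t
  substituted-coef {t} t∈ = trans (coef-image terms (proj₂ t) terms<W (s≤s (sum≤tdeg f t∈))) (terms-coef terms distinct t∈)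

  substituted-coef≉0 : ∀ {k} → k ∈ map proj₂ substituted → ¬ coef substituted k ≈ 0#
  substituted-coef≉0 k∈ with ∈-map⁻ proj₂ k∈
  ... | _ , t′∈ , ≡.refl with ∈-map⁻ _ t′∈
  ...   | t , t∈ , ≡.refl = λ c≈0 → All.lookup nonzero t∈ (trans (sym (substituted-coef t∈)) c≈0)

  topKey : ℕ
  topKey = foldr (λ t k → proj₂ t ℕ.⊔ k) 0 substituted

  private
    scan : ∀ C → (∀ {u} → u ∈ C → t₀ u ≈ 0#) ⊎ ∃ λ u → u ∈ C × ¬ t₀ u ≈ 0#
    scan []      = inj₁ λ ()
    scan (u ∷ C) with t₀ u ≟ 0# | scan C
    ... | no u≉0  | _                     = inj₂ (u , here ≡.refl , u≉0)
    ... | yes _   | inj₂ (v , v∈ , v≉0)   = inj₂ (v , there v∈ , v≉0)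
    ... | yes u≈0 | inj₁ all              = inj₁ λ { (here ≡.refl) → u≈0 ; (there v∈) → all v∈ }

    graph-0 : ∀ {t κ} C → (∀ {u} → u ∈ C → t u ≈ 0#) → graph t κ C ≋ []
    graph-0 C all = mk λ ψ → go C all ψ
      where
      go : ∀ {t κ} C → (∀ {u} → u ∈ C → t u ≈ 0#) → ∀ ψ → ⟨ graph t κ C ∣ ψ ⟩ ≈ 0#
      go []      _   ψ = refl
      go (u ∷ C) all ψ = trans (+-cong (trans (*-congʳ (all (here ≡.refl))) (zeroˡ _)) (go C (all ∘ there) ψ)) (+-identityʳ _)

    graphᵛ-0 : ∀ C u → t₀ u ≈ 0# → V.coef (graphᵛ t₀ C) u ≈ 0#
    graphᵛ-0 []      u u≈0 = refl
    graphᵛ-0 (w ∷ C) u u≈0 = case ≡-dec ℕ._≟_ w u of λ where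
      (yes w≡u) → trans (V.coef-≡ {P = graphᵛ t₀ C} w≡u) (trans (+-cong (trans (reflexive (≡.cong t₀ w≡u)) u≈0) (graphᵛ-0 C u u≈0)) (+-identityʳ _))
      (no w≢u)  → trans (V.coef-≢ {P = graphᵛ t₀ C} w≢u) (graphᵛ-0 C u u≈0)

  module _ {C : List (Vec ℕ n)} (unique : Unique C) (C<W : ∀ {u} → u ∈ C → Vec.sum u < W)
    (supported : ∀ {u} → ¬ t₀ u ≈ 0# → u ∈ C) where

    C-injective : ∀ {v w} → v ∈ C → w ∈ C → φ v ≡ φ w → v ≡ w
    C-injective v∈ w∈ = φ-injective {W} (C<W v∈) (C<W w∈)

    graph-root : graph t₀ φ C ^ˢ e ≋ substituted
    graph-root = ≋-trans (^ˢ-cong e (≋-sym (≡.subst (reindex φ g₀ ≋_) (≡.sym (map-∘ C)) (reindex-cong φ g₀≋))))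
      (reindex-root (scaled-additive W 1) {g₀} {terms} e g₀^e≋f)
      where
      g₀≋ : g₀ V.≋ graphᵛ t₀ C
      g₀≋ = V.coef-≋ λ u → case t₀ u ≟ 0# of λ where
        (no u≉0)  → sym (graphᵛ-coef C unique (supported u≉0))
        (yes u≈0) → trans u≈0 (sym (graphᵛ-0 C u u≈0))

    private
      G = graph t₀ φ C

    record Leading : Set (a ⊔ ℓ) where
      field
        u₀       : Vec ℕ n
        u₀∈C     : u₀ ∈ C
        t₀u₀≉0   : ¬ t₀ u₀ ≈ 0#
        below    : Below (graph t₀ φ C) (φ u₀)
        topKey≡  : topKey ≡ e * φ u₀
        top-coef : coef substituted topKey ≈ t₀ u₀ ^ᶠ e

    abstract
      -- If all coefficients of the graph vanished, so would f. Otherwise e times the largest key of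
      -- the graph has a nonzero coefficient in the image of f and larger keys have none; as every
      -- listed key of that image has a nonzero coefficient, this is the largest listed one.
      leading : ∀ {t₁} → t₁ ∈ terms → Leading
      leading {t₁} t₁∈ with scan C
      ... | inj₁ all = contradiction (trans (sym (≋-coef graph-root _)) (trans (≋-coef (≋-trans (^ˢ-cong e (graph-0 C all)) ([]^ 1≤e)) _) refl))
                         (substituted-coef≉0 (∈-map⁺ proj₂ (∈-map⁺ _ t₁∈)))
        where
        []^ : ∀ {e} → 1 ≤ e → [] ^ˢ e ≋ []
        []^ (s≤s _) = ≋-refl
      ... | inj₂ (u , u∈ , u≉0) with top-exists G (φ u) (λ c≈0 → u≉0 (trans (sym (graph-coef C unique C-injective u∈)) c≈0))
      ...   | k₀ , _ , below , k₀≉0 with ucoef≉0⇒∈ G k₀≉0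
      ...     | _ , t∈ , ≡.refl with ∈-map⁻ _ t∈
      ...       | u₀ , u₀∈ , ≡.refl = record
        { u₀ = u₀ ; u₀∈C = u₀∈
        ; t₀u₀≉0 = λ u₀≈0 → k₀≉0 (trans coef≈ u₀≈0)
        ; below = below
        ; topKey≡ = topKey≡
        ; top-coef = trans (reflexive (≡.cong (coef substituted) topKey≡)) top }
        where
        coef≈ : coef G (φ u₀) ≈ t₀ u₀
        coef≈ = graph-coef C unique C-injective u₀∈
        top : coef substituted (e * φ u₀) ≈ t₀ u₀ ^ᶠ e
        top = trans (sym (≋-coef graph-root _)) (trans (^ˢ-top e below) (^-congˡ e coef≈))
        topKey≡ : topKey ≡ e * φ u₀
        topKey≡ with ucoef≉0⇒∈ substituted (λ c≈0 → ^-≉0 e k₀≉0 (trans (sym (^ˢ-top e below)) (trans (≋-coef graph-root _) c≈0)))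
        ... | t , t∈ , t≡ = ℕ.≤-antisym
          (foldr-⊔-≤ proj₂ substituted λ {t′} t′∈ → ℕ.≮⇒≥ λ lt → substituted-coef≉0 (∈-map⁺ proj₂ t′∈)
            (trans (sym (≋-coef graph-root _)) (above (^ˢ-Below e below) _ lt)))
          (≡.subst (_≤ topKey) t≡ (≤-foldr-⊔ proj₂ substituted t∈))

key-map : ∀ e {W n} (u : Vec ℕ n) → keyᵛ W (Vec.map (e *_) u) ≡ e * keyᵛ W u
key-map e []          = ≡.sym (ℕ.*-zeroʳ e)
key-map e {W} (x ∷ u) = ≡.trans (≡.cong (λ k → e * x + W * k) (key-map e {W} u))
  (solve 4 (λ e x w k → e :* x :+ w :* (e :* k) := e :* (x :+ w :* k)) ≡.refl e x W (keyᵛ W u))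
  where
  open +-*-Solver

sum-map : ∀ e {n} (u : Vec ℕ n) → Vec.sum (Vec.map (e *_) u) ≡ e * Vec.sum u
sum-map e []      = ≡.sym (ℕ.*-zeroʳ e)
sum-map e (x ∷ u) = ≡.trans (≡.cong (e * x +_) (sum-map e u)) (≡.sym (ℕ.*-distribˡ-+ e x (Vec.sum u)))

module GraphRoots {a ℓ} (F : Field a ℓ) (n : ℕ) where
  open FieldExtras F
  open Univariate F
  open Graphs F n
  open PureAttempt F n
  open Completeness F n
  open Characteristic F
  private module R = CommutativeRing sumRing

  graph-scale : ∀ {t κ} x C → graph (λ u → x *ᶠ t u) κ C ≋ ((x , 0) ∷ []) ⊛ graph t κ C
  graph-scale {t} {κ} x C = mk λ ψ → trans (go C ψ) (sym (trans (pairing-⊛ ((x , 0) ∷ []) (graph t κ C) ψ) (+-identityʳ _)))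
    where
    go : ∀ C ψ → ⟨ graph (λ u → x *ᶠ t u) κ C ∣ ψ ⟩ ≈ x *ᶠ ⟨ graph t κ C ∣ ψ ⟩
    go []      ψ = sym (zeroʳ x)
    go (u ∷ C) ψ = trans (+-congˡ (go C ψ))
      (solve 4 (λ x t p g → x :* t :* p :+ x :* g := x :* (t :* p :+ g)) refl x (t u) (ψ (κ u)) ⟨ graph t κ C ∣ ψ ⟩)

  -- Multiplication by an e-th root of unity adapts the leading coefficient of a given root to the
  -- scalar root that the oracle happens to return.
  graph-scale-^ : ∀ {t κ x e G} C → x ^ᶠ e ≈ 1# → graph t κ C ^ˢ e ≋ G → graph (λ u → x *ᶠ t u) κ C ^ˢ e ≋ G
  graph-scale-^ {t} {κ} {x} {e} {G} C x^e≈1 graph^e≋G = ≋-trans (^ˢ-cong e (graph-scale x C))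
    (≋-trans (^-distrib-*ˢ ((x , 0) ∷ []) (graph t κ C) e) (≋-trans (⊛-cong {Q = graph t κ C ^ˢ e} unit ≋-refl)
      (≋-trans (R.*-identityˡ (graph t κ C ^ˢ e)) graph^e≋G)))
    where
    open import Algebra.Properties.CommutativeSemiring.Exp R.commutativeSemiring using () renaming (^-distrib-* to ^-distrib-*ˢ)
    unit : ((x , 0) ∷ []) ^ˢ e ≋ one
    unit = ≋-trans (term-^ x 0 e) (mk λ ψ → +-congʳ (*-cong x^e≈1 (reflexive (≡.cong ψ (ℕ.*-zeroʳ e)))))

  kept-≋ : ∀ {t W u₀} Cs → (∀ {u} → u ∈ Cs → ¬ scaled W 1 u ≤ scaled W 1 u₀ → t u ≈ 0#) →
           graph t (scaled W 1) (kept W u₀ Cs) ≋ graph t (scaled W 1) Cs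
  kept-≋ {t} {W} {u₀} Cs h = mk (go Cs h)
    where
    go : ∀ Cs → (∀ {u} → u ∈ Cs → ¬ scaled W 1 u ≤ scaled W 1 u₀ → t u ≈ 0#) → ∀ ψ →
         ⟨ graph t (scaled W 1) (kept W u₀ Cs) ∣ ψ ⟩ ≈ ⟨ graph t (scaled W 1) Cs ∣ ψ ⟩
    go []       h ψ = refl
    go (w ∷ Cs) h ψ = step (scaled W 1 w ℕ.≤? scaled W 1 u₀)
      where
      step : (d : Dec (scaled W 1 w ≤ scaled W 1 u₀)) →
        ⟨ graph t (scaled W 1) (if does d then w ∷ kept W u₀ Cs else kept W u₀ Cs) ∣ ψ ⟩ ≈ ⟨ graph t (scaled W 1) (w ∷ Cs) ∣ ψ ⟩
      step (yes _)   = +-congˡ (go Cs (h ∘ there) ψ)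
      step (no w≰u₀) = trans (go Cs (h ∘ there) ψ)
        (sym (trans (+-congʳ (trans (*-congʳ (h (here ≡.refl) w≰u₀)) (zeroˡ _))) (+-identityˡ _)))

  graph-single : ∀ {t κ u₀} C → Unique C → u₀ ∈ C → (∀ {u} → u ≢ u₀ → t u ≈ 0#) → graph t κ C ≋ (t u₀ , κ u₀) ∷ []
  graph-single {t} {κ} {u₀} C d u₀∈ h = mk (go C d u₀∈)
    where
    vanish : ∀ C → (∀ {u} → u ∈ C → u ≢ u₀) → ∀ ψ → ⟨ graph t κ C ∣ ψ ⟩ ≈ 0#
    vanish []      _   ψ = refl
    vanish (u ∷ C) ∉C ψ = trans (+-cong (trans (*-congʳ (h (∉C (here ≡.refl)))) (zeroˡ _)) (vanish C (∉C ∘ there) ψ)) (+-identityʳ _)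
    go : ∀ C → Unique C → u₀ ∈ C → ∀ ψ → ⟨ graph t κ C ∣ ψ ⟩ ≈ t u₀ *ᶠ ψ (κ u₀) +ᶠ 0#
    go (u ∷ C) (u∉ ∷ _) (here ≡.refl) ψ = +-congˡ (vanish C (λ v∈ → All.lookup u∉ v∈ ∘ ≡.sym) ψ)
    go (u ∷ C) (u∉ ∷ d) (there u₀∈)   ψ = trans (+-cong (trans (*-congʳ (h (All.lookup u∉ u₀∈))) (zeroˡ _)) (go C d u₀∈ ψ)) (+-identityˡ _)

module Completed {a ℓ} (F : Field a ℓ) (n : ℕ) (f : SparsePoly F n) (e : ℕ) (1≤e : 1 ≤ e) (O : RootOracle F e) (X : ℕ)
  {g₀ : Poly F n} (g₀^e≋f : PolyArithmetic._≋_ F (PolyArithmetic._^ᵖ_ F g₀ e) (SparsePoly.terms f))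
  {t₁ : Term F n} (t₁∈terms : t₁ ∈ SparsePoly.terms f) where
  open FieldExtras F
  open SparsePoly f
  open Univariate F
  open PureAttempt F n
  open PureSearch F n
  open Faithfulness F n
  open Graphs F n
  open GraphRoots F n
  open Completeness F n
  open Characteristic F
  open RootData F n f e 1≤e {g₀} g₀^e≋f
  open OracleRules O X using (rootOrZero; frobeniusRoot; frobeniusRoots)
  open OracleExponent O X 1≤e using (rootOrZero-root)
  open OracleExponent.Exponents (exponents O X 1≤e)
  open VectorCandidates e D s ms using (candidatesᵛ; ∈-candidatesᵛ⁺; ∈-candidatesᵛ⁻; candidatesᵛ-unique)

  y : Carrier
  y = rootOrZero (coef substituted topKey)

  degree<W : ∀ {u : Vec ℕ n} → e * Vec.sum u ≤ D → Vec.sum u < W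
  degree<W {u} le = s≤s (ℕ.≤-trans (ℕ.m≤n*m (Vec.sum u) e {{ℕ.>-nonZero 1≤e}}) le)

  -- A root normalised to what an attempt can reach: its leading coefficient is the choice `y` of
  -- the oracle, and it is supported on candidates.
  record Witness : Set (a ⊔ ℓ) where
    field
      t     : Vec ℕ n → Carrier
      u₀    : Vec ℕ n
      u₀∈   : u₀ ∈ candidatesᵛ
      tu₀≈y : t u₀ ≈ y
      y≉0   : ¬ y ≈ 0#
      graph^e≋ : graph t φ (kept W u₀ candidatesᵛ) ^ˢ e ≋ substituted
      key≡  : topKey ≡ e * φ u₀

  private
    y-properties : ∀ {c} → ¬ c ≈ 0# → coef substituted topKey ≈ c ^ᶠ e → y ^ᶠ e ≈ c ^ᶠ e × ¬ y ≈ 0#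
    y-properties {c} c≉0 top = y^e≈ , λ y≈0 → ^-≉0 e c≉0 (trans (sym y^e≈) (trans (^-congˡ e y≈0) (0^ 1≤e)))
      where
      y^e≈ : y ^ᶠ e ≈ c ^ᶠ e
      y^e≈ = trans (rootOrZero-root (sym top)) top
      0^ : ∀ {e} → 1 ≤ e → 0# ^ᶠ e ≈ 0#
      0^ (s≤s _) = zeroˡ _

  -- Two roots of f differ by a scalar, so the root may be assumed to have the leading coefficient y.
  witness-general : 2 ≤ s → Witness
  witness-general 2≤s = record
    { t = λ u → x *ᶠ t₀ u ; u₀ = u₀ ; u₀∈ = u₀∈C
    ; tu₀≈y = trans (*-assoc y _ _) (trans (*-congˡ (trans (*-comm _ _) (*-inv (t₀ u₀) t₀u₀≉0))) (*-identityʳ y))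
    ; y≉0 = proj₂ (y-properties t₀u₀≉0 top-coef)
    ; graph^e≋ = ≋-trans (^ˢ-cong e (kept-≋ {λ u → x *ᶠ t₀ u} {W} {u₀} candidatesᵛ dropped)) (graph-scale-^ {t₀} {φ} {x} {e} {substituted} candidatesᵛ x^e≈1 (graph-root unique bounded supported))
    ; key≡ = topKey≡ }
    where
    unique : Unique candidatesᵛ
    unique = candidatesᵛ-unique
    bounded : ∀ {u} → u ∈ candidatesᵛ → Vec.sum u < W
    bounded {u} u∈ = degree<W {u} (proj₁ (∈-candidatesᵛ⁻ u∈))
    supported : ∀ {u} → ¬ t₀ u ≈ 0# → u ∈ candidatesᵛ
    supported u≉0 = ∈-candidatesᵛ⁺ 1≤e (support-degree u≉0 , λ i → support-fits u≉0 i , inj₁ 2≤s)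
    open Leading (leading unique bounded supported t₁∈terms)
    x : Carrier
    x = y *ᶠ t₀ u₀ ⁻¹
    x^e≈1 : x ^ᶠ e ≈ 1#
    x^e≈1 = begin
      (y *ᶠ t₀ u₀ ⁻¹) ^ᶠ e              ≈⟨ ^-distrib-* y (t₀ u₀ ⁻¹) e ⟩
      y ^ᶠ e *ᶠ (t₀ u₀ ⁻¹) ^ᶠ e         ≈⟨ *-congʳ (proj₁ (y-properties t₀u₀≉0 top-coef)) ⟩
      t₀ u₀ ^ᶠ e *ᶠ (t₀ u₀ ⁻¹) ^ᶠ e     ≈⟨ ^-distrib-* (t₀ u₀) (t₀ u₀ ⁻¹) e ⟨
      (t₀ u₀ *ᶠ t₀ u₀ ⁻¹) ^ᶠ e          ≈⟨ ^-congˡ e (*-inv (t₀ u₀) t₀u₀≉0) ⟩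
      1# ^ᶠ e                           ≈⟨ 1^ e ⟩
      1#                                ∎
      where
      1^ : ∀ k → 1# ^ᶠ k ≈ 1#
      1^ zero    = refl
      1^ (suc k) = trans (*-identityˡ _) (1^ k)
    dropped : ∀ {u} → u ∈ candidatesᵛ → ¬ φ u ≤ φ u₀ → x *ᶠ t₀ u ≈ 0#
    dropped {u} u∈ u≰u₀ = trans (*-congˡ (trans (sym (graph-coef {t₀} {φ} candidatesᵛ unique (C-injective unique bounded supported) u∈))
      (above below (φ u) (ℕ.≰⇒> u≰u₀)))) (zeroʳ x)

  -- The leading monomial of a root of a monomial is itself a root.
  module _ (s≤1 : s ≤ 1) where
    -- With 2 in place of `s` exponents are not forced, so these candidates contain the whole
    -- support of the given root. Only its leading monomial is then shown to be a candidate for the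
    -- actual `s`.
    private module C₂ = VectorCandidates e D 2 ms
    bounded : ∀ {u} → u ∈ C₂.candidatesᵛ → Vec.sum u < W
    bounded {u} u∈ = degree<W {u} (proj₁ (C₂.∈-candidatesᵛ⁻ u∈))
    supported : ∀ {u} → ¬ t₀ u ≈ 0# → u ∈ C₂.candidatesᵛ
    supported u≉0 = C₂.∈-candidatesᵛ⁺ 1≤e (support-degree u≉0 , λ i → support-fits u≉0 i , inj₁ ℕ.≤-refl)

    module _ (lead : Leading {C₂.candidatesᵛ} C₂.candidatesᵛ-unique bounded supported) where
      open Leading lead
      private
        v : Vec ℕ n
        v = proj₂ t₁
        terms≡ : terms ≡ t₁ ∷ []
        terms≡ = singleton t₁∈terms s≤1
          where
          singleton : ∀ {L : Poly F n} → t₁ ∈ L → length L ≤ 1 → L ≡ t₁ ∷ []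
          singleton {_ ∷ []}    (here ≡.refl) _ = ≡.refl
          singleton {_ ∷ _ ∷ _} _ (s≤s ())
        t : Vec ℕ n → Carrier
        t u = if does (≡-dec ℕ._≟_ u u₀) then y else 0#
        tu₀≈y : t u₀ ≈ y
        tu₀≈y with ≡-dec ℕ._≟_ u₀ u₀
        ... | yes _   = refl
        ... | no u≢u = contradiction ≡.refl u≢u
        t-single : ∀ {u} → u ≢ u₀ → t u ≈ 0#
        t-single {u} u≢u₀ with ≡-dec ℕ._≟_ u u₀
        ... | yes eq = contradiction eq u≢u₀
        ... | no _   = refl
        topKey≡φv : topKey ≡ φ v
        topKey≡φv = ≡.trans (≡.cong (λ L → foldr (λ t k → proj₂ t ℕ.⊔ k) 0 (image W 1 L)) terms≡) (ℕ.⊔-identityʳ (φ v))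
        eφ≡φv : e * φ u₀ ≡ φ v
        eφ≡φv = ≡.trans (≡.sym topKey≡) topKey≡φv
        coefficient : t u₀ ^ᶠ e ≈ proj₁ t₁
        coefficient = trans (^-congˡ e tu₀≈y) (trans (proj₁ (y-properties t₀u₀≉0 top-coef)) (trans (sym top-coef)
          (trans (reflexive (≡.cong (coef substituted) topKey≡φv)) (substituted-coef t₁∈terms))))
        -- Equal keys give equal vectors because both total degrees are at most D.
        eu₀≡v : Vec.map (e *_) u₀ ≡ v
        eu₀≡v = key-injective {W = W} (≡.subst (_< W) (≡.sym (sum-map e u₀)) (s≤s (support-degree t₀u₀≉0))) (s≤s (sum≤tdeg f t₁∈terms))
          (≡.trans (key-map e {W} u₀) (≡.trans (≡.cong (e *_) (≡.sym (ℕ.*-identityˡ (keyᵛ W u₀)))) (≡.trans eφ≡φv (ℕ.*-identityˡ (keyᵛ W v)))))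
        ms-lookup : ∀ i → Vec.lookup ms i ≤ e * Vec.lookup u₀ i
        ms-lookup i = ℕ.≤-reflexive (≡.trans (≡.cong (λ L → Vec.lookup (columnSums L) i) terms≡)
          (≡.trans (lookup-zipWith _+_ i v (Vec.replicate n 0)) (≡.trans (≡.cong (Vec.lookup v i +_) (lookup-replicate i 0))
          (≡.trans (ℕ.+-identityʳ _) (≡.trans (≡.cong (λ u → Vec.lookup u i) (≡.sym eu₀≡v)) (lookup-map i (e *_) u₀))))))
        u₀∈ : u₀ ∈ candidatesᵛ
        u₀∈ = ∈-candidatesᵛ⁺ 1≤e (support-degree t₀u₀≉0 , λ i → support-fits t₀u₀≉0 i , inj₂ (ms-lookup i))
        single : graph t φ (kept W u₀ candidatesᵛ) ≋ (t u₀ , φ u₀) ∷ []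
        single = graph-single {t} {φ} {u₀} (kept W u₀ candidatesᵛ) (kept-unique W u₀ candidatesᵛ candidatesᵛ-unique)
          (∈-kept⁺ W u₀ candidatesᵛ u₀∈ ℕ.≤-refl) t-single
        same-term : (t u₀ ^ᶠ e , e * φ u₀) ∷ [] ≋ substituted
        same-term = ≡.subst ((t u₀ ^ᶠ e , e * φ u₀) ∷ [] ≋_) (≡.cong (image W 1) (≡.sym terms≡))
          (mk λ ψ → +-congʳ (*-cong coefficient (reflexive (≡.cong ψ eφ≡φv))))

      monomial-witness : Witness
      monomial-witness = record
        { t = t ; u₀ = u₀ ; u₀∈ = u₀∈
        ; tu₀≈y = tu₀≈y
        ; y≉0 = proj₂ (y-properties t₀u₀≉0 top-coef)
        ; graph^e≋ = ≋-trans (^ˢ-cong e single) (≋-trans (term-^ (t u₀) (φ u₀) e) same-term)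
        ; key≡ = topKey≡ }

    witness-monomial : Witness
    witness-monomial = monomial-witness (leading C₂.candidatesᵛ-unique bounded supported t₁∈terms)

  abstract
    witness : Witness
    witness with 2 ℕ.≤? s
    ... | yes 2≤s = witness-general 2≤s
    ... | no 2≰s  = witness-monomial (ℕ.≤-pred (ℕ.≰⇒> 2≰s))

  -- The coefficients of f are coefficients of an e-th power and hence P-th powers, so
  -- `frobeniusRoot` returns a true root of each.
  substituted≈H^P : ∀ k → coef substituted k ≈ coef (frobeniusRoots substituted) k ^ᶠ P
  substituted≈H^P k = trans (sym (rooted substituted isPower)) (trans (reflexive (≡.cong (λ A → coef A k) (map-∘ substituted)))
    (FrobeniusMap.coef-^P frobeniusPower (frobeniusRoots substituted) k))
    where
    open Witness witness
    rooted : ∀ A → (∀ {s} → s ∈ A → frobeniusRoot (proj₁ s) ^ᶠ P ≈ proj₁ s) →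
             coef (map (λ s → frobeniusRoot (proj₁ s) ^ᶠ P , proj₂ s) A) k ≈ coef A k
    rooted []      _ = refl
    rooted (s ∷ A) h = case proj₂ s ℕ.≟ k of λ where
      (yes eq) → trans (coef-≡ {P = map _ A} eq) (trans (+-cong (h (here ≡.refl)) (rooted A (h ∘ there))) (sym (coef-≡ {P = A} eq)))
      (no neq) → trans (coef-≢ {P = map _ A} neq) (trans (rooted A (h ∘ there)) (sym (coef-≢ {P = A} neq)))
    isPower : ∀ {s} → s ∈ substituted → frobeniusRoot (proj₁ s) ^ᶠ P ≈ proj₁ s
    isPower s∈ with ∈-map⁻ _ s∈
    ... | t′ , t′∈ , ≡.refl = isRoot (trans (sym (coef-^ˢ-frobenius frobeniusPower (graph t φ (kept W u₀ candidatesᵛ)) P*q≡e (φ (proj₂ t′))))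
      (trans (≋-coef graph^e≋ (φ (proj₂ t′))) (substituted-coef t′∈)))

  search-complete : ¬ search candidatesᵛ W e substituted (frobeniusRoots substituted) topKey y ≡ nothing
  search-complete eq = contradiction (≡.trans (≡.sym (proj₂ found))
    (search-nothing candidatesᵛ W e substituted (frobeniusRoots substituted) topKey y eq {P} {q} (∈-numbers⁺ e 1≤P P≤e) (∈-numbers⁺ e 1≤q q≤e))) λ ()
    where
    open Witness witness
    found : ∃ λ g → attempt candidatesᵛ W e substituted (frobeniusRoots substituted) topKey y P q ≡ just g
    found = attempt-complete {candidatesᵛ} {W} {e} {substituted} {frobeniusRoots substituted} {topKey} {y} {t} {u₀}
      candidatesᵛ-unique (λ {u} u∈ → degree<W {u} (proj₁ (∈-candidatesᵛ⁻ u∈))) u₀∈ tu₀≈y y≉0 graph^e≋ key≡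
      frobeniusPower substituted≈H^P P*q≡e q≉0
    1≤P = FrobeniusPower.positive frobeniusPower
    1≤q : 1 ≤ q
    1≤q = ℕ.n≢0⇒n>0 λ q≡0 → q≉0 (reflexive (≡.cong (_×ᶠ 1#) q≡0))
    P≤e : P ≤ e
    P≤e = ≡.subst (P ≤_) P*q≡e (ℕ.m≤m*n P q {{ℕ.>-nonZero 1≤q}})
    q≤e : q ≤ e
    q≤e = ≡.subst (q ≤_) P*q≡e (ℕ.m≤n*m q P {{ℕ.>-nonZero 1≤P}})

-- Sizes

support-++ : ∀ pre ys → support ys ≤ support (pre ++ ys)
support-++ []            ys = ℕ.≤-refl
support-++ (zero  ∷ pre) ys = support-++ pre ys
support-++ (suc _ ∷ pre) ys = ℕ.m≤n⇒m≤1+n (support-++ pre ys)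

support≤sum : ∀ ms → support ms ≤ foldr _+_ 0 ms
support≤sum []           = z≤n
support≤sum (zero  ∷ ms) = support≤sum ms
support≤sum (suc m ∷ ms) = s≤s (ℕ.≤-trans (support≤sum ms) (ℕ.m≤n+m _ m))

sum≡0⇒zeros : ∀ {n} (u : Vec ℕ n) → Vec.sum u ≡ 0 → u ≡ replicate n 0
sum≡0⇒zeros []          _  = ≡.refl
sum≡0⇒zeros (zero  ∷ u) eq = ≡.cong (0 ∷_) (sum≡0⇒zeros u eq)

max≡0⇒sum≡0 : ∀ {n} (u : Vec ℕ n) → Vec.foldr _ ℕ._⊔_ 0 u ≤ 0 → Vec.sum u ≡ 0
max≡0⇒sum≡0 []          _  = ≡.refl
max≡0⇒sum≡0 (x ∷ u) le with ℕ.≤-trans (ℕ.m≤m⊔n x _) le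
... | z≤n = max≡0⇒sum≡0 u le

-- The source of the bound s D on the number of occurring variables: each of them adds at least 1 to
-- this sum.
columnSums-sum : ∀ {b} {B : Set b} {n} (L : List (B × Vec ℕ n)) {D} → (∀ {t} → t ∈ L → Vec.sum (proj₂ t) ≤ D) →
                 Vec.sum (columnSums L) ≤ length L * D
columnSums-sum {n = n} []  _ = ℕ.≤-reflexive (Additive.0-homo (sum-additive {n}))
columnSums-sum (t ∷ L) h = ≡.subst (_≤ _) (≡.sym (Additive.+-homo sum-additive (proj₂ t) (columnSums L)))
  (ℕ.+-mono-≤ (h (here ≡.refl)) (columnSums-sum L (h ∘ there)))

module _ {a ℓ} (F : Field a ℓ) (n : ℕ) (f : SparsePoly F n) where
  open FieldExtras F
  open SparsePoly f
  open Substitution F n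
  open PolyArithmetic F {n} renaming (_≋_ to _≋ᵖ_)

  private
    scan : ∀ (L : Poly F n) → (∀ {t} → t ∈ L → Vec.sum (proj₂ t) ≡ 0) ⊎ ∃ λ t → t ∈ L × 1 ≤ Vec.sum (proj₂ t)
    scan []      = inj₁ λ ()
    scan (t ∷ L) with Vec.sum (proj₂ t) in eq | scan L
    ... | suc _ | _                    = inj₂ (t , here ≡.refl , ≡.subst (1 ≤_) (≡.sym eq) (s≤s z≤n))
    ... | zero  | inj₂ (t′ , t′∈ , le) = inj₂ (t′ , there t′∈ , le)
    ... | zero  | inj₁ zeros           = inj₁ λ { (here ≡.refl) → eq ; (there t∈) → zeros t∈ }

    isConstant : (∀ {t} → t ∈ terms → Vec.sum (proj₂ t) ≡ 0) → terms ≋ᵖ constant (coeff terms (replicate n 0))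
    isConstant zeros u = trans (reflexive (coeff≡coef terms u)) (trans (compare (≡-dec ℕ._≟_ (replicate n 0) u))
      (reflexive (≡.sym (coeff≡coef (constant (coeff terms (replicate n 0))) u))))
      where
      compare : Dec (replicate n 0 ≡ u) → V.coef terms u ≈ V.coef (constant (coeff terms (replicate n 0))) u
      compare (yes ≡.refl) = trans (reflexive (≡.sym (coeff≡coef terms u))) (sym (trans (V.coef-≡ {v = replicate n 0} {P = []} ≡.refl) (+-identityʳ _)))
      compare (no 0≢u)     = trans (V.coef-∉ terms (All.tabulate λ {t} t∈ eq → 0≢u (≡.trans (≡.sym (sum≡0⇒zeros (proj₂ t) (zeros t∈))) eq)))
        (sym (V.coef-≢ {P = []} 0≢u))

  nonconstant-term : NonConstant f → ∃ λ t → t ∈ terms × 1 ≤ Vec.sum (proj₂ t)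
  nonconstant-term ¬constant with scan terms
  ... | inj₂ found = found
  ... | inj₁ zeros = contradiction (_ , isConstant zeros) ¬constant

  module _ {t₁ : Term F n} (t₁∈ : t₁ ∈ terms) (1≤t₁ : 1 ≤ Vec.sum (proj₂ t₁)) where

    1≤tdeg : 1 ≤ tdeg f
    1≤tdeg = ℕ.≤-trans 1≤t₁ (sum≤tdeg f t₁∈)

    1≤indeg : 1 ≤ indeg f
    1≤indeg = ℕ.≮⇒≥ λ indeg<1 → contradiction (max≡0⇒sum≡0 (proj₂ t₁) (ℕ.≤-trans
      (≡.subst (_ ≤_) (≡.sym (foldr-map ℕ._⊔_ (Vec.foldr _ ℕ._⊔_ 0 ∘ proj₂) 0 terms)) (≤-foldr-⊔ (Vec.foldr _ ℕ._⊔_ 0 ∘ proj₂) terms t₁∈))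
      (ℕ.≤-pred indeg<1))) λ eq → ℕ.<⇒≱ 1≤t₁ (ℕ.≤-reflexive eq)

    1≤sparsity : 1 ≤ ‖ f ‖₀
    1≤sparsity = go t₁∈
      where
      go : ∀ {L : Poly F n} → t₁ ∈ L → 1 ≤ length L
      go (here _)  = s≤s z≤n
      go (there _) = s≤s z≤n

    -- From e deg g ≤ D < e a root would be constant, and then so would be its power, but `t₁` has
    -- positive degree.
    no-high-root : ∀ {e} → tdeg f < e → ¬ (∃ λ g → g ^ᵖ e ≋ᵖ terms)
    no-high-root {e} D<e (g₀ , root-of-f) = ℕ.<⇒≱ 1≤t₁ t₁≤0
      where
      open Faithfulness F n
      open RootData F n f e (ℕ.≤-trans (s≤s z≤n) D<e) {g₀} root-of-f
      -- The list `g₀` may contain terms of positive degree that cancel, so it is replaced by its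
      -- constant coefficient.
      g₁ : Poly F n
      g₁ = (t₀ (replicate n 0) , replicate n 0) ∷ []
      support-zero : ∀ {u} → ¬ t₀ u ≈ 0# → replicate n 0 ≡ u
      support-zero {u} u≉0 = ≡.sym (sum≡0⇒zeros u (ℕ.n<1⇒n≡0 (ℕ.*-cancelˡ-< e (Vec.sum u) 1
        (≡.subst (e * Vec.sum u <_) (≡.sym (ℕ.*-identityʳ e)) (ℕ.≤-<-trans (support-degree u≉0) D<e)))))
      g₁≋g₀ : g₁ V.≋ g₀
      g₁≋g₀ = V.coef-≋ λ u → case ≡-dec ℕ._≟_ (replicate n 0) u of λ where
        (yes ≡.refl) → trans (V.coef-≡ {v = replicate n 0} {P = []} ≡.refl) (+-identityʳ _)
        (no 0≢u)     → trans (V.coef-≢ {P = []} 0≢u) (case t₀ u ≟ 0# of λ where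
          (yes u≈0) → sym u≈0
          (no u≉0)  → contradiction (support-zero u≉0) 0≢u)
      t₁≤0 : Vec.sum (proj₂ t₁) ≤ 0
      t₁≤0 with coef≉0⇒∈ (g₁ ^ᵖ e) {proj₂ t₁} (λ c≈0 → All.lookup nonzero t₁∈
        (trans (sym (terms-coef terms distinct t₁∈)) (trans (sym (V.≋-coef (≋ᵖ⇒≋ {g₀ ^ᵖ e} {terms} root-of-f) (proj₂ t₁)))
          (trans (sym (V.≋-coef (^ᵖ-cong e g₁≋g₀) (proj₂ t₁))) c≈0))))
      ... | t , t∈ , ≡.refl = ≡.subst (Vec.sum (proj₂ t) ≤_) (ℕ.*-zeroʳ e)
        (All.lookup (^ᵖ-All sum-additive g₁ e (ℕ.≤-reflexive (Additive.0-homo (sum-additive {n})) ∷ [])) t∈)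

  module CandidateBounds (e : ℕ) (1≤e : 1 ≤ e) (1≤s : 1 ≤ ‖ f ‖₀) where
    open PureAttempt F n
    private
      D W s : ℕ
      D = tdeg f
      W = suc D
      s = ‖ f ‖₀
      ms : Vec ℕ n
      ms = columnSums terms

    bound : ℕ
    bound = s ^ (3 * D)

    open VectorCandidates e D s ms

    1≤bound : 1 ≤ bound
    1≤bound = ℕ.m^n>0 s {{ℕ.>-nonZero 1≤s}} (3 * D)

    support-ms : support (toList ms) ≤ s * D
    support-ms = ℕ.≤-trans (support≤sum (toList ms)) (ℕ.≤-trans (ℕ.≤-reflexive (sum-toList ms))
      (columnSums-sum terms (sum≤tdeg f)))

    -- Stated for any e′ because the keys of powers are counted with e′ = 1, and for suffixes
    -- because the program passes through the candidates of each of them.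
    candidates-bound : ∀ {e′} → 1 ≤ e′ → ∀ pre ys → toList ms ≡ pre ++ ys → length (Candidates.candidates e′ D s ys) ≤ bound
    candidates-bound {e′} 1≤e′ pre ys eq with 2 ℕ.≤? s
    ... | yes 2≤s = Candidates.candidates-length e′ D s 1≤e′ 2≤s ys
      (ℕ.≤-trans (support-++ pre ys) (≡.subst (λ l → support l ≤ s * D) eq support-ms))
    ... | no 2≰s = ℕ.≤-trans (Candidates.candidates-forced e′ D s 1≤e′ (ℕ.≤-pred (ℕ.≰⇒> 2≰s)) ys) 1≤bound

    candidatesᵛ-bound : ∀ {e′} → 1 ≤ e′ → length (VectorCandidates.candidatesᵛ e′ D s ms) ≤ bound
    candidatesᵛ-bound {e′} 1≤e′ = ≡.subst (_≤ bound) (≡.trans (≡.cong length (≡.sym (VectorCandidates.candidatesᵛ-toList e′ D s ms)))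
      (length-map toList (VectorCandidates.candidatesᵛ e′ D s ms))) (candidates-bound 1≤e′ [] (toList ms) ≡.refl)

    private
      scaled-+ : ∀ P u v → scaled W P u + scaled W P v ≡ scaled W P (zipWith _+_ u v)
      scaled-+ P u v = ≡.sym (Additive.+-homo (*-additive (key-additive W) P) u v)

      -- The stock for the j-th power consists of the candidates for j D and for j times the column
      -- sums. Such bounds add up along products; for j ≤ e the factor e cancels, and every member
      -- becomes a candidate for the exponent 1, of which there are few.
      sparse-keys : 2 ≤ s → ∀ P → PowerKeys candidatesᵛ W P e bound
      sparse-keys 2≤s P = record
        { S = λ j → map (scaled W P) (products j)
        ; small = λ j j≤e → ≡.subst (_≤ bound) (≡.sym (length-map (scaled W P) (products j)))
            (ℕ.≤-trans (unique-⊆-length (Product.candidatesᵛ-unique j) (reduced j≤e)) (candidatesᵛ-bound ℕ.≤-refl))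
        ; zero∈ = ≡.subst (_∈ map (scaled W P) (products 0)) (Additive.0-homo (*-additive (key-additive {n} W) P))
            (∈-map⁺ (scaled W P) (Product.∈-candidatesᵛ⁺ 0 {replicate n 0} 1≤e
              ( ℕ.≤-reflexive (≡.trans (≡.cong (e *_) (Additive.0-homo (sum-additive {n}))) (ℕ.*-zeroʳ e))
              , λ i → ≡.subst₂ _≤_ (≡.sym (≡.trans (≡.cong (e *_) (lookup-replicate i 0)) (ℕ.*-zeroʳ e))) ≡.refl z≤n , inj₁ 2≤s)))
        ; closed = closed }
        where
        module Product (j : ℕ) = VectorCandidates e (j * D) s (Vec.map (j *_) ms)
        module One = VectorCandidates 1 D s ms
        products : ℕ → List (Vec ℕ n)
        products j = Product.candidatesᵛ j
        reduced : ∀ {j u} → j ≤ e → u ∈ products j → u ∈ One.candidatesᵛ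
        reduced {j} {u} j≤e u∈ with Product.∈-candidatesᵛ⁻ j u∈
        ... | deg , fits = One.∈-candidatesᵛ⁺ ℕ.≤-refl
          ( ≡.subst (_≤ D) (≡.sym (ℕ.*-identityˡ _)) (cancel (ℕ.≤-trans deg (ℕ.*-monoˡ-≤ D j≤e)))
          , λ i → ≡.subst (_≤ Vec.lookup ms i) (≡.sym (ℕ.*-identityˡ _))
              (cancel (ℕ.≤-trans (proj₁ (fits i)) (≡.subst (_≤ e * Vec.lookup ms i) (≡.sym (lookup-map i (j *_) ms)) (ℕ.*-monoˡ-≤ _ j≤e))))
            , inj₁ 2≤s)
          where
          cancel : ∀ {x y} → e * x ≤ e * y → x ≤ y
          cancel = ℕ.*-cancelˡ-≤ e {{ℕ.>-nonZero 1≤e}}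
        closed : ∀ {j u l} → j < e → u ∈ candidatesᵛ → l ∈ map (scaled W P) (products j) →
                 scaled W P u + l ∈ map (scaled W P) (products (suc j))
        closed {j} {u} j<e u∈ l∈ with ∈-map⁻ (scaled W P) l∈
        ... | v , v∈ , l≡ with ∈-candidatesᵛ⁻ u∈ | Product.∈-candidatesᵛ⁻ j v∈
        ...   | du , fu | dv , fv = ≡.subst (_∈ map (scaled W P) (products (suc j)))
          (≡.sym (≡.trans (≡.cong (scaled W P u +_) l≡) (scaled-+ P u v)))
          (∈-map⁺ (scaled W P) (Product.∈-candidatesᵛ⁺ (suc j) {zipWith _+_ u v} 1≤e
            ( ≡.subst (_≤ suc j * D) (≡.sym (≡.trans (≡.cong (e *_) (Additive.+-homo sum-additive u v)) (ℕ.*-distribˡ-+ e _ _)))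
                (ℕ.+-mono-≤ du dv)
            , λ i → ≡.subst₂ _≤_
                (≡.sym (≡.trans (≡.cong (e *_) (lookup-zipWith _+_ i u v)) (ℕ.*-distribˡ-+ e _ _)))
                (≡.trans (≡.cong (Vec.lookup ms i +_) (lookup-map i (j *_) ms)) (≡.sym (lookup-map i (suc j *_) ms)))
                (ℕ.+-mono-≤ (proj₁ (fu i)) (proj₁ (fv i)))
              , inj₁ 2≤s)))

      -- A power of a single monomial is a single monomial. One key is all that `bound` allows for s
      -- = 1, where it equals 1.
      single-keys : ∀ Cs P → length Cs ≤ 1 → PowerKeys Cs W P e bound
      single-keys []          P _ = record
        { S = λ _ → 0 ∷ [] ; small = λ _ _ → 1≤bound ; zero∈ = here ≡.refl ; closed = λ _ () }
      single-keys (u ∷ [])    P _ = record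
        { S = λ j → j * scaled W P u ∷ [] ; small = λ _ _ → 1≤bound ; zero∈ = here ≡.refl
        ; closed = λ { _ (here ≡.refl) (here ≡.refl) → here ≡.refl } }
      single-keys (_ ∷ _ ∷ _) P (s≤s ())

    power-keys : ∀ P → PowerKeys candidatesᵛ W P e bound
    power-keys P with 2 ℕ.≤? s
    ... | yes 2≤s = sparse-keys 2≤s P
    ... | no 2≰s  = single-keys candidatesᵛ P (≡.subst (_≤ 1) (≡.trans (≡.cong length (≡.sym candidatesᵛ-toList)) (length-map toList candidatesᵛ))
      (Candidates.candidates-forced e D s 1≤e (ℕ.≤-pred (ℕ.≰⇒> 2≰s)) (toList ms)))

-- Correctness and running time of the whole algorithm

module Correctness {a ℓ} (F : Field a ℓ) (n : ℕ) (f : SparsePoly F n) (nonconstant : NonConstant f)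
  (e : ℕ) (1≤e : 1 ≤ e) (O : RootOracle F e) where
  open RootOracle O
  open SparsePoly f
  open PureAttempt F n
  open Faithfulness F n

  private
    s d D : ℕ
    s = ‖ f ‖₀
    d = indeg f
    D = tdeg f

    term : ∃ λ t → t ∈ terms × 1 ≤ Vec.sum (proj₂ t)
    term = nonconstant-term F n f nonconstant

    t₁∈ : proj₁ term ∈ terms
    t₁∈ = proj₁ (proj₂ term)

    1≤t₁ : 1 ≤ Vec.sum (proj₂ (proj₁ term))
    1≤t₁ = proj₂ (proj₂ term)

    1≤s : 1 ≤ s
    1≤s = 1≤sparsity F n f t₁∈ 1≤t₁

    1≤Dd : 1 ≤ D * d
    1≤Dd = ℕ.*-mono-≤ (1≤tdeg F n f t₁∈ 1≤t₁) (1≤indeg F n f t₁∈ 1≤t₁)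

    instance
      s≢0 : NonZero s
      s≢0 = ℕ.>-nonZero 1≤s

  -- The factor 2 makes room for D + 1, and for the s ^ (3 D) terms of a power together with the s
  -- terms of f in a residual.
  size X : ℕ
  size = s ^ (3 * (D * d)) + n + d + D
  X    = 2 * size

  power≤size : s ^ (3 * (D * d)) ≤ size
  power≤size = ℕ.≤-trans (ℕ.m≤m+n _ n) (ℕ.≤-trans (ℕ.m≤m+n _ d) (ℕ.m≤m+n _ D))

  1≤size : 1 ≤ size
  1≤size = ℕ.≤-trans (ℕ.m^n>0 s (3 * (D * d))) power≤size

  private
    D≤size : D ≤ size
    D≤size = ℕ.m≤n+m D _

    size≤X : size ≤ X
    size≤X = ℕ.m≤n*m size 2

    size+size≤X : size + size ≤ X
    size+size≤X = ℕ.≤-reflexive (≡.cong (size +_) (≡.sym (ℕ.+-identityʳ size)))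

    n≤X : n ≤ X
    n≤X = ℕ.≤-trans (ℕ.≤-trans (ℕ.m≤n+m n _) (ℕ.≤-trans (ℕ.m≤m+n _ d) (ℕ.m≤m+n _ D))) size≤X

    D<X : suc D ≤ X
    D<X = ℕ.≤-trans (ℕ.+-mono-≤ 1≤size D≤size) size+size≤X

    s≤size : s ≤ size
    s≤size = ℕ.≤-trans (ℕ.≤-trans (ℕ.≤-reflexive (≡.sym (ℕ.^-identityʳ s)))
      (ℕ.^-monoʳ-≤ s (ℕ.≤-trans 1≤Dd (ℕ.m≤n*m (D * d) 3)))) power≤size

    s≤X : s ≤ X
    s≤X = ℕ.≤-trans s≤size size≤X

    open CandidateBounds F n f e 1≤e 1≤s
    open VectorCandidates e D s (columnSums terms)

    bound≤size : bound ≤ size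
    bound≤size = ℕ.≤-trans (ℕ.^-monoʳ-≤ s (ℕ.*-monoʳ-≤ 3 (ℕ.m≤m*n D d {{ℕ.>-nonZero (1≤indeg F n f t₁∈ 1≤t₁)}}))) power≤size

    input : All (Semantics.⟦_⟧ O) (nat ∷ nat ∷ polyTy ∷ [])
    input = lift n ∷ lift e ∷ encode O terms ∷ []

    module _ (e≤D : e ≤ D) where
      open MainRuns O X f e≤D n≤X D<X s≤X

      H : List (Field.Carrier F × ℕ)
      H = OracleRules.frobeniusRoots O X substituted

      y : Field.Carrier F
      y = OracleRules.rootOrZero O X (FormalSums.coef F ℕ._≟_ substituted topKey)

      result′ : Maybe (Poly F n)
      result′ = outcome candidatesᵛ candidatesᵛ-toList (ℕ.≤-trans (ℕ.+-mono-≤ bound≤size s≤size) size+size≤X)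
        (λ P _ _ → power-keys P) 1≤e (λ pre ys eq → ℕ.≤-trans (candidates-bound 1≤e pre ys eq) (ℕ.≤-trans bound≤size size≤X))

      runs′ : OracleRules.RunsO O X (rootCost + (s * frobCost + 0)) algorithm input (Maybe.map (encode O) result′)
      runs′ = algorithm-runs candidatesᵛ candidatesᵛ-toList (ℕ.≤-trans (ℕ.+-mono-≤ bound≤size s≤size) size+size≤X)
        (λ P _ _ → power-keys P) 1≤e (λ pre ys eq → ℕ.≤-trans (candidates-bound 1≤e pre ys eq) (ℕ.≤-trans bound≤size size≤X))

      classify : ∀ m → result′ ≡ m → IsRootOf O (Maybe.map (encode O) m) f
      classify nothing  eq = λ (g , g^e≋f) → Completed.search-complete F n f e 1≤e O X {g} g^e≋f t₁∈ eq
      classify (just g) eq =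
        let (P , q , found) = search-just candidatesᵛ (suc D) e substituted H topKey y eq
            (h , g≡ , h^e≋f) = attempt-sound {candidatesᵛ} {D} {e} {terms} {H} {topKey} {y} {P} {q} 1≤e candidatesᵛ-unique
              (λ u∈ → proj₁ (∈-candidatesᵛ⁻ u∈)) (All.tabulate (sum≤tdeg f)) found
        in h , ≡.cong (encode O) g≡ , h^e≋f

    -- The single root can be charged as s roots, because f has at least one term.
    oracle≤ : rootCost + (s * frobCost + 0) ≤ s * cost
    oracle≤ = ℕ.≤-trans (ℕ.+-mono-≤ (ℕ.m≤n*m rootCost s) (ℕ.≤-reflexive (ℕ.+-identityʳ (s * frobCost))))
      (ℕ.≤-reflexive (≡.sym (ℕ.*-distribˡ-+ s rootCost frobCost)))

    rejects : ¬ e ≤ D → OracleRules.RunsO O X 0 algorithm input nothing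
    rejects = DegreeRuns.algorithm-high-exponent O X f n≤X s≤X

    conclude : ∀ (A : Algorithm) {v r} → OracleRules.RunsO O X r A input v → r ≤ s * cost → IsRootOf O v f →
               IsRootOf O (output O A f) f × time O A f ≤ costOf A X + s * cost
    conclude A (OracleRules.runsO yielded) r≤ isRoot =
      ≡.subst (λ x → IsRootOf O x f) (≡.sym (Yields.result yielded)) isRoot ,
      ℕ.≤-trans (Yields.time≤ yielded) (ℕ.+-monoʳ-≤ (costOf A X) r≤)

    cases : Dec (e ≤ D) → IsRootOf O (output O algorithm f) f × time O algorithm f ≤ costOf algorithm X + s * cost
    cases (yes e≤D) = conclude algorithm (runs′ e≤D) oracle≤ (classify e≤D _ ≡.refl)
    cases (no e≰D)  = conclude algorithm (rejects e≰D) z≤n (no-high-root F n f t₁∈ 1≤t₁ (ℕ.≰⇒> e≰D))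

  correct : IsRootOf O (output O algorithm f) f × time O algorithm f ≤ costOf algorithm X + s * cost
  correct = cases (e ℕ.≤? D)

-- The factor 2 ^ j has to be absorbed into the leading constant, and since that constant is also
-- the exponent, the latter grows with it.
PolyBounded-double : ∀ {f} → PolyBounded f → PolyBounded (λ m → f (2 * m))
PolyBounded-double {f} (j , bound) = j * 2 ^ j , λ m 1≤m → begin
  f (2 * m)                       ≤⟨ bound (2 * m) (ℕ.≤-trans 1≤m (ℕ.m≤n*m m 2)) ⟩
  j * (2 * m) ^ j                 ≡⟨ ≡.cong (j *_) (*-^ 2 m j) ⟩
  j * (2 ^ j * m ^ j)             ≡⟨ ℕ.*-assoc j (2 ^ j) (m ^ j) ⟨
  j * 2 ^ j * m ^ j               ≤⟨ ℕ.*-monoʳ-≤ (j * 2 ^ j) (ℕ.^-monoʳ-≤ m {{ℕ.>-nonZero 1≤m}} (ℕ.m≤m*n j (2 ^ j) {{ℕ.m^n≢0 2 j}})) ⟩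
  j * 2 ^ j * m ^ (j * 2 ^ j)     ∎
  where open ℕ.≤-Reasoning

abstract
  polynomial-bound : PolyBounded (λ m → costOf algorithm (2 * m))
  polynomial-bound = PolyBounded-double {costOf algorithm} (costOf-poly algorithm)

theorem5p2 : (a ℓ : Level) →
    Σ Algorithm λ A → Σ ℕ λ c → Σ ℕ λ k →
      (F : Field a ℓ) (n : ℕ) (f : SparsePoly F n) → NonConstant f →
      (e : ℕ) → 2 ≤ e →
      (O : RootOracle F e) →
      let s = ‖ f ‖₀
          d = indeg f
          D = tdeg f
          R = RootOracle.cost O
      in IsRootOf O (output O A f) f ×
         time O A f ≤ k * (s ^ (c * (D * d)) + n + d + D) ^ k + s * R
theorem5p2 a ℓ = algorithm , 3 , proj₁ polynomial-bound , λ F n f nonconstant e 2≤e O →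
  let open Correctness F n f nonconstant e (ℕ.≤-trans (s≤s z≤n) 2≤e) O in
  proj₁ correct , ℕ.≤-trans (proj₂ correct) (ℕ.+-monoˡ-≤ _ (proj₂ polynomial-bound size 1≤size))
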